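{- Let $(G,X,H,f)$ be a constructible configuration. For every block $B$ of $G$ let $X^B$ be the restriction of $X$ to $V(B)$ and let $H^B=H[\bigcup_{v\in V(B)}X_v]$. Let $\mathcal{B}(G)$ be the set of blocks of $G$ and $\mathcal{B}_v(G)$ the set of blocks of $G$ containing $v$. Then for every $B\in\mathcal{B}(G)$ there is a unique function $f^B:V(H^B)\to\mathbb{N}_0$ such that (these functions together satisfying) $(B,X^B,H^B,f^B)$ is an M-, K- or C-configuration for every $B\in\mathcal{B}(G)$, and, for all $v\in V(G)$ and $x\in X_v$, $$f(x)=\sum_{B\in\mathcal{B}_v(G)}f^B(x).$$
   Context: $\mathbb{N}=\{1,2,\dots\}$, $\mathbb{N}_0=\mathbb{N}\cup\{0\}$. Graphs are finite, undirected, may have multiple edges, no loops; connected graphs are non-empty. $\mu_G(u,v)$ is the number of edges joining $u,v$; $d_G(v)$ is the number of edges incident with $v$. $tG$ has vertex set $V(G)$ and $\mu_{tG}=t\mu_G$. $K_n$, $C_n$ ($n\ge3$), $K_{s,s}$ are the simple complete graph, cycle, complete bipartite graph. A block of a graph is a maximal connected subgraph $B$ that has no separating vertex (vertex whose deletion from $B$ leaves at least two components); $G$ is a block if it is its own only block. Covers. A cover of $G$ is a pair $(X,H)$, $H$ a graph, $X$ assigning to each $v\in V(G)$ a set $X_v\subseteq V(H)$, such that the $X_v$ are pairwise disjoint with union $V(H)$, each $X_v$ is independent in $H$, and for distinct $u,v\in V(G)$ the set of edges of $H$ between $X_u$ and $X_v$ is the union of $\mu_G(u,v)$ (possibly empty)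 matchings. For $U\subseteq V(H)$ put $X_v(U)=X_v\cap U$; $(X,H)/U$ is the cover $(X',H[U])$ of $G[\{v: X_v(U)\ne\varnothing\}]$ with $X'_v=X_v(U)$. Configurations. A configuration is a tuple $(G,X,H,f)$ with $(X,H)$ a cover of the graph $G$ and $f:V(H)\to\mathbb{N}_0$. It is uniform if for some $r\ge1$ all $|X_v|=r$. Special covers (all up to renaming vertices of the cover graph). A $G$-cover is a cover with $X_v=\{x_v\}$ for all $v$ and $\mu_H(x_u,x_v)=\mu_G(u,v)$ for all distinct $u,v$. For $G=tC_n$ with $C_n=(v_1,\dots,v_n,v_1)$, a double $G$-cover is a cover with $X_{v_i}=\{x_i,x_{n+i}\}$ ($1\le i\le n$), $\mu_H(x_i,x_j)=t$ if $i-j\equiv\pm1 \pmod{2n}$ and $\mu_H(x_i,x_j)=0$ otherwise. If $s\in\mathbb{N}$ divides all multiplicities $\mu_H(x,y)$, the $s$-inflation of $(X,H)$ is the cover $(\tilde X,\tilde H)$ of $G$ obtained by replacing every $x\in V(H)$ by a set $U_x$ of $s$ new vertices, with $\tilde X_v=\bigcup_{x\in X_v}U_x$, and for distinct $x,y\in V(H)$ placing a copy of $mK_{s,s}$ with parts $U_x,U_y$, where $m=\mu_H(x,y)/s$. An inflation is an $s$-inflation for some $s\in\mathbb{N}$. Constructible configurations. The family of constructible configurations is defined recursively: a uniform configuration $(G,X,H,f)$ is constructible if one of the following holds. (K1) M-configuration: $G$ is a block and there is $U\subseteq V(H)$ such that $(X,H)/U$ is an inflation of a $G$-cover, and for $v\in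 V(G)$, $x\in X_v$: $f(x)=d_G(v)/|X_v(U)|$ if $x\in U$, else $f(x)=0$. (K2) K-configuration: $G=tK_n$ with $t,n\in\mathbb{N}$ and there are $p\ge1$, $n_1,\dots,n_p\in\mathbb{N}$ with $n_1+\dots+n_p=n-1$ and pairwise disjoint $U_1,\dots,U_p\subseteq V(H)$ such that each $(X,H)/U_i$ is an inflation of a $G$-cover, and for $v\in V(G)$, $x\in X_v$: $f(x)=tn_i/|X_v(U_i)|$ if $x\in U_i$ for some $i$, else $f(x)=0$. (K3) Odd C-configuration: $G=tC_n$ with $t\in\mathbb{N}$, $n\ge3$ odd, and there are disjoint $U_1,U_2\subseteq V(H)$ such that each $(X,H)/U_i$ is an inflation of a $G$-cover, and for $v\in V(G)$, $x\in X_v$: $f(x)=t/|X_v(U_i)|$ if $x\in U_i$ for $i\in\{1,2\}$, else $f(x)=0$. (K4) Even C-configuration: $G=tC_n$ with $t\in\mathbb{N}$, $n\ge4$ even, and there is $U\subseteq V(H)$ such that $(X,H)/U$ is an inflation of a double $G$-cover, and for $v\in V(G)$, $x\in X_v$: $f(x)=2t/|X_v(U)|$ if $x\in U$, else $f(x)=0$. (K5) There are two disjoint constructible configurations $(G^1,X^1,H^1,f^1)$, $(G^2,X^2,H^2,f^2)$ such that $G$ is obtained from the disjoint graphs $G^1,G^2$ by identifying a vertex $v^1\in V(G^1)$ and a vertex $v^2\in V(G^2)$ to a new vertex $v^*$; $H$ is obtained from the disjoint graphs $H^1,H^2$ by choosing a bijection $\pi:X^1_{v^1}\to X^2_{v^2}$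 and identifying each $x\in X^1_{v^1}$ with $\pi(x)$ to a vertex $x^*$ (so $X_{v^*}$ is the set of these $x^*$, and $X_v=X^i_v$ for other $v\in V(G^i)$); and $f(y)=f^i(y)$ for $y\in V(H^i)\setminus X^i_{v^i}$, $f(x^*)=f^1(x)+f^2(\pi(x))$ for $x\in X^1_{v^1}$. A C-configuration is an odd or an even C-configuration. -}

module Defs where

open import Data.Bool.Base using (Bool; true; false; if_then_else_; _∧_; _∨_)
open import Data.Bool.Properties using (∧-comm; ∨-comm)
open import Data.Fin.Base using (Fin; toℕ; _↑ˡ_; _↑ʳ_)
open import Data.Fin.Properties using (_≟_; all?; any?)
open import Data.Fin.Subset
open import Data.Fin.Subset.Properties
open import Data.List.Base as List using (List; []; _∷_; _++_; length; filter; allFin)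
open import Data.List.Membership.Propositional using () renaming (_∈_ to _∈ˡ_)
open import Data.List.Membership.Propositional.Properties
  using (∈-map⁺; ∈-map⁻; ∈-++⁺ˡ; ∈-++⁺ʳ; ∈-filter⁺; ∈-filter⁻; ∈-allFin)
open import Data.List.Relation.Unary.All as All using (All)
open import Data.List.Relation.Unary.All.Properties using (all-filter)
open import Data.List.Relation.Unary.AllPairs as AllPairs using (AllPairs)
open import Data.List.Relation.Unary.AllPairs.Properties as AllPairsₚ using ()
open import Data.List.Relation.Unary.Any using (here; there)
open import Data.List.Relation.Unary.Unique.Propositional using (Unique)
import Data.List.Relation.Unary.Unique.Propositional.Properties as Unique
open import Data.Nat.Base using (ℕ; zero; suc; _+_; _*_; _≤_; _≥_; _≡ᵇ_; NonZero; z≤n)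
open import Data.Nat.DivMod using (_/_; _%_)
open import Data.Nat.Divisibility using (_∣_)
open import Data.Nat.Properties
  using (+-0-commutativeMonoid; *-zeroʳ; ≤-refl; ≤-reflexive; ≤-trans; n≤0⇒n≡0)
  renaming (_≟_ to _≟ℕ_)
open import Data.Product using (Σ; Σ-syntax; ∃; ∃-syntax; _×_; _,_; proj₁; proj₂)
open import Data.Sum.Base using (_⊎_; inj₁; inj₂)
open import Data.Vec.Base using ([]; _∷_)
open import Data.Vec.Properties using (∷-injectiveʳ)
open import Function.Base using (_∘_; id)
open import Function.Bundles using (_⇔_)
open import Relation.Binary.Construct.Closure.ReflexiveTransitive as Star
  using (Star; ε; _◅_; _◅◅_)
open import Relation.Binary.PropositionalEquality
  using (_≡_; _≢_; refl; sym; trans; cong; cong₂; subst)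
open import Relation.Nullary
  using (¬_; Dec; yes; no; does; ¬?; _×-dec_; _⊎-dec_; _→-dec_; contradiction)
open import Relation.Nullary.Decidable using (map′)
open import Algebra.Properties.CommutativeMonoid.Sum +-0-commutativeMonoid
  using (sum; sum-syntax) public

private variable
  n m l n₁ m₁ n₂ m₂ : ℕ

-- A finite loopless multigraph whose vertices are some of the elements
-- of Fin n.  A graph and its subgraphs thus live over the same Fin n.
record Graph (n : ℕ) : Set where
  field
    V          : Subset n
    μ          : Fin n → Fin n → ℕ
    μ-sym      : ∀ u v → μ u v ≡ μ v u
    μ-loopless : ∀ v → μ v v ≡ 0
    μ-support  : ∀ u v → u ∉ V → μ u v ≡ 0

open Graph public

degree : Graph n → Fin n → ℕ
degree {n} G v = ∑[ u < n ] μ G v u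

infix 4 _⊑_ _≈_

record _⊑_ (B G : Graph n) : Set where
  constructor sub
  field
    V-⊆ : V B ⊆ V G
    μ-≤ : ∀ u v → μ B u v ≤ μ G u v

open _⊑_ public

_≈_ : Graph n → Graph n → Set
B ≈ G = B ⊑ G × G ⊑ B

infixl 9 _[_]

_[_] : Graph n → Subset n → Graph n
G [ S ] = record
  { V          = V G ∩ S
  ; μ          = λ u v → if does (u ∈? S) ∧ does (v ∈? S) then μ G u v else 0
  ; μ-sym      = λ u v → cong₂ (λ b k → if b then k else 0)
                               (∧-comm (does (u ∈? S)) (does (v ∈? S))) (μ-sym G u v)
  ; μ-loopless = λ v → lem (does (v ∈? S) ∧ does (v ∈? S)) (μ-loopless G v)
  ; μ-support  = support
  }
  where
  lem : ∀ b {j} → j ≡ 0 → (if b then j else 0) ≡ 0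
  lem true  eq = eq
  lem false _  = refl
  support : ∀ u v → u ∉ V G ∩ S →
            (if does (u ∈? S) ∧ does (v ∈? S) then μ G u v else 0) ≡ 0
  support u v u∉ with u ∈? S
  ... | no  _   = refl
  ... | yes u∈S = lem (does (v ∈? S)) (μ-support G u v λ u∈G → u∉ (x∈p∩q⁺ (u∈G , u∈S)))

infixr 8 _·_

_·_ : ℕ → Graph n → Graph n
t · G = record
  { V          = V G
  ; μ          = λ u v → t * μ G u v
  ; μ-sym      = λ u v → cong (t *_) (μ-sym G u v)
  ; μ-loopless = λ v → trans (cong (t *_) (μ-loopless G v)) (*-zeroʳ t)
  ; μ-support  = λ u v u∉ → trans (cong (t *_) (μ-support G u v u∉)) (*-zeroʳ t)
  }

-- The simple graph on all of Fin n joining distinct u and v whenever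
-- adj u v or adj v u.
simple : (Fin n → Fin n → Bool) → Graph n
simple {n} adj = record
  { V          = ⊤
  ; μ          = mult
  ; μ-sym      = symm
  ; μ-loopless = loopless
  ; μ-support  = λ _ _ u∉ → contradiction ∈⊤ u∉
  }
  where
  mult : Fin n → Fin n → ℕ
  mult u v with u ≟ v
  ... | yes _ = 0
  ... | no  _ = if adj u v ∨ adj v u then 1 else 0
  symm : ∀ u v → mult u v ≡ mult v u
  symm u v with u ≟ v | v ≟ u
  ... | yes _   | yes _   = refl
  ... | no  _   | no  _   = cong (if_then 1 else 0) (∨-comm (adj u v) (adj v u))
  ... | yes u≡v | no  v≢u = contradiction (sym u≡v) v≢u
  ... | no  u≢v | yes v≡u = contradiction (sym v≡u) u≢v
  loopless : ∀ v → mult v v ≡ 0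
  loopless v with v ≟ v
  ... | yes _   = refl
  ... | no  v≢v = contradiction refl v≢v

K : ∀ n → Graph n
K n = simple λ _ _ → true

-- Only meaningful for n ≥ 3.
C : ∀ n → Graph n
C zero      = K zero
C n@(suc _) = simple λ i j → (suc (toℕ i) % n) ≡ᵇ toℕ j

infix 4 _≅_

-- Isomorphism, given by a map on all labels of which only the values
-- on V S matter.
record _≅_ (S : Graph l) (G : Graph n) : Set where
  field
    to         : Fin l → Fin n
    to-∈       : ∀ {i} → i ∈ V S → to i ∈ V G
    injective  : ∀ {i j} → i ∈ V S → j ∈ V S → to i ≡ to j → i ≡ j
    surjective : ∀ {v} → v ∈ V G → ∃[ i ] i ∈ V S × to i ≡ v
    to-μ       : ∀ {i j} → i ∈ V S → j ∈ V S → μ G (to i) (to j) ≡ μ S i j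

Adjacent : Graph n → Fin n → Fin n → Set
Adjacent G u v = μ G u v ≢ 0

Joined : Graph n → Fin n → Fin n → Set
Joined G = Star (Adjacent G)

Connected : Graph n → Set
Connected G = Nonempty (V G) × (∀ u v → u ∈ V G → v ∈ V G → Joined G u v)

_⊖_ : Graph n → Fin n → Graph n
G ⊖ v = G [ ∁ ⁅ v ⁆ ]

Separating : Graph n → Fin n → Set
Separating B v = v ∈ V B ×
  (∃[ u ] ∃[ w ] u ∈ V (B ⊖ v) × w ∈ V (B ⊖ v) × ¬ Joined (B ⊖ v) u w)

ConnectedNonseparable : Graph n → Set
ConnectedNonseparable B = Connected B × ¬ ∃ (Separating B)

infix 4 _IsBlockOf_

_IsBlockOf_ : Graph n → Graph n → Set
B IsBlockOf G = B ⊑ G × ConnectedNonseparable B ×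
  (∀ B′ → B′ ⊑ G → ConnectedNonseparable B′ → B ⊑ B′ → B′ ⊑ B)

IsBlock : Graph n → Set
IsBlock G = G IsBlockOf G × (∀ B → B IsBlockOf G → B ≈ G)

-- A block is an induced subgraph, so the blocks of G are found by deciding
-- InducedBlock for all S ⊆ V G.  By blocks-sound, blocks-complete and
-- blocks-distinct, blocks G lists every block exactly once up to ≈.

module _ {A : Set} {R : A → A → Set} where

  -- Walks whose inner vertices are taken from a list.
  Via : List A → A → A → Set
  Via []      x y = x ≡ y ⊎ R x y
  Via (c ∷ L) x y = Via L x y ⊎ (Via L x c × Via L c y)

  via⇒star : ∀ L {x y} → Via L x y → Star R x y
  via⇒star []      (inj₁ refl)    = ε
  via⇒star []      (inj₂ r)       = r ◅ ε
  via⇒star (c ∷ L) (inj₁ p)       = via⇒star L p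
  via⇒star (c ∷ L) (inj₂ (p , q)) = via⇒star L p ◅◅ via⇒star L q

  via-base : ∀ L {x y} → x ≡ y ⊎ R x y → Via L x y
  via-base []      b = b
  via-base (_ ∷ L) b = inj₁ (via-base L b)

  via-trans : ∀ L {x c y} → c ∈ˡ L → Via L x c → Via L c y → Via L x y
  via-trans (c ∷ L) (here refl) p q = inj₂ (first p , second q)
    where
    first : ∀ {x} → Via (c ∷ L) x c → Via L x c
    first (inj₁ r)       = r
    first (inj₂ (r , _)) = r
    second : ∀ {y} → Via (c ∷ L) c y → Via L c y
    second (inj₁ r)       = r
    second (inj₂ (_ , r)) = r
  via-trans (_ ∷ L) (there i) (inj₁ p) (inj₁ q) = inj₁ (via-trans L i p q)
  via-trans (_ ∷ L) (there i) (inj₁ p) (inj₂ (q , r)) = inj₂ (via-trans L i p q , r)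
  via-trans (_ ∷ L) (there i) (inj₂ (p , q)) (inj₁ r) = inj₂ (p , via-trans L i q r)
  via-trans (_ ∷ L) (there i) (inj₂ (p , _)) (inj₂ (_ , r)) = inj₂ (p , r)

  star⇒via : ∀ L → (∀ x → x ∈ˡ L) → ∀ {x y} → Star R x y → Via L x y
  star⇒via L full ε            = via-base L (inj₁ refl)
  star⇒via L full (r ◅ rs) =
    via-trans L (full _) (via-base L (inj₂ r)) (star⇒via L full rs)

  via? : (∀ x y → Dec (x ≡ y)) → (∀ x y → Dec (R x y)) → ∀ L x y → Dec (Via L x y)
  via? eq? R? []      x y = eq? x y ⊎-dec R? x y
  via? eq? R? (c ∷ L) x y =
    via? eq? R? L x y ⊎-dec (via? eq? R? L x c ×-dec via? eq? R? L c y)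

joined? : (G : Graph n) → ∀ u v → Dec (Joined G u v)
joined? {n} G u v = map′ (via⇒star (allFin n)) (star⇒via (allFin n) ∈-allFin)
  (via? _≟_ (λ x y → ¬? (μ G x y ≟ℕ 0)) (allFin n) u v)

connectedNonseparable? : (G : Graph n) → Dec (ConnectedNonseparable G)
connectedNonseparable? G =
  (nonempty? (V G) ×-dec
   all? λ u → all? λ v → u ∈? V G →-dec (v ∈? V G →-dec joined? G u v))
  ×-dec
  ¬? (any? λ v → v ∈? V G ×-dec
       (any? λ u → any? λ w → u ∈? V (G ⊖ v) ×-dec w ∈? V (G ⊖ v)
         ×-dec ¬? (joined? (G ⊖ v) u w)))

⊑-refl : {G : Graph n} → G ⊑ G
⊑-refl = sub id λ _ _ → ≤-refl

⊑-trans : {A B D : Graph n} → A ⊑ B → B ⊑ D → A ⊑ D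
⊑-trans (sub p q) (sub r s) = sub (r ∘ p) λ u v → ≤-trans (q u v) (s u v)

[]-⊑ : (G : Graph n) (S : Subset n) → G [ S ] ⊑ G
[]-⊑ G S = sub (p∩q⊆p (V G) S) λ u v → lem (does (u ∈? S) ∧ does (v ∈? S))
  where
  lem : ∀ b {j} → (if b then j else 0) ≤ j
  lem true  = ≤-refl
  lem false = z≤n

[]-mono : {B D : Graph n} {S T : Subset n} → B ⊑ D → S ⊆ T → B [ S ] ⊑ D [ T ]
[]-mono {B = B} {D} {S} {T} (sub p q) S⊆T = sub vs es
  where
  vs : V (B [ S ]) ⊆ V (D [ T ])
  vs x∈ with x∈p∩q⁻ (V B) S x∈
  ... | x∈B , x∈S = x∈p∩q⁺ (p x∈B , S⊆T x∈S)
  es : ∀ u v → μ (B [ S ]) u v ≤ μ (D [ T ]) u v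
  es u v with u ∈? S | v ∈? S | u ∈? T | v ∈? T
  ... | no _    | _       | _      | _      = z≤n
  ... | yes _   | no _    | _      | _      = z≤n
  ... | yes _   | yes _   | yes _  | yes _  = q u v
  ... | yes u∈S | yes _   | no u∉T | _      = contradiction (S⊆T u∈S) u∉T
  ... | yes _   | yes v∈S | yes _  | no v∉T = contradiction (S⊆T v∈S) v∉T

⊑-induced : {B G : Graph n} → B ⊑ G → B ⊑ G [ V B ]
⊑-induced {B = B} {G} (sub p q) = sub (λ x∈ → x∈p∩q⁺ (p x∈ , x∈)) es
  where
  es : ∀ u v → μ B u v ≤ μ (G [ V B ]) u v
  es u v with u ∈? V B | v ∈? V B
  ... | yes _  | yes _  = q u v
  ... | no u∉B | _      = ≤-reflexive (μ-support B u v u∉B)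
  ... | yes _  | no v∉B = ≤-reflexive (trans (μ-sym B u v) (μ-support B v u v∉B))

joined-mono : {B D : Graph n} → B ⊑ D → ∀ {u v} → Joined B u v → Joined D u v
joined-mono {B = B} {D} (sub _ q) = Star.map λ {u} {v} adj eq →
  adj (n≤0⇒n≡0 (subst (μ B u v ≤_) eq (q u v)))

-- Adding edges does not destroy the property.
connectedNonseparable-mono : {B D : Graph n} → B ⊑ D → V D ⊆ V B →
  ConnectedNonseparable B → ConnectedNonseparable D
connectedNonseparable-mono {B = B} {D} B⊑D D⊆B (((x , x∈B) , conn) , nonsep) =
  ( (x , V-⊆ B⊑D x∈B)
  , λ u v u∈ v∈ → joined-mono B⊑D (conn u v (D⊆B u∈) (D⊆B v∈)) )
  , λ { (v , v∈ , u , w , u∈ , w∈ , ¬j) → nonsep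
        ( v , D⊆B v∈ , u , w , back v u∈ , back v w∈
        , ¬j ∘ joined-mono ([]-mono B⊑D id) ) }
  where
  back : ∀ v {u} → u ∈ V (D ⊖ v) → u ∈ V (B ⊖ v)
  back v u∈ with x∈p∩q⁻ (V D) (∁ ⁅ v ⁆) u∈
  ... | u∈D , u≢v = x∈p∩q⁺ (D⊆B u∈D , u≢v)

InducedBlock : Graph n → Subset n → Set
InducedBlock G S = S ⊆ V G × G [ S ] IsBlockOf G

inducedBlock? : (G : Graph n) (S : Subset n) → Dec (InducedBlock G S)
inducedBlock? G S = map′ to from
  (S ⊆? V G ×-dec connectedNonseparable? (G [ S ]) ×-dec ¬? (anySubset? larger?))
  where
  Larger : Subset _ → Set
  Larger T = T ⊆ V G × ConnectedNonseparable (G [ T ]) × S ⊆ T × ¬ T ⊆ S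
  larger? : ∀ T → Dec (Larger T)
  larger? T = T ⊆? V G ×-dec connectedNonseparable? (G [ T ])
    ×-dec S ⊆? T ×-dec ¬? (T ⊆? S)
  to : S ⊆ V G × ConnectedNonseparable (G [ S ]) × ¬ ∃ Larger → InducedBlock G S
  to (S⊆G , cn , max) = S⊆G , []-⊑ G S , cn , maximal
    where
    maximal : ∀ B′ → B′ ⊑ G → ConnectedNonseparable B′ →
              G [ S ] ⊑ B′ → B′ ⊑ G [ S ]
    maximal B′ B′⊑G cn′ S⊑B′ with V B′ ⊆? S
    ... | yes B′⊆S = ⊑-trans (⊑-induced B′⊑G) ([]-mono ⊑-refl B′⊆S)
    ... | no  B′⊈S = contradiction
      ( V B′ , (λ {x} → V-⊆ B′⊑G {x})
      , connectedNonseparable-mono (⊑-induced B′⊑G) (p∩q⊆q (V G) (V B′)) cn′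
      , (λ {x} x∈ → V-⊆ S⊑B′ (x∈p∩q⁺ (S⊆G x∈ , x∈)))
      , λ B′⊆S → B′⊈S λ {x} → B′⊆S {x} ) max
  from : InducedBlock G S → S ⊆ V G × ConnectedNonseparable (G [ S ]) × ¬ ∃ Larger
  from (S⊆G , _ , cn , max) = S⊆G , cn ,
    λ { (T , T⊆G , cn′ , S⊆T , T⊈S) → T⊈S λ x∈ →
        p∩q⊆q (V G) S (V-⊆ (max (G [ T ]) ([]-⊑ G T) cn′ ([]-mono ⊑-refl S⊆T))
          (x∈p∩q⁺ (T⊆G x∈ , x∈))) }

subsets : ∀ n → List (Subset n)
subsets zero    = [] ∷ []
subsets (suc n) = List.map (outside ∷_) (subsets n) ++ List.map (inside ∷_) (subsets n)

∈-subsets : (S : Subset n) → S ∈ˡ subsets n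
∈-subsets []            = here refl
∈-subsets (outside ∷ S) = ∈-++⁺ˡ (∈-map⁺ (outside ∷_) (∈-subsets S))
∈-subsets (inside  ∷ S) = ∈-++⁺ʳ _ (∈-map⁺ (inside ∷_) (∈-subsets S))

subsets-unique : ∀ n → Unique (subsets n)
subsets-unique zero    = All.[] AllPairs.∷ AllPairs.[]
subsets-unique (suc n) = Unique.++⁺
  (Unique.map⁺ ∷-injectiveʳ (subsets-unique n))
  (Unique.map⁺ ∷-injectiveʳ (subsets-unique n))
  λ (p , q) → disjoint (∈-map⁻ (outside ∷_) p) (∈-map⁻ (inside ∷_) q)
  where
  disjoint : ∀ {S : Subset (suc n)} →
    (∃ λ T → T ∈ˡ subsets n × S ≡ outside ∷ T) →
    ¬ (∃ λ T → T ∈ˡ subsets n × S ≡ inside ∷ T)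
  disjoint (_ , _ , refl) (_ , _ , ())

blockSets : Graph n → List (Subset n)
blockSets {n} G = filter (inducedBlock? G) (subsets n)

blocks : Graph n → List (Graph n)
blocks G = List.map (G [_]) (blockSets G)

blocks-sound : {G B : Graph n} → B ∈ˡ blocks G → B IsBlockOf G
blocks-sound {G = G} B∈ with ∈-map⁻ (G [_]) B∈
... | S , S∈ , refl = proj₂ (proj₂ (∈-filter⁻ (inducedBlock? G) {xs = subsets _} S∈))

blocks-complete : {G B : Graph n} → B IsBlockOf G → ∃[ B′ ] B′ ∈ˡ blocks G × B ≈ B′
blocks-complete {G = G} {B} (B⊑G , cn , max) =
  G [ V B ]
  , ∈-map⁺ (G [_]) (∈-filter⁺ (inducedBlock? G) (∈-subsets (V B))
      ( (λ {x} → V-⊆ B⊑G {x}) , []-⊑ G (V B) , cn′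
      , λ B′ B′⊑G cn″ le → ⊑-trans (max B′ B′⊑G cn″ (⊑-trans ind le)) ind ))
  , ind , max _ ([]-⊑ G (V B)) cn′ ind
  where
  ind : B ⊑ G [ V B ]
  ind = ⊑-induced B⊑G
  cn′ : ConnectedNonseparable (G [ V B ])
  cn′ = connectedNonseparable-mono ind (p∩q⊆q (V G) (V B)) cn

blocks-distinct : (G : Graph n) → AllPairs (λ B B′ → ¬ B ≈ B′) (blocks G)
blocks-distinct {n} G = AllPairsₚ.map⁺ (pairs
  (All.map proj₁ (all-filter (inducedBlock? G) (subsets n)))
  (Unique.filter⁺ (inducedBlock? G) (subsets-unique n)))
  where
  ⊑⇒⊆ : ∀ {S T} → S ⊆ V G → G [ S ] ⊑ G [ T ] → S ⊆ T
  ⊑⇒⊆ {S} {T} S⊆G (sub p _) x∈ = p∩q⊆q (V G) T (p (x∈p∩q⁺ (S⊆G x∈ , x∈)))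
  distinct : ∀ {S T} → S ⊆ V G → T ⊆ V G → S ≢ T → ¬ G [ S ] ≈ G [ T ]
  distinct S⊆G T⊆G S≢T (p , q) = S≢T (⊆-antisym (⊑⇒⊆ S⊆G p) (⊑⇒⊆ T⊆G q))
  heads : ∀ {S Ss} → S ⊆ V G → All (_⊆ V G) Ss → All (S ≢_) Ss →
          All (λ T → ¬ G [ S ] ≈ G [ T ]) Ss
  heads S⊆G All.[]           All.[]         = All.[]
  heads S⊆G (T⊆G All.∷ T⊆Gs) (S≢T All.∷ S≢) = distinct S⊆G T⊆G S≢T All.∷ heads S⊆G T⊆Gs S≢
  pairs : ∀ {Ss} → All (_⊆ V G) Ss → Unique Ss →
          AllPairs (λ S T → ¬ G [ S ] ≈ G [ T ]) Ss
  pairs All.[]            AllPairs.[]       = AllPairs.[]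
  pairs (S⊆G All.∷ S⊆Gs) (S≢ AllPairs.∷ u) = heads S⊆G S⊆Gs S≢ AllPairs.∷ pairs S⊆Gs u

BlockIndex : Graph n → Set
BlockIndex G = Fin (length (blocks G))

block : (G : Graph n) → BlockIndex G → Graph n
block G = List.lookup (blocks G)

-- X v is only relevant for vertices v of the graph being covered, so the
-- same X also serves as its own restriction to a subgraph.
Assignment : ℕ → ℕ → Set
Assignment n m = Fin n → Subset m

-- Fin (μ H x y) is the set of edges joining x and y, so that E x y picks
-- some of these.
EdgeSet : Graph m → Set
EdgeSet H = ∀ x y → Subset (μ H x y)

record IsMatching (H : Graph m) (P Q : Subset m) (E : EdgeSet H) : Set where
  field
    uniqueʳ : ∀ {x y y′} → x ∈ P → y ∈ Q → y′ ∈ Q →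
              ∀ {e e′} → e ∈ E x y → e′ ∈ E x y′ →
              _≡_ {A = Σ[ z ∈ Fin m ] Fin (μ H x z)} (y , e) (y′ , e′)
    uniqueˡ : ∀ {x x′ y} → x ∈ P → x′ ∈ P → y ∈ Q →
              ∀ {e e′} → e ∈ E x y → e′ ∈ E x′ y →
              _≡_ {A = Σ[ z ∈ Fin m ] Fin (μ H z y)} (x , e) (x′ , e′)

-- The edges between P and Q (for disjoint P and Q) form a union of k
-- matchings.
UnionOfMatchings : Graph m → (P Q : Subset m) → ℕ → Set
UnionOfMatchings H P Q k = Σ[ E ∈ (Fin k → EdgeSet H) ]
  (∀ i → IsMatching H P Q (E i)) ×
  (∀ {x y} → x ∈ P → y ∈ Q → ∀ e → ∃[ i ] e ∈ E i x y)

record IsCover (G : Graph n) (X : Assignment n m) (H : Graph m) : Set where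
  field
    disjoint    : ∀ {u v} → u ∈ V G → v ∈ V G → u ≢ v → Empty (X u ∩ X v)
    union       : ∀ {x} → x ∈ V H ⇔ (∃[ v ] v ∈ V G × x ∈ X v)
    independent : ∀ {v} → v ∈ V G → ∀ {x y} → x ∈ X v → y ∈ X v → μ H x y ≡ 0
    matchings   : ∀ {u v} → u ∈ V G → v ∈ V G → u ≢ v →
                  UnionOfMatchings H (X u) (X v) (μ G u v)

-- Together with H [ U ] this is the cover (X , H) / U.
_↾_ : Assignment n m → Subset m → Assignment n m
(X ↾ U) v = X v ∩ U

record IsGCover (G : Graph n) (X : Assignment n m) (H : Graph m) : Set where
  field
    isCover   : IsCover G X H
    x         : Fin n → Fin m
    singleton : ∀ {v} → v ∈ V G → X v ≡ ⁅ x v ⁆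
    x-μ       : ∀ {u v} → u ∈ V G → v ∈ V G → u ≢ v → μ H (x u) (x v) ≡ μ G u v

-- With c labelling the underlying cycle as (v₁ , … , vₖ , v₁), the
-- vertices of H are x₁ , … , x₂ₖ, and they form t C₂ₖ in this order.
record IsDoubleCover (G : Graph n) (t k : ℕ) (c : t · C k ≅ G)
                     (X : Assignment n m) (H : Graph m) : Set where
  field
    isCover   : IsCover G X H
    x         : Fin (k + k) → Fin m
    injective : ∀ {i j} → x i ≡ x j → i ≡ j
    pair      : ∀ i → X (_≅_.to c i) ≡ ⁅ x (i ↑ˡ k) ⁆ ∪ ⁅ x (k ↑ʳ i) ⁆
    x-μ       : ∀ i j → μ H (x i) (x j) ≡ μ (t · C (k + k)) i j

record IsInflation (s : ℕ) .{{_ : NonZero s}} (G : Graph n)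
                   (X₀ : Assignment n m₁) (H₀ : Graph m₁)
                   (X : Assignment n m) (H : Graph m) : Set where
  field
    divides     : ∀ x y → s ∣ μ H₀ x y
    U           : Fin m₁ → Subset m
    size        : ∀ {x} → x ∈ V H₀ → ∣ U x ∣ ≡ s
    disjoint    : ∀ {x y} → x ∈ V H₀ → y ∈ V H₀ → x ≢ y → Empty (U x ∩ U y)
    vertices    : ∀ {z} → z ∈ V H ⇔ (∃[ x ] x ∈ V H₀ × z ∈ U x)
    assignment  : ∀ {v} → v ∈ V G → ∀ {z} → z ∈ X v ⇔ (∃[ x ] x ∈ X₀ v × z ∈ U x)
    independent : ∀ {x} → x ∈ V H₀ → ∀ {z w} → z ∈ U x → w ∈ U x → μ H z w ≡ 0
    bipartite   : ∀ {x y} → x ∈ V H₀ → y ∈ V H₀ → x ≢ y →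
                  ∀ {z w} → z ∈ U x → w ∈ U y → μ H z w ≡ μ H₀ x y / s

-- (X , H) is an inflation of some cover of G satisfying P.  Inflations have
-- X v nonempty for all v ∈ V G; hence, when (X , H) is (X′ , H′) / U,
-- the graph it covers is G itself.
InflationOf : (∀ {m₀} → Assignment n m₀ → Graph m₀ → Set) →
              Graph n → Assignment n m → Graph m → Set
InflationOf {n} P G X H =
  Σ[ m₀ ∈ ℕ ] Σ[ X₀ ∈ Assignment n m₀ ] Σ[ H₀ ∈ Graph m₀ ] P X₀ H₀ ×
  Σ[ s ∈ ℕ ] Σ[ s≢0 ∈ NonZero s ] IsInflation s {{s≢0}} G X₀ H₀ X H

-- The function f of a configuration is given on all labels of vertices of
-- H, but only its values on V H matter.  Equations f x = a / b with b > 0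
-- are stated as f x * b ≡ a.

Uniform : Graph n → Assignment n m → Graph m → Set
Uniform G X H = IsCover G X H ×
  (∃[ r ] r ≥ 1 × (∀ {v} → v ∈ V G → ∣ X v ∣ ≡ r))

record MConfiguration (G : Graph n) (X : Assignment n m) (H : Graph m)
                      (f : Fin m → ℕ) : Set where
  field
    uniform   : Uniform G X H
    isBlock   : IsBlock G
    U         : Subset m
    U⊆H       : U ⊆ V H
    inflation : InflationOf (IsGCover G) G (X ↾ U) (H [ U ])
    f-inside  : ∀ {v x} → v ∈ V G → x ∈ X v → x ∈ U → f x * ∣ X v ∩ U ∣ ≡ degree G v
    f-outside : ∀ {v x} → v ∈ V G → x ∈ X v → x ∉ U → f x ≡ 0

record KConfiguration (G : Graph n) (X : Assignment n m) (H : Graph m)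
                      (f : Fin m → ℕ) : Set where
  field
    uniform   : Uniform G X H
    t k       : ℕ
    t≥1       : t ≥ 1
    k≥1       : k ≥ 1
    complete  : t · K k ≅ G
    p         : ℕ
    p≥1       : p ≥ 1
    parts     : Fin p → ℕ
    parts≥1   : ∀ i → parts i ≥ 1
    parts-sum : suc (sum parts) ≡ k
    U         : Fin p → Subset m
    U⊆H       : ∀ i → U i ⊆ V H
    disjoint  : ∀ {i j} → i ≢ j → Empty (U i ∩ U j)
    inflation : ∀ i → InflationOf (IsGCover G) G (X ↾ U i) (H [ U i ])
    f-inside  : ∀ {v x} → v ∈ V G → x ∈ X v →
                ∀ i → x ∈ U i → f x * ∣ X v ∩ U i ∣ ≡ t * parts i
    f-outside : ∀ {v x} → v ∈ V G → x ∈ X v → (∀ i → x ∉ U i) → f x ≡ 0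

record OddCConfiguration (G : Graph n) (X : Assignment n m) (H : Graph m)
                         (f : Fin m → ℕ) : Set where
  field
    uniform   : Uniform G X H
    t k       : ℕ
    t≥1       : t ≥ 1
    k≥3       : k ≥ 3
    odd       : ¬ 2 ∣ k
    cycle     : t · C k ≅ G
    U         : Fin 2 → Subset m
    U⊆H       : ∀ i → U i ⊆ V H
    disjoint  : ∀ {i j} → i ≢ j → Empty (U i ∩ U j)
    inflation : ∀ i → InflationOf (IsGCover G) G (X ↾ U i) (H [ U i ])
    f-inside  : ∀ {v x} → v ∈ V G → x ∈ X v →
                ∀ i → x ∈ U i → f x * ∣ X v ∩ U i ∣ ≡ t
    f-outside : ∀ {v x} → v ∈ V G → x ∈ X v → (∀ i → x ∉ U i) → f x ≡ 0

record EvenCConfiguration (G : Graph n) (X : Assignment n m) (H : Graph m)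
                          (f : Fin m → ℕ) : Set where
  field
    uniform   : Uniform G X H
    t k       : ℕ
    t≥1       : t ≥ 1
    k≥4       : k ≥ 4
    even      : 2 ∣ k
    cycle     : t · C k ≅ G
    U         : Subset m
    U⊆H       : U ⊆ V H
    inflation : InflationOf (IsDoubleCover G t k cycle) G (X ↾ U) (H [ U ])
    f-inside  : ∀ {v x} → v ∈ V G → x ∈ X v → x ∈ U → f x * ∣ X v ∩ U ∣ ≡ 2 * t
    f-outside : ∀ {v x} → v ∈ V G → x ∈ X v → x ∉ U → f x ≡ 0

CConfiguration : (G : Graph n) (X : Assignment n m) (H : Graph m) (f : Fin m → ℕ) → Set
CConfiguration G X H f = OddCConfiguration G X H f ⊎ EvenCConfiguration G X H f

-- G is obtained from the disjoint graphs G₁ and G₂ by identifying a ∈ V G₁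
-- with b ∈ V G₂ whenever a ~ b.  Only used when ~ is a bijection between an
-- independent set of G₁ and one of G₂, so that no two edges get merged and
-- both clauses for μ agree where they overlap.
record Identification (G₁ : Graph n₁) (G₂ : Graph n₂)
                      (_~_ : Fin n₁ → Fin n₂ → Set) (G : Graph n) : Set where
  field
    ι₁         : Fin n₁ → Fin n
    ι₂         : Fin n₂ → Fin n
    ι₁-∈       : ∀ {a} → a ∈ V G₁ → ι₁ a ∈ V G
    ι₂-∈       : ∀ {b} → b ∈ V G₂ → ι₂ b ∈ V G
    ι₁-inj     : ∀ {a a′} → a ∈ V G₁ → a′ ∈ V G₁ → ι₁ a ≡ ι₁ a′ → a ≡ a′
    ι₂-inj     : ∀ {b b′} → b ∈ V G₂ → b′ ∈ V G₂ → ι₂ b ≡ ι₂ b′ → b ≡ b′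
    identified : ∀ {a b} → a ∈ V G₁ → b ∈ V G₂ → ι₁ a ≡ ι₂ b ⇔ a ~ b
    onto       : ∀ {v} → v ∈ V G →
                 (∃[ a ] a ∈ V G₁ × ι₁ a ≡ v) ⊎ (∃[ b ] b ∈ V G₂ × ι₂ b ≡ v)
    μ₁         : ∀ {a a′} → a ∈ V G₁ → a′ ∈ V G₁ → μ G (ι₁ a) (ι₁ a′) ≡ μ G₁ a a′
    μ₂         : ∀ {b b′} → b ∈ V G₂ → b′ ∈ V G₂ → μ G (ι₂ b) (ι₂ b′) ≡ μ G₂ b b′
    μ-across   : ∀ {a b} → a ∈ V G₁ → b ∈ V G₂ →
                 (∀ {b′} → b′ ∈ V G₂ → ¬ a ~ b′) → (∀ {a′} → a′ ∈ V G₁ → ¬ a′ ~ b) →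
                 μ G (ι₁ a) (ι₂ b) ≡ 0

record IsMerge (G₁ : Graph n₁) (X₁ : Assignment n₁ m₁) (H₁ : Graph m₁) (f₁ : Fin m₁ → ℕ)
               (G₂ : Graph n₂) (X₂ : Assignment n₂ m₂) (H₂ : Graph m₂) (f₂ : Fin m₂ → ℕ)
               (G : Graph n) (X : Assignment n m) (H : Graph m) (f : Fin m → ℕ) : Set where
  field
    v₁    : Fin n₁
    v₂    : Fin n₂
    v₁∈   : v₁ ∈ V G₁
    v₂∈   : v₂ ∈ V G₂
    graph : Identification G₁ G₂ (λ a b → a ≡ v₁ × b ≡ v₂) G
    π     : Fin m₁ → Fin m₂
    π-∈   : ∀ {x} → x ∈ X₁ v₁ → π x ∈ X₂ v₂
    π-inj : ∀ {x x′} → x ∈ X₁ v₁ → x′ ∈ X₁ v₁ → π x ≡ π x′ → x ≡ x′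
    π-sur : ∀ {y} → y ∈ X₂ v₂ → ∃[ x ] x ∈ X₁ v₁ × π x ≡ y
    cover : Identification H₁ H₂ (λ x y → x ∈ X₁ v₁ × π x ≡ y) H

  open Identification graph public using (ι₁; ι₂)
  open Identification cover public using () renaming (ι₁ to κ₁; ι₂ to κ₂)

  field
    X-left   : ∀ {a} → a ∈ V G₁ → ∀ {z} → z ∈ X (ι₁ a) ⇔ (∃[ x ] x ∈ X₁ a × κ₁ x ≡ z)
    X-right  : ∀ {b} → b ∈ V G₂ → ∀ {z} → z ∈ X (ι₂ b) ⇔ (∃[ y ] y ∈ X₂ b × κ₂ y ≡ z)
    f-left   : ∀ {x} → x ∈ V H₁ → x ∉ X₁ v₁ → f (κ₁ x) ≡ f₁ x
    f-right  : ∀ {y} → y ∈ V H₂ → y ∉ X₂ v₂ → f (κ₂ y) ≡ f₂ y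
    f-merged : ∀ {x} → x ∈ X₁ v₁ → f (κ₁ x) ≡ f₁ x + f₂ (π x)

data Constructible : (G : Graph n) (X : Assignment n m) (H : Graph m) (f : Fin m → ℕ) → Set where
  mConf : {G : Graph n} {X : Assignment n m} {H : Graph m} {f : Fin m → ℕ} →
          MConfiguration G X H f → Constructible G X H f
  kConf : {G : Graph n} {X : Assignment n m} {H : Graph m} {f : Fin m → ℕ} →
          KConfiguration G X H f → Constructible G X H f
  cConf : {G : Graph n} {X : Assignment n m} {H : Graph m} {f : Fin m → ℕ} →
          CConfiguration G X H f → Constructible G X H f
  merge : {G₁ : Graph n₁} {X₁ : Assignment n₁ m₁} {H₁ : Graph m₁} {f₁ : Fin m₁ → ℕ}
          {G₂ : Graph n₂} {X₂ : Assignment n₂ m₂} {H₂ : Graph m₂} {f₂ : Fin m₂ → ℕ}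
          {G : Graph n} {X : Assignment n m} {H : Graph m} {f : Fin m → ℕ} →
          Uniform G X H →
          Constructible G₁ X₁ H₁ f₁ → Constructible G₂ X₂ H₂ f₂ →
          IsMerge G₁ X₁ H₁ f₁ G₂ X₂ H₂ f₂ G X H f →
          Constructible G X H f

-- H [ ⋃ X v ], the union being over the vertices v of B.
coverOver : Graph n → Assignment n m → Graph m → Graph m
coverOver {n} B X H = H [ ⋃ (List.map X (filter (_∈? V B) (allFin n))) ]

BlockFunctions : Graph n → ℕ → Set
BlockFunctions G m = BlockIndex G → Fin m → ℕ

record IsBlockDecomposition (G : Graph n) (X : Assignment n m) (H : Graph m)
                            (f : Fin m → ℕ) (F : BlockFunctions G m) : Set where
  field
    configurations : ∀ i → let B = block G i ; Hᴮ = coverOver B X H in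
      MConfiguration B X Hᴮ (F i) ⊎ KConfiguration B X Hᴮ (F i) ⊎ CConfiguration B X Hᴮ (F i)
    sums : ∀ {v x} → v ∈ V G → x ∈ X v →
      f x ≡ ∑[ i < length (blocks G) ] (if does (v ∈? V (block G i)) then F i x else 0)

-- Equality of families of functions f^B : V(H^B) → ℕ.
SameBlockFunctions : (G : Graph n) (X : Assignment n m) (H : Graph m) →
                     BlockFunctions G m → BlockFunctions G m → Set
SameBlockFunctions G X H F F′ =
  ∀ i {x} → x ∈ V (coverOver (block G i) X H) → F i x ≡ F′ i x

{-# OPTIONS --safe #-}
module Submission where

-- Existence: embed the pieces of all merges into the final graph.  A connected
-- nonseparable subgraph cannot have vertices on both sides of an identified
-- vertex, so the blocks of a merge are those of its two parts, except that a
-- part consisting of a single vertex (whose function is 0) disappears.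
--
-- Uniqueness: in an inflation of a G-cover or of a double G-cover the edges at
-- a vertex x of U use up all matchings of the cover, so U is a union of
-- components of H.  Hence for all types of configurations f x / d (v) is
-- constant along the edges of H (x ∈ X v), and f x ≠ 0 only if x has a
-- neighbour: f is determined by its values off any one fibre X w.  Given two
-- decompositions of the same f, split G at a cut vertex v* and compare first on
-- the side not containing w, off X v*, where only blocks of this side count;
-- then subtract and go on with the other side.

open import Defs
open import Data.Bool.Base using (Bool; true; false; if_then_else_; _∧_; _∨_)
open import Data.Bool.Properties using () renaming (_≟_ to _≟ᵇ_)
open import Data.Fin.Base using (Fin; zero; suc; _↑ˡ_; _↑ʳ_; splitAt; toℕ; fromℕ<)
open import Data.Fin.Properties
  using (_≟_; any?; injective⇒≤; suc-injective; join-splitAt; toℕ<n; toℕ-fromℕ<;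
         toℕ-injective; toℕ-↑ˡ; toℕ-↑ʳ)
open import Data.Fin.Subset
open import Data.Fin.Subset.Properties
open import Data.List.Base as List using (List; []; _∷_; _++_; length; filter; allFin)
open import Data.List.Membership.Propositional using () renaming (_∈_ to _∈ˡ_)
open import Data.List.Membership.Propositional.Properties
  using (∈-map⁺; ∈-map⁻; ∈-++⁺ˡ; ∈-++⁺ʳ; ∈-++⁻; ∈-filter⁺; ∈-filter⁻; ∈-allFin)
open import Data.List.Membership.Propositional.Properties.WithK using (unique∧set⇒bag)
open import Data.List.Properties using (map-++)
open import Data.List.Relation.Binary.BagAndSetEquality using (∼bag⇒↭)
open import Data.List.Relation.Binary.Permutation.Propositional.Properties
  using () renaming (map⁺ to ↭-map⁺)
open import Data.List.Relation.Unary.All as All using ()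
open import Data.List.Relation.Unary.AllPairs as AllPairs using ()
open import Data.List.Relation.Unary.Any using (here; there)
open import Data.List.Relation.Unary.Unique.Propositional using (Unique)
import Data.List.Relation.Unary.Unique.Propositional.Properties as Unique
open import Data.Nat.Base hiding (_%_; _/_)
open import Data.Nat.DivMod using (_%_; _/_; m*[n/m]≡n; m%n<n; m<n⇒m%n≡m; n%n≡0)
open import Data.Nat.ListAction using () renaming (sum to sumᴸ)
open import Data.Nat.ListAction.Properties using (sum-++; sum-↭)
open import Data.Nat.Properties hiding (suc-injective) renaming (_≟_ to _≟ℕ_)
open import Data.Product using (Σ-syntax; ∃; ∃!; ∃-syntax; _×_; _,_; proj₁; proj₂)
open import Data.Product.Properties using (,-injectiveˡ)
open import Data.Product.Properties.WithK using (,-injectiveʳ)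
open import Data.Sum.Base using (_⊎_; inj₁; inj₂; [_,_]′)
open import Data.Vec.Base using ([]; _∷_; tabulate)
open import Data.Vec.Properties using (≡-dec; lookup∘tabulate; []=⇒lookup; lookup⇒[]=)
open import Function.Base using (_∘_; id)
open import Function.Bundles using (_⇔_; mk⇔; Equivalence)
open import Level using (0ℓ)
open import Relation.Binary.Construct.Closure.ReflexiveTransitive
  using (Star; ε; _◅_; _◅◅_; gmap; reverse)
open import Relation.Binary.Definitions using (tri<; tri≈; tri>)
open import Relation.Binary.PropositionalEquality hiding ([_])
open import Relation.Nullary
open import Relation.Nullary.Decidable using (dec-true; dec-false; decidable-stable)
open import Relation.Unary using (Pred; Decidable)
open import Algebra.Properties.CommutativeMonoid.Sum +-0-commutativeMonoid
  using (∑-comm; ∑-distrib-+; sum-cong-≗; sum-replicate-zero)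
open Equivalence using (to; from)

private variable
  n m l m₀ n₁ m₁ n₂ m₂ n₃ m₃ : ℕ

infix 3 _when_

_when_ : {P : Set} → ℕ → Dec P → ℕ
a when P? = if does P? then a else 0

when-yes : {P : Set} (P? : Dec P) {a : ℕ} → P → (a when P?) ≡ a
when-yes (yes _) _  = refl
when-yes (no ¬p) p  = contradiction p ¬p

when-no : {P : Set} (P? : Dec P) {a : ℕ} → ¬ P → (a when P?) ≡ 0
when-no (yes p) ¬p = contradiction p ¬p
when-no (no _)  _  = refl

when-≢0 : {P : Set} (P? : Dec P) {a : ℕ} → (a when P?) ≢ 0 → P
when-≢0 (yes p) _  = p
when-≢0 (no _)  ≢0 = contradiction refl ≢0

when-cong : {P Q : Set} (P? : Dec P) (Q? : Dec Q) {a b : ℕ} →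
            (P → Q) → (Q → P) → (P → a ≡ b) → (a when P?) ≡ (b when Q?)
when-cong (yes p) Q? P⇒Q _   eq = trans (eq p) (sym (when-yes Q? (P⇒Q p)))
when-cong (no ¬p) Q? _   Q⇒P _  = sym (when-no Q? (¬p ∘ Q⇒P))

sum-zero : (h : Fin n → ℕ) → (∀ v → h v ≡ 0) → sum h ≡ 0
sum-zero {n} h z = trans (sum-cong-≗ z) (sum-replicate-zero n)

sum-single : (h : Fin n → ℕ) (a : Fin n) → (∀ v → v ≢ a → h v ≡ 0) → sum h ≡ h a
sum-single h zero    z =
  trans (cong (h zero +_) (sum-zero (h ∘ suc) λ v → z (suc v) λ ())) (+-identityʳ _)
sum-single h (suc a) z =
  cong₂ _+_ (z zero λ ()) (sum-single (h ∘ suc) a λ v v≢a → z (suc v) (v≢a ∘ suc-injective))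

sum-mono : {g h : Fin n → ℕ} → (∀ v → g v ≤ h v) → sum g ≤ sum h
sum-mono {zero}  _  = z≤n
sum-mono {suc n} le = +-mono-≤ (le zero) (sum-mono (le ∘ suc))

sum-≢0 : (h : Fin n → ℕ) → sum h ≢ 0 → ∃[ v ] h v ≢ 0
sum-≢0 {zero}  h s≢0 = contradiction refl s≢0
sum-≢0 {suc n} h s≢0 with h zero in eq
... | suc _ = zero , λ h≡0 → 1+n≢0 (trans (sym eq) h≡0)
... | zero  with sum-≢0 (h ∘ suc) s≢0
...   | v , hv = suc v , hv

term≤sum : (h : Fin n → ℕ) (v : Fin n) → h v ≤ sum h
term≤sum h zero    = m≤m+n _ _
term≤sum h (suc v) = ≤-trans (term≤sum (h ∘ suc) v) (m≤n+m _ _)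

sum-reindex : {S : Subset l} (to : Fin l → Fin n) (g : Fin n → ℕ) →
              (∀ {i j} → i ∈ S → j ∈ S → to i ≡ to j → i ≡ j) →
              (∀ v → g v ≢ 0 → ∃[ i ] i ∈ S × to i ≡ v) →
              sum g ≡ ∑[ i < l ] (g (to i) when i ∈? S)
sum-reindex {l} {n} {S} to g inj image = trans (sum-cong-≗ spread)
  (trans (∑-comm cell) (sum-cong-≗ collect))
  where
  hit? : ∀ i v → Dec (i ∈ S × to i ≡ v)
  hit? i v = i ∈? S ×-dec to i ≟ v
  cell : Fin n → Fin l → ℕ
  cell v i = g v when hit? i v
  spread : ∀ v → g v ≡ sum (cell v)
  spread v with g v in eq
  ... | zero  = sym (sum-zero _ λ i → lem (does (hit? i v)))
    where
    lem : ∀ b → (if b then 0 else 0) ≡ 0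
    lem true  = refl
    lem false = refl
  ... | suc k with image v (λ gv≡0 → 1+n≢0 (trans (sym eq) gv≡0))
  ...   | i , i∈ , toi = sym (trans
            (sum-single _ i λ j j≢i → when-no (hit? j v)
              λ (j∈ , toj) → j≢i (inj j∈ i∈ (trans toj (sym toi))))
            (when-yes (hit? i v) (i∈ , toi)))
  collect : ∀ i → sum (λ v → cell v i) ≡ (g (to i) when i ∈? S)
  collect i = trans
    (sum-single _ (to i) λ v v≢ → when-no (hit? i v) (v≢ ∘ sym ∘ proj₂))
    (when-cong (hit? i (to i)) (i ∈? S) proj₁ (_, refl) λ _ → refl)

∣∣-sum : (S : Subset n) → ∣ S ∣ ≡ ∑[ v < n ] (1 when v ∈? S)
∣∣-sum []            = refl
∣∣-sum (outside ∷ S) = ∣∣-sum S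
∣∣-sum (inside  ∷ S) = cong suc (∣∣-sum S)

sum-const : (S : Subset n) (c : ℕ) → ∑[ v < n ] (c when v ∈? S) ≡ ∣ S ∣ * c
sum-const []            c = refl
sum-const (outside ∷ S) c = sum-const S c
sum-const (inside  ∷ S) c = cong (c +_) (sum-const S c)

∣image∣ : {S : Subset l} {T : Subset n} (to : Fin l → Fin n) →
          (∀ {i j} → i ∈ S → j ∈ S → to i ≡ to j → i ≡ j) →
          (∀ {z} → z ∈ T ⇔ (∃[ i ] i ∈ S × to i ≡ z)) → ∣ T ∣ ≡ ∣ S ∣
∣image∣ {l} {n} {S} {T} to inj image = trans (∣∣-sum T) (trans
  (sum-reindex {S = S} to _ inj λ v → Equivalence.to image ∘ when-≢0 (v ∈? T))
  (trans (sum-cong-≗ λ i → when-cong (i ∈? S) (i ∈? S) id id λ i∈ →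
            when-yes (to i ∈? T) (Equivalence.from image (i , i∈ , refl)))
         (sym (∣∣-sum S))))

∣disjoint-∪∣ : (S T : Subset n) → Empty (S ∩ T) → ∣ S ∪ T ∣ ≡ ∣ S ∣ + ∣ T ∣
∣disjoint-∪∣ {n} S T disj = trans (∣∣-sum (S ∪ T)) (trans (sum-cong-≗ pointwise)
  (trans (∑-distrib-+ (λ v → 1 when v ∈? S) (λ v → 1 when v ∈? T))
         (sym (cong₂ _+_ (∣∣-sum S) (∣∣-sum T)))))
  where
  pointwise : ∀ v → (1 when v ∈? (S ∪ T)) ≡ (1 when v ∈? S) + (1 when v ∈? T)
  pointwise v with v ∈? S | v ∈? T
  ... | yes p | yes q = contradiction (v , x∈p∩q⁺ (p , q)) disj
  ... | yes p | no _  = when-yes (v ∈? (S ∪ T)) (x∈p∪q⁺ (inj₁ p))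
  ... | no _  | yes q = when-yes (v ∈? (S ∪ T)) (x∈p∪q⁺ (inj₂ q))
  ... | no ¬p | no ¬q = when-no (v ∈? (S ∪ T)) λ r → case-⊥ (x∈p∪q⁻ S T r)
    where
    case-⊥ : ¬ (v ∈ S ⊎ v ∈ T)
    case-⊥ (inj₁ p) = ¬p p
    case-⊥ (inj₂ q) = ¬q q

pick : (g : Fin n → ℕ) → Fin (sum g) → Σ[ y ∈ Fin n ] Fin (g y)
pick {suc n} g i with splitAt (g zero) i
... | inj₁ e = zero , e
... | inj₂ j = let y , e = pick (g ∘ suc) j in suc y , e

pick-injective : (g : Fin n → ℕ) {i j : Fin (sum g)} → pick g i ≡ pick g j → i ≡ j
pick-injective {suc n} g {i} {j} eq
  with splitAt (g zero) i | splitAt (g zero) j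
     | join-splitAt (g zero) _ i | join-splitAt (g zero) _ j
... | inj₁ e | inj₁ e′ | refl | refl = cong (_↑ˡ _) (lem eq)
  where
  lem : ∀ {e e′} → _≡_ {A = Σ[ y ∈ Fin (suc n) ] Fin (g y)} (zero , e) (zero , e′) → e ≡ e′
  lem refl = refl
... | inj₂ a | inj₂ b  | refl | refl =
  cong (g zero ↑ʳ_) (pick-injective (g ∘ suc) (lem eq))
  where
  lem : {p q : Σ[ y ∈ Fin n ] Fin (g (suc y))} →
        _≡_ {A = Σ[ y ∈ Fin (suc n) ] Fin (g y)}
            (suc (proj₁ p) , proj₂ p) (suc (proj₁ q) , proj₂ q) → p ≡ q
  lem refl = refl
... | inj₁ _ | inj₂ _  | _ | _ = contradiction (cong proj₁ eq) λ ()
... | inj₂ _ | inj₁ _  | _ | _ = contradiction (cong proj₁ eq) λ ()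

pigeonhole : ∀ {k} (g : Fin n → ℕ) (c : (Σ[ y ∈ Fin n ] Fin (g y)) → Fin k) →
             (∀ {p q} → c p ≡ c q → p ≡ q) → sum g ≤ k
pigeonhole g c inj = injective⇒≤ {f = c ∘ pick g} (pick-injective g ∘ inj)

⟪_⟫ : {P : Pred (Fin n) 0ℓ} → Decidable P → Subset n
⟪ P? ⟫ = tabulate (does ∘ P?)

∈⟪⟫ : {P : Pred (Fin n) 0ℓ} (P? : Decidable P) {v : Fin n} → v ∈ ⟪ P? ⟫ ⇔ P v
∈⟪⟫ {P = P} P? {v} = mk⇔ fwd bwd
  where
  fwd : v ∈ ⟪ P? ⟫ → P v
  fwd v∈ with P? v | trans (sym (lookup∘tabulate (does ∘ P?) v)) ([]=⇒lookup v∈)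
  ... | yes p | _  = p
  ... | no _  | ()
  bwd : P v → v ∈ ⟪ P? ⟫
  bwd p = lookup⇒[]= v _ (trans (lookup∘tabulate (does ∘ P?) v) (dec-true (P? v) p))

image : (Fin l → Fin n) → Subset l → Subset n
image to S = ⟪ (λ v → any? λ i → i ∈? S ×-dec to i ≟ v) ⟫

∈image : (to : Fin l → Fin n) (S : Subset l) {v : Fin n} →
         v ∈ image to S ⇔ (∃[ i ] i ∈ S × to i ≡ v)
∈image to S = ∈⟪⟫ λ v → any? λ i → i ∈? S ×-dec to i ≟ v

-- Graphs, complete graphs and cycles

[]-μ : (G : Graph n) (S : Subset n) {u v : Fin n} → u ∈ S → v ∈ S → μ (G [ S ]) u v ≡ μ G u v
[]-μ G S {u} {v} u∈ v∈ rewrite dec-true (u ∈? S) u∈ | dec-true (v ∈? S) v∈ = refl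

[]-μ≢0 : (G : Graph n) (S : Subset n) {u v : Fin n} → Adjacent (G [ S ]) u v →
         u ∈ S × v ∈ S × Adjacent G u v
[]-μ≢0 G S {u} {v} adj with u ∈? S | v ∈? S
... | yes u∈ | yes v∈ = u∈ , v∈ , adj
... | yes _  | no _   = contradiction refl adj
... | no _   | _      = contradiction refl adj

adjacent-sym : (G : Graph n) {u v : Fin n} → Adjacent G u v → Adjacent G v u
adjacent-sym G adj eq = adj (trans (μ-sym G _ _) eq)

adjacent-∈ˡ : (G : Graph n) {u v : Fin n} → Adjacent G u v → u ∈ V G
adjacent-∈ˡ G {u} {v} adj with u ∈? V G
... | yes u∈ = u∈
... | no  u∉ = contradiction (μ-support G u v u∉) adj

adjacent-∈ʳ : (G : Graph n) {u v : Fin n} → Adjacent G u v → v ∈ V G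
adjacent-∈ʳ G = adjacent-∈ˡ G ∘ adjacent-sym G

adjacent⇒≢ : (G : Graph n) {u v : Fin n} → Adjacent G u v → u ≢ v
adjacent⇒≢ G adj refl = adj (μ-loopless G _)

joined-sym : (G : Graph n) {u v : Fin n} → Joined G u v → Joined G v u
joined-sym G = reverse (adjacent-sym G)

degree≢0 : (G : Graph n) {u v : Fin n} → Adjacent G v u → degree G v ≢ 0
degree≢0 G {u} {v} adj d≡0 = adj (n≤0⇒n≡0 (subst (μ G v u ≤_) d≡0 (term≤sum (μ G v) u)))

star-invariant : {A : Set} {R : A → A → Set} (P : A → Set) →
                 (∀ {x y} → P x → R x y → P y) → ∀ {x y} → Star R x y → P x → P y
star-invariant P step ε        p = p
star-invariant P step (r ◅ rs) p = star-invariant P step rs (step p r)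

∈-⊖ : (G : Graph n) {u v : Fin n} → u ∈ V G → u ≢ v → u ∈ V (G ⊖ v)
∈-⊖ G u∈ u≢v = x∈p∩q⁺ (u∈ , x∉p⇒x∈∁p (x≢y⇒x∉⁅y⁆ u≢v))

∈-⊖⁻ : (G : Graph n) {u v : Fin n} → u ∈ V (G ⊖ v) → u ∈ V G × u ≢ v
∈-⊖⁻ G {u} {v} u∈ with x∈p∩q⁻ (V G) (∁ ⁅ v ⁆) u∈
... | u∈G , u∉v = u∈G , x∉⁅y⁆⇒x≢y (x∈∁p⇒x∉p u∉v)

⊖-adjacent : (G : Graph n) {v u w : Fin n} → u ≢ v → w ≢ v → Adjacent G u w → Adjacent (G ⊖ v) u w
⊖-adjacent G {v} u≢v w≢v adj eq = adj (trans (sym ([]-μ G (∁ ⁅ v ⁆)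
  (x∉p⇒x∈∁p (x≢y⇒x∉⁅y⁆ u≢v)) (x∉p⇒x∈∁p (x≢y⇒x∉⁅y⁆ w≢v)))) eq)

isBlock⇒connectedNonseparable : {G : Graph n} → IsBlock G → ConnectedNonseparable G
isBlock⇒connectedNonseparable ((_ , cn , _) , _) = cn

connectedNonseparable⇒isBlock : {G : Graph n} → ConnectedNonseparable G → IsBlock G
connectedNonseparable⇒isBlock cn =
  (⊑-refl , cn , λ _ B⊑G _ _ → B⊑G) ,
  λ { B (B⊑G , _ , max) → B⊑G , max _ ⊑-refl cn B⊑G }

module Iso {S : Graph l} {G : Graph n} (c : S ≅ G) where
  open _≅_ c renaming (to to ι)

  ≅-adjacent : ∀ {i j} → Adjacent S i j → Adjacent G (ι i) (ι j)
  ≅-adjacent adj eq = adj (trans (sym (to-μ (adjacent-∈ˡ S adj) (adjacent-∈ʳ S adj))) eq)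

  ≅-joined : ∀ {i j} → Joined S i j → Joined G (ι i) (ι j)
  ≅-joined = gmap ι ≅-adjacent

  ≅-restrict : (P : Subset l) (Q : Subset n) → (∀ {i} → i ∈ V S → i ∈ P ⇔ ι i ∈ Q) →
               S [ P ] ≅ G [ Q ]
  ≅-restrict P Q P⇔Q = record
    { to         = ι
    ; to-∈       = λ i∈ → let i∈S , i∈P = x∈p∩q⁻ (V S) P i∈ in
                   x∈p∩q⁺ (to-∈ i∈S , to (P⇔Q i∈S) i∈P)
    ; injective  = λ i∈ j∈ → injective (p∩q⊆p (V S) P i∈) (p∩q⊆p (V S) P j∈)
    ; surjective = λ v∈ → let v∈G , v∈Q = x∈p∩q⁻ (V G) Q v∈ ; i , i∈ , eq = surjective v∈G in
                   i , x∈p∩q⁺ (i∈ , from (P⇔Q i∈) (subst (_∈ Q) (sym eq) v∈Q)) , eq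
    ; to-μ       = λ i∈ j∈ →
        let i∈S , i∈P = x∈p∩q⁻ (V S) P i∈ ; j∈S , j∈P = x∈p∩q⁻ (V S) P j∈ in
        trans ([]-μ G Q (to (P⇔Q i∈S) i∈P) (to (P⇔Q j∈S) j∈P))
              (trans (to-μ i∈S j∈S) (sym ([]-μ S P i∈P j∈P)))
    }

  ≅-degree : ∀ {i} → i ∈ V S → degree G (ι i) ≡ degree S i
  ≅-degree {i} i∈ = trans
    (sum-reindex {S = V S} ι (μ G (ι i)) injective λ v adj → surjective (adjacent-∈ʳ G adj))
    (sum-cong-≗ λ j → lem j (j ∈? V S))
    where
    lem : ∀ j (d : Dec (j ∈ V S)) → (μ G (ι i) (ι j) when d) ≡ μ S i j
    lem j (yes j∈) = to-μ i∈ j∈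
    lem j (no j∉)  = sym (trans (μ-sym S i j) (μ-support S j i j∉))

module _ {S : Graph l} {G : Graph n} (c : S ≅ G) where
  open _≅_ c renaming (to to ι)
  open Iso c

  ≅-⊖ : ∀ {i} → i ∈ V S → S ⊖ i ≅ G ⊖ ι i
  ≅-⊖ {i} i∈ = ≅-restrict (∁ ⁅ i ⁆) (∁ ⁅ ι i ⁆) λ {j} j∈ → mk⇔
    (λ j∈∁ → x∉p⇒x∈∁p (x≢y⇒x∉⁅y⁆ λ eq →
      x∉⁅y⁆⇒x≢y (x∈∁p⇒x∉p j∈∁) (injective j∈ i∈ eq)))
    (λ j∈∁ → x∉p⇒x∈∁p (x≢y⇒x∉⁅y⁆ λ eq →
      x∉⁅y⁆⇒x≢y (x∈∁p⇒x∉p j∈∁) (cong ι eq)))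

  ≅-connectedNonseparable : ConnectedNonseparable S → ConnectedNonseparable G
  ≅-connectedNonseparable (((i₀ , i₀∈) , conn) , nonsep) = ((ι i₀ , to-∈ i₀∈) , conn′) , nonsep′
    where
    conn′ : ∀ u v → u ∈ V G → v ∈ V G → Joined G u v
    conn′ u v u∈ v∈ with surjective u∈ | surjective v∈
    ... | i , i∈ , refl | j , j∈ , refl = ≅-joined (conn i j i∈ j∈)
    nonsep′ : ¬ ∃ (Separating G)
    nonsep′ (v , v∈ , u , w , u∈ , w∈ , ¬j) with surjective v∈
    ... | i , i∈ , refl with _≅_.surjective (≅-⊖ i∈) u∈ | _≅_.surjective (≅-⊖ i∈) w∈
    ...   | a , a∈ , refl | b , b∈ , refl =
      nonsep (i , i∈ , a , b , a∈ , b∈ , ¬j ∘ Iso.≅-joined (≅-⊖ i∈))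

≅-trans : {A : Graph l} {B : Graph m} {D : Graph n} → A ≅ B → B ≅ D → A ≅ D
≅-trans {A = A} {D = D} c d = record
  { to         = D₀.to ∘ C₀.to
  ; to-∈       = D₀.to-∈ ∘ C₀.to-∈
  ; injective  = λ i∈ j∈ eq → C₀.injective i∈ j∈ (D₀.injective (C₀.to-∈ i∈) (C₀.to-∈ j∈) eq)
  ; surjective = surj
  ; to-μ       = λ i∈ j∈ → trans (D₀.to-μ (C₀.to-∈ i∈) (C₀.to-∈ j∈)) (C₀.to-μ i∈ j∈)
  }
  where
  module C₀ = _≅_ c
  module D₀ = _≅_ d
  surj : ∀ {v} → v ∈ V D → ∃[ i ] i ∈ V A × D₀.to (C₀.to i) ≡ v
  surj v∈ with D₀.surjective v∈
  ... | j , j∈ , refl with C₀.surjective j∈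
  ...   | i , i∈ , refl = i , i∈ , refl

simple-≢ : (adj : Fin n → Fin n → Bool) {u v : Fin n} → u ≢ v →
           μ (simple adj) u v ≡ (if adj u v ∨ adj v u then 1 else 0)
simple-≢ adj {u} {v} u≢v with u ≟ v
... | yes u≡v = contradiction u≡v u≢v
... | no _    = refl

·-adjacent : ∀ {t} (G : Graph n) {u v : Fin n} → t ≥ 1 → Adjacent G u v → Adjacent (t · G) u v
·-adjacent {t = t} G t≥1 adj eq with m*n≡0⇒m≡0∨n≡0 t eq
... | inj₁ refl = contradiction t≥1 λ ()
... | inj₂ μ≡0  = adj μ≡0

K-adjacent : ∀ k {u v : Fin k} → u ≢ v → Adjacent (K k) u v
K-adjacent k {u} {v} u≢v eq = 1+n≢0 (trans (sym (simple-≢ (λ _ _ → true) {u} {v} u≢v)) eq)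

K-connectedNonseparable : ∀ {t k} → t ≥ 1 → k ≥ 1 → ConnectedNonseparable (t · K k)
K-connectedNonseparable {t} {suc k} t≥1 _ =
  ((zero , ∈⊤) , λ u v _ _ → conn u v) ,
  λ { (v , _ , u , w , u∈ , w∈ , ¬j) →
      ¬j (conn′ v u w (proj₂ (∈-⊖⁻ G u∈)) (proj₂ (∈-⊖⁻ G w∈))) }
  where
  G = t · K (suc k)
  adj : ∀ {u v} → u ≢ v → Adjacent G u v
  adj {u} {v} u≢v = ·-adjacent (K (suc k)) {u} {v} t≥1 (K-adjacent (suc k) u≢v)
  conn : ∀ u v → Joined G u v
  conn u v with u ≟ v
  ... | yes refl = ε
  ... | no u≢v   = adj {u} {v} u≢v ◅ ε
  conn′ : ∀ v u w → u ≢ v → w ≢ v → Joined (G ⊖ v) u w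
  conn′ v u w u≢v w≢v with u ≟ w
  ... | yes refl = ε
  ... | no u≢w   = ⊖-adjacent G u≢v w≢v (adj {u} {w} u≢w) ◅ ε

K-degree : ∀ t k (i j : Fin k) → degree (t · K k) i ≡ degree (t · K k) j
K-degree t k i j = +-cancelʳ-≡ t _ _ (trans (total i) (sym (total j)))
  where
  total : ∀ i → degree (t · K k) i + t ≡ ∑[ v < k ] t
  total i = trans (cong (degree (t · K k) i +_) (sym (trans
      (sum-single (λ v → t when v ≟ i) i λ v v≢i → when-no (v ≟ i) v≢i)
      (when-yes (i ≟ i) refl))))
    (trans (sym (∑-distrib-+ (μ (t · K k) i) (λ v → t when v ≟ i))) (sum-cong-≗ cell))
    where
    cell : ∀ v → t * μ (K k) i v + (t when v ≟ i) ≡ t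
    cell v with v ≟ i
    ... | yes refl = cong (_+ t) (trans (cong (t *_) (μ-loopless (K k) i)) (*-zeroʳ t))
    ... | no v≢i   = trans (+-identityʳ _)
      (trans (cong (t *_) (simple-≢ (λ _ _ → true) {i} {v} (v≢i ∘ sym))) (*-identityʳ t))

next : ∀ {k} → Fin (suc k) → Fin (suc k)
next {k} i = fromℕ< (m%n<n (suc (toℕ i)) (suc k))

next-cases : ∀ {k} (i : Fin (suc k)) →
             (toℕ i < k × toℕ (next i) ≡ suc (toℕ i)) ⊎ (toℕ i ≡ k × toℕ (next i) ≡ 0)
next-cases {k} i with m≤n⇒m<n∨m≡n (s≤s⁻¹ (toℕ<n i))
... | inj₁ i<k = inj₁ (i<k , trans (toℕ-fromℕ< _) (m<n⇒m%n≡m (s≤s i<k)))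
... | inj₂ i≡k = inj₂ (i≡k , trans (toℕ-fromℕ< _)
                   (trans (cong (λ a → suc a % suc k) i≡k) (n%n≡0 (suc k))))

next-< : ∀ {k} {i j : Fin (suc k)} → toℕ j ≡ suc (toℕ i) → next i ≡ j
next-< {k} {i} {j} j≡ with next-cases i
... | inj₁ (_ , eq)  = toℕ-injective (trans eq (sym j≡))
... | inj₂ (i≡k , _) = contradiction (subst (_< suc k) (trans j≡ (cong suc i≡k)) (toℕ<n j)) (<-irrefl refl)

next-wrap : ∀ {k} {i j : Fin (suc k)} → toℕ i ≡ k → toℕ j ≡ 0 → next i ≡ j
next-wrap {k} {i} {j} i≡k j≡0 with next-cases i
... | inj₁ (i<k , _) = contradiction i<k (<-irrefl i≡k)
... | inj₂ (_ , eq)  = toℕ-injective (trans eq (sym j≡0))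

next-injective : ∀ {k} {i j : Fin (suc k)} → next i ≡ next j → i ≡ j
next-injective {i = i} {j} eq with next-cases i | next-cases j
... | inj₁ (_ , p) | inj₁ (_ , q) =
  toℕ-injective (cong pred (trans (sym p) (trans (cong toℕ eq) q)))
... | inj₂ (p , _) | inj₂ (q , _) = toℕ-injective (trans p (sym q))
... | inj₁ (_ , p) | inj₂ (_ , q) =
  contradiction (trans (sym p) (trans (cong toℕ eq) q)) λ ()
... | inj₂ (_ , p) | inj₁ (_ , q) =
  contradiction (trans (sym q) (trans (cong toℕ (sym eq)) p)) λ ()

next-surjective : ∀ {k} (v : Fin (suc k)) → ∃[ i ] next i ≡ v
next-surjective {k} zero    = fromℕ< (n<1+n k) , next-wrap (toℕ-fromℕ< (n<1+n k)) refl
next-surjective {k} (suc v) = fromℕ< v< , next-< (cong suc (sym (toℕ-fromℕ< v<)))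
  where
  v< : toℕ v < suc k
  v< = m≤n⇒m≤1+n (toℕ<n v)

next-≢ : ∀ {k} (i : Fin (suc (suc k))) → i ≢ next i
next-≢ i eq with next-cases i
... | inj₁ (_ , p) = 1+n≢n (trans (sym p) (cong toℕ (sym eq)))
... | inj₂ (p , q) = contradiction (trans (sym q) (trans (cong toℕ (sym eq)) p)) λ ()

adjacentC? : ∀ {k} (i j : Fin (suc k)) → Dec (i ≢ j × (next i ≡ j ⊎ next j ≡ i))
adjacentC? i j = ¬? (i ≟ j) ×-dec (next i ≟ j ⊎-dec next j ≟ i)

C-μ : ∀ {k} (i j : Fin (suc k)) → μ (C (suc k)) i j ≡ (1 when adjacentC? i j)
C-μ {k} i j with i ≟ j
... | yes _   = refl
... | no _    = cong (if_then 1 else 0) (cong₂ _∨_ (step i j) (step j i))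
  where
  step : ∀ i j → (suc (toℕ i) % suc k ≡ᵇ toℕ j) ≡ does (next i ≟ j)
  step i j with next i ≟ j
  ... | yes refl = dec-true (_ ≟ℕ _) (sym (toℕ-fromℕ< (m%n<n (suc (toℕ i)) (suc k))))
  ... | no next≢ = dec-false (_ ≟ℕ _) λ eq → next≢ (toℕ-injective
                     (trans (toℕ-fromℕ< (m%n<n (suc (toℕ i)) (suc k))) eq))

C-adjacent : ∀ {k} (i j : Fin (suc k)) → Adjacent (C (suc k)) i j →
             i ≢ j × (next i ≡ j ⊎ next j ≡ i)
C-adjacent i j adj = when-≢0 (adjacentC? i j) λ eq → adj (trans (C-μ i j) eq)

C-next : ∀ {k} (i : Fin (suc (suc k))) → μ (C (suc (suc k))) i (next i) ≡ 1
C-next i = trans (C-μ i (next i)) (when-yes (adjacentC? i (next i)) (next-≢ i , inj₁ refl))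

C-μ≡1 : ∀ {k} {i j : Fin (suc (suc k))} → next i ≡ j ⊎ next j ≡ i → μ (C (suc (suc k))) i j ≡ 1
C-μ≡1 {i = i}     (inj₁ refl) = C-next i
C-μ≡1 {k} {j = j} (inj₂ refl) = trans (μ-sym (C (suc (suc k))) (next j) j) (C-next j)

C-rotate : ∀ {k} (i j : Fin (suc k)) → μ (C (suc k)) (next i) (next j) ≡ μ (C (suc k)) i j
C-rotate i j = trans (C-μ (next i) (next j)) (trans
  (when-cong (adjacentC? (next i) (next j)) (adjacentC? i j)
    (λ { (≢ , inj₁ e) → ≢ ∘ cong next , inj₁ (next-injective e)
       ; (≢ , inj₂ e) → ≢ ∘ cong next , inj₂ (next-injective e) })
    (λ { (≢ , inj₁ e) → ≢ ∘ next-injective , inj₁ (cong next e)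
       ; (≢ , inj₂ e) → ≢ ∘ next-injective , inj₂ (cong next e) })
    λ _ → refl)
  (sym (C-μ i j)))

C-degree : ∀ t k {i j : Fin k} → Adjacent (C k) i j → degree (t · C k) i ≡ degree (t · C k) j
C-degree t (suc k) {i} {j} adj with C-adjacent i j adj
... | _ , step = [ (λ { refl → sym (rotate i) }) , (λ { refl → rotate j }) ]′ step
  where
  rotate : ∀ i → degree (t · C (suc k)) (next i) ≡ degree (t · C (suc k)) i
  rotate i = trans
    (sum-reindex {S = ⊤} next (μ (t · C (suc k)) (next i)) (λ _ _ → next-injective)
      λ v _ → let i , eq = next-surjective v in i , ∈⊤ , eq)
    (sum-cong-≗ λ j → trans (when-yes (j ∈? ⊤) ∈⊤) (cong (t *_) (C-rotate i j)))

low : ∀ {k} (Γ : Graph (suc k)) (b : ℕ) →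
      (∀ i → suc (toℕ i) < b → Adjacent Γ i (next i)) →
      ∀ u → toℕ u < b → Joined Γ zero u
low {k} Γ b step u u<b = go (toℕ u) u refl u<b
  where
  go : ∀ a u → toℕ u ≡ a → a < b → Joined Γ zero u
  go zero    u u≡ _   = subst (Joined Γ zero) (toℕ-injective (sym u≡)) ε
  go (suc a) u u≡ a<b = go a w (toℕ-fromℕ< a<) (<⇒≤ a<b) ◅◅
    subst (Adjacent Γ w) (next-< (trans u≡ (cong suc (sym (toℕ-fromℕ< a<)))))
      (step w (subst (λ z → suc z < b) (sym (toℕ-fromℕ< a<)) a<b)) ◅ ε
    where
    a< : a < suc k
    a< = <⇒≤ (subst (_< suc k) u≡ (toℕ<n u))
    w = fromℕ< a<

high : ∀ {k} (Γ : Graph (suc k)) (b : ℕ) →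
       (∀ i → b < toℕ i → toℕ i < k → Adjacent Γ i (next i)) →
       ∀ u → b < toℕ u → Joined Γ u (fromℕ< (n<1+n k))
high {k} Γ b step u b<u = go (k ∸ toℕ u) u (m+[n∸m]≡n (s≤s⁻¹ (toℕ<n u))) b<u
  where
  go : ∀ d u → toℕ u + d ≡ k → b < toℕ u → Joined Γ u (fromℕ< (n<1+n k))
  go zero    u eq _   = subst (Joined Γ u)
    (toℕ-injective (trans (trans (sym (+-identityʳ _)) eq) (sym (toℕ-fromℕ< (n<1+n k))))) ε
  go (suc d) u eq b<u with next-cases u
  ... | inj₂ (u≡k , _)  = contradiction
          (+-cancelˡ-≡ (toℕ u) _ 0 (trans eq (sym (trans (+-identityʳ _) u≡k)))) λ ()
  ... | inj₁ (u<k , nu) = step u b<u u<k ◅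
    go d (next u) (trans (cong (_+ d) nu) (trans (sym (+-suc (toℕ u) d)) eq))
      (subst (b <_) (sym nu) (m≤n⇒m≤1+n b<u))

C-connectedNonseparable : ∀ {t k} → t ≥ 1 → k ≥ 3 → ConnectedNonseparable (t · C k)
C-connectedNonseparable {k = suc zero} _ (s≤s ())
C-connectedNonseparable {k = suc (suc zero)} _ (s≤s (s≤s ()))
C-connectedNonseparable {t} {suc (suc (suc k))} t≥1 _ =
  ((zero , ∈⊤) , λ u v _ _ → joined-sym G (conn u) ◅◅ conn v) ,
  λ { (v , _ , u , w , u∈ , w∈ , ¬j) →
      ¬j (conn′ v u w (proj₂ (∈-⊖⁻ G u∈)) (proj₂ (∈-⊖⁻ G w∈))) }
  where
  G = t · C (3 + k)
  last : Fin (3 + k)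
  last = fromℕ< (n<1+n (2 + k))
  adj : ∀ i → Adjacent G i (next i)
  adj i = ·-adjacent (C (3 + k)) {i} {next i} t≥1 λ eq → 1+n≢0 (trans (sym (C-next i)) eq)
  conn : ∀ u → Joined G zero u
  conn u = low G (3 + k) (λ i _ → adj i) u (toℕ<n u)
  adj′ : ∀ v i → toℕ i ≢ toℕ v → toℕ (next i) ≢ toℕ v → Adjacent (G ⊖ v) i (next i)
  adj′ v i i≢v ni≢v = ⊖-adjacent G (i≢v ∘ cong toℕ) (ni≢v ∘ cong toℕ) (adj i)
  toℕ-next-last : toℕ (next last) ≡ 0
  toℕ-next-last = cong toℕ (next-wrap {j = zero} (toℕ-fromℕ< (n<1+n (2 + k))) refl)
  module _ (v : Fin (3 + k)) where
    below : ∀ u → toℕ u < toℕ v → Joined (G ⊖ v) zero u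
    below = low (G ⊖ v) (toℕ v) λ i si<v → adj′ v i (<⇒≢ (<⇒≤ si<v)) (si≢v i si<v)
      where
      si≢v : ∀ i → suc (toℕ i) < toℕ v → toℕ (next i) ≢ toℕ v
      si≢v i si<v with next-cases i
      ... | inj₁ (_ , eq) = λ e → <⇒≢ si<v (trans (sym eq) e)
      ... | inj₂ (_ , eq) = λ e → contradiction (subst (suc (toℕ i) <_) (trans (sym e) eq) si<v) λ ()
    above : ∀ u → toℕ v < toℕ u → Joined (G ⊖ v) u last
    above = high (G ⊖ v) (toℕ v) λ i v<i i<k → adj′ v i (<⇒≢ v<i ∘ sym) (ni≢v i v<i i<k)
      where
      ni≢v : ∀ i → toℕ v < toℕ i → toℕ i < 2 + k → toℕ (next i) ≢ toℕ v
      ni≢v i v<i i<k with next-cases i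
      ... | inj₁ (_ , eq) = λ e → <⇒≢ (m≤n⇒m≤1+n v<i) (trans (sym e) eq)
      ... | inj₂ (i≡k , _) = contradiction i<k (<-irrefl i≡k)
    -- The edge from last to zero is used only if v lies strictly between them.
    around : ∀ u w → toℕ u < toℕ v → toℕ v < toℕ w → Joined (G ⊖ v) u w
    around u w u<v v<w = joined-sym (G ⊖ v) (below u u<v) ◅◅
      adjacent-sym (G ⊖ v) {last} {zero} (subst (Adjacent (G ⊖ v) last) (toℕ-injective toℕ-next-last)
        (adj′ v last last≢ (λ e → <⇒≢ (≤-<-trans z≤n u<v) (trans (sym toℕ-next-last) e)))) ◅
      joined-sym (G ⊖ v) (above w v<w)
      where
      last≢ : toℕ last ≢ toℕ v
      last≢ e = <⇒≢ (<-≤-trans v<w (s≤s⁻¹ (toℕ<n w)))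
        (trans (sym e) (toℕ-fromℕ< (n<1+n (2 + k))))
    conn′ : ∀ u w → u ≢ v → w ≢ v → Joined (G ⊖ v) u w
    conn′ u w u≢v w≢v with <-cmp (toℕ u) (toℕ v) | <-cmp (toℕ w) (toℕ v)
    ... | tri≈ _ e _   | _            = contradiction (toℕ-injective e) u≢v
    ... | _            | tri≈ _ e _   = contradiction (toℕ-injective e) w≢v
    ... | tri< u<v _ _ | tri< w<v _ _ = joined-sym (G ⊖ v) (below u u<v) ◅◅ below w w<v
    ... | tri> _ _ v<u | tri> _ _ v<w = above u v<u ◅◅ joined-sym (G ⊖ v) (above w v<w)
    ... | tri< u<v _ _ | tri> _ _ v<w = around u w u<v v<w
    ... | tri> _ _ v<u | tri< w<v _ _ = joined-sym (G ⊖ v) (around w u w<v v<u)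

-- C₂ₖ wraps twice around Cₖ; i ↑ˡ k and k ↑ʳ i are the two lifts of i.
next-lift : ∀ {k} (i : Fin (suc k)) → let N = suc k in
            (next (i ↑ˡ N) ≡ next i ↑ˡ N × next (N ↑ʳ i) ≡ N ↑ʳ next i) ⊎
            (next (i ↑ˡ N) ≡ N ↑ʳ next i × next (N ↑ʳ i) ≡ next i ↑ˡ N)
next-lift {k} i with next-cases i
... | inj₁ (_ , eq) = inj₁
  ( next-< (trans (toℕ-↑ˡ (next i) _) (trans eq (cong suc (sym (toℕ-↑ˡ i _)))))
  , next-< (trans (toℕ-↑ʳ (suc k) (next i)) (trans (cong (suc k +_) eq)
      (trans (+-suc (suc k) _) (cong suc (sym (toℕ-↑ʳ (suc k) i)))))) )
... | inj₂ (i≡k , eq) = inj₂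
  ( next-< (trans (toℕ-↑ʳ (suc k) (next i)) (trans (cong (suc k +_) eq)
      (trans (+-identityʳ (suc k)) (cong suc (sym (trans (toℕ-↑ˡ i _) i≡k))))))
  , next-wrap (trans (toℕ-↑ʳ (suc k) i) (trans (cong (suc k +_) i≡k) (sym (+-suc k k))))
      (trans (toℕ-↑ˡ (next i) _) eq) )

lift-adjacent : ∀ {k} (i j : Fin k) → k ≥ 2 → Adjacent (C k) i j →
  (i′ : Fin (k + k)) → i′ ≡ i ↑ˡ k ⊎ i′ ≡ k ↑ʳ i →
  ∃[ j′ ] (j′ ≡ j ↑ˡ k ⊎ j′ ≡ k ↑ʳ j) × μ (C (k + k)) i′ j′ ≡ μ (C k) i j
lift-adjacent {suc zero}    i j (s≤s ()) adj i′ i′≡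
lift-adjacent {suc (suc k)} i j _ adj i′ i′≡ with C-adjacent i j adj
... | _ , step = let j′ , j′≡ , step′ = lift step i′≡ in
  j′ , j′≡ , trans (C-μ≡1 step′) (sym (C-μ≡1 step))
  where
  N = suc (suc k)
  lift : next i ≡ j ⊎ next j ≡ i → i′ ≡ i ↑ˡ N ⊎ i′ ≡ N ↑ʳ i →
         ∃[ j′ ] (j′ ≡ j ↑ˡ N ⊎ j′ ≡ N ↑ʳ j) × (next i′ ≡ j′ ⊎ next j′ ≡ i′)
  lift (inj₁ refl) i′≡ with next-lift i | i′≡
  ... | inj₁ (p , _) | inj₁ refl = _ , inj₁ refl , inj₁ p
  ... | inj₁ (_ , q) | inj₂ refl = _ , inj₂ refl , inj₁ q
  ... | inj₂ (p , _) | inj₁ refl = _ , inj₂ refl , inj₁ p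
  ... | inj₂ (_ , q) | inj₂ refl = _ , inj₁ refl , inj₁ q
  lift (inj₂ refl) i′≡ with next-lift j | i′≡
  ... | inj₁ (p , _) | inj₁ refl = _ , inj₁ refl , inj₂ p
  ... | inj₁ (_ , q) | inj₂ refl = _ , inj₂ refl , inj₂ q
  ... | inj₂ (p , _) | inj₂ refl = _ , inj₁ refl , inj₂ p
  ... | inj₂ (_ , q) | inj₁ refl = _ , inj₂ refl , inj₂ q

-- Inflations inside a cover

∣biunion∣ : {S : Subset l} {T : Subset n} {s : ℕ} (U : Fin l → Subset n) →
            (∀ {x} → x ∈ S → ∣ U x ∣ ≡ s) →
            (∀ {x y} → x ∈ S → y ∈ S → x ≢ y → Empty (U x ∩ U y)) →
            (∀ {z} → z ∈ T ⇔ (∃[ x ] x ∈ S × z ∈ U x)) → ∣ T ∣ ≡ ∣ S ∣ * s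
∣biunion∣ {l} {n} {S} {T} {s} U size disj union = trans (∣∣-sum T)
  (trans (sum-cong-≗ spread) (trans (∑-comm cell) (trans (sum-cong-≗ collect) (sum-const S s))))
  where
  in? : ∀ x z → Dec (x ∈ S × z ∈ U x)
  in? x z = x ∈? S ×-dec z ∈? U x
  cell : Fin n → Fin l → ℕ
  cell z x = 1 when in? x z
  spread : ∀ z → (1 when z ∈? T) ≡ sum (cell z)
  spread z with z ∈? T
  ... | no z∉  = sym (sum-zero (cell z) λ x → when-no (in? x z) λ p → z∉ (from union (x , p)))
  ... | yes z∈ with to union z∈
  ...   | x , x∈ , z∈U = sym (trans
            (sum-single (cell z) x λ y y≢x → when-no (in? y z)
              λ (y∈ , z∈U′) → disj y∈ x∈ y≢x (z , x∈p∩q⁺ (z∈U′ , z∈U)))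
            (when-yes (in? x z) (x∈ , z∈U)))
  collect : ∀ x → sum (λ z → cell z x) ≡ (s when x ∈? S)
  collect x with x ∈? S
  ... | yes x∈ = trans (sym (∣∣-sum (U x))) (size x∈)
  ... | no _   = sum-zero {n} (λ _ → 0) λ _ → refl

cover-⊆ : {G : Graph n} {X : Assignment n m} {H : Graph m} → IsCover G X H →
          ∀ {v} → v ∈ V G → X v ⊆ V H
cover-⊆ cov v∈ x∈ = from (IsCover.union cov) (_ , v∈ , x∈)

cover-fibre : {G : Graph n} {X : Assignment n m} {H : Graph m} → IsCover G X H →
              ∀ {u v x} → u ∈ V G → v ∈ V G → x ∈ X u → x ∈ X v → u ≡ v
cover-fibre cov {u} {v} u∈ v∈ x∈u x∈v with u ≟ v
... | yes u≡v = u≡v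
... | no u≢v  = contradiction (_ , x∈p∩q⁺ (x∈u , x∈v)) (IsCover.disjoint cov u∈ v∈ u≢v)

module _ {G : Graph n} {X : Assignment n m} {H : Graph m} (cov : IsCover G X H) where

  ∑-edges≤μ : ∀ {u v x} → u ∈ V G → v ∈ V G → u ≢ v → x ∈ X u →
              ∑[ y < m ] (μ H x y when y ∈? X v) ≤ μ G u v
  ∑-edges≤μ {u} {v} {x} u∈ v∈ u≢v x∈ = pigeonhole g colour colour-injective
    where
    g : Fin m → ℕ
    g y = μ H x y when y ∈? X v
    matchings = IsCover.matchings cov u∈ v∈ u≢v
    E = proj₁ matchings
    strip : ∀ {y} (d : Dec (y ∈ X v)) → Fin (μ H x y when d) → Fin (μ H x y)
    strip (yes _) e = e
    strip-∈ : ∀ {y} (d : Dec (y ∈ X v)) → Fin (μ H x y when d) → y ∈ X v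
    strip-∈ (yes y∈) _ = y∈
    strip-injective : ∀ {y} (d : Dec (y ∈ X v)) {e e′} → strip d e ≡ strip d e′ → e ≡ e′
    strip-injective (yes _) eq = eq
    end : (p : Σ[ y ∈ Fin m ] Fin (g y)) → proj₁ p ∈ X v
    end (y , e) = strip-∈ (y ∈? X v) e
    covered : (p : Σ[ y ∈ Fin m ] Fin (g y)) →
              ∃[ i ] strip (proj₁ p ∈? X v) (proj₂ p) ∈ E i x (proj₁ p)
    covered p = proj₂ (proj₂ matchings) x∈ (end p) _
    colour : (Σ[ y ∈ Fin m ] Fin (g y)) → Fin (μ G u v)
    colour p = proj₁ (covered p)
    colour-injective : ∀ {p q} → colour p ≡ colour q → p ≡ q
    colour-injective {y , e} {y′ , e′} eq = unstrip (IsMatching.uniqueʳ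
      (proj₁ (proj₂ matchings) (colour (y′ , e′))) x∈ (end (y , e)) (end (y′ , e′))
      (subst (λ i → strip (y ∈? X v) e ∈ E i x y) eq (proj₂ (covered (y , e))))
      (proj₂ (covered (y′ , e′))))
      where
      unstrip : _≡_ {A = Σ[ y ∈ Fin m ] Fin (μ H x y)}
                (y , strip (y ∈? X v) e) (y′ , strip (y′ ∈? X v) e′) →
                _≡_ {A = Σ[ y ∈ Fin m ] Fin (g y)} (y , e) (y′ , e′)
      unstrip eq with ,-injectiveˡ eq
      ... | refl = cong (y ,_) (strip-injective (y ∈? X v) (,-injectiveʳ eq))

  cover-adjacent : ∀ {u v x y} → u ∈ V G → v ∈ V G → x ∈ X u → y ∈ X v →
                   Adjacent H x y → Adjacent G u v
  cover-adjacent {u} {v} {x} {y} u∈ v∈ x∈ y∈ adj μ≡0 with u ≟ v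
  ... | yes refl = adj (IsCover.independent cov u∈ x∈ y∈)
  ... | no u≢v   = adj (n≤0⇒n≡0 (subst₂ _≤_ (when-yes (y ∈? X v) y∈) μ≡0
      (≤-trans (term≤sum (λ y → μ H x y when y ∈? X v) y) (∑-edges≤μ u∈ v∈ u≢v x∈))))

record IsLift (G : Graph n) (X₀ : Assignment n m) (H₀ : Graph m) : Set where
  field
    isCover : IsCover G X₀ H₀
    c       : ℕ
    c≥1     : c ≥ 1
    card    : ∀ {v} → v ∈ V G → ∣ X₀ v ∣ ≡ c
    lift    : ∀ {u v x} → Adjacent G u v → x ∈ X₀ u → ∃[ y ] y ∈ X₀ v × μ H₀ x y ≡ μ G u v

gCover⇒lift : {G : Graph n} {X : Assignment n m} {H : Graph m} → IsGCover G X H → IsLift G X H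
gCover⇒lift {G = G} {X} {H} gc = record
  { isCover = isCover
  ; c       = 1
  ; c≥1     = ≤-refl
  ; card    = λ v∈ → trans (cong ∣_∣ (singleton v∈)) (∣⁅x⁆∣≡1 (x _))
  ; lift    = λ {u} {v} adj y∈ → let u∈ = adjacent-∈ˡ G adj ; v∈ = adjacent-∈ʳ G adj in
      x v , subst (x v ∈_) (sym (singleton v∈)) (x∈⁅x⁆ (x v)) ,
      trans (cong (λ y → μ H y (x v)) (x∈⁅y⁆⇒x≡y (x u) (subst (_ ∈_) (singleton u∈) y∈)))
            (x-μ u∈ v∈ (adjacent⇒≢ G adj))
  }
  where open IsGCover gc

doubleCover⇒lift : {G : Graph n} {X : Assignment n m} {H : Graph m} {t k : ℕ} {c : t · C k ≅ G} →
                   k ≥ 2 → IsDoubleCover G t k c X H → IsLift G X H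
doubleCover⇒lift {G = G} {X} {H} {t} {k} {c} k≥2 dc = record
  { isCover = isCover
  ; c       = 2
  ; c≥1     = s≤s z≤n
  ; card    = card
  ; lift    = lift
  }
  where
  open IsDoubleCover dc
  open _≅_ c using (to-∈; surjective; to-μ) renaming (to to ι)
  ↑ˡ≢↑ʳ : ∀ {i j : Fin k} → i ↑ˡ k ≢ k ↑ʳ j
  ↑ˡ≢↑ʳ {i} {j} eq = <⇒≢ (<-≤-trans (toℕ<n i) (m≤m+n k (toℕ j)))
    (trans (sym (toℕ-↑ˡ i k)) (trans (cong toℕ eq) (toℕ-↑ʳ k j)))
  card : ∀ {v} → v ∈ V G → ∣ X v ∣ ≡ 2
  card v∈ with surjective v∈
  ... | i , _ , refl = trans (cong ∣_∣ (pair i)) (trans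
    (∣disjoint-∪∣ ⁅ x (i ↑ˡ k) ⁆ ⁅ x (k ↑ʳ i) ⁆ λ (z , z∈) →
      let p , q = x∈p∩q⁻ ⁅ x (i ↑ˡ k) ⁆ ⁅ x (k ↑ʳ i) ⁆ z∈ in
      ↑ˡ≢↑ʳ (injective (trans (sym (x∈⁅y⁆⇒x≡y _ p)) (x∈⁅y⁆⇒x≡y _ q))))
    (cong₂ _+_ (∣⁅x⁆∣≡1 (x (i ↑ˡ k))) (∣⁅x⁆∣≡1 (x (k ↑ʳ i)))))
  pair⁻ : ∀ i {y} → y ∈ X (ι i) → ∃[ i′ ] (i′ ≡ i ↑ˡ k ⊎ i′ ≡ k ↑ʳ i) × y ≡ x i′
  pair⁻ i y∈ with x∈p∪q⁻ ⁅ x (i ↑ˡ k) ⁆ ⁅ x (k ↑ʳ i) ⁆ (subst (_ ∈_) (pair i) y∈)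
  ... | inj₁ p = i ↑ˡ k , inj₁ refl , x∈⁅y⁆⇒x≡y _ p
  ... | inj₂ q = k ↑ʳ i , inj₂ refl , x∈⁅y⁆⇒x≡y _ q
  pair⁺ : ∀ i {i′} → i′ ≡ i ↑ˡ k ⊎ i′ ≡ k ↑ʳ i → x i′ ∈ X (ι i)
  pair⁺ i (inj₁ refl) = subst (_ ∈_) (sym (pair i)) (x∈p∪q⁺ (inj₁ (x∈⁅x⁆ _)))
  pair⁺ i (inj₂ refl) = subst (_ ∈_) (sym (pair i)) (x∈p∪q⁺ (inj₂ (x∈⁅x⁆ _)))
  lift : ∀ {u v y} → Adjacent G u v → y ∈ X u → ∃[ z ] z ∈ X v × μ H y z ≡ μ G u v
  lift adj y∈ with surjective (adjacent-∈ˡ G adj) | surjective (adjacent-∈ʳ G adj)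
  ... | i , i∈ , refl | j , j∈ , refl with pair⁻ i y∈
  ...   | i′ , i′≡ , refl =
    let j′ , j′≡ , eq = lift-adjacent i j k≥2
          (λ z → adj (trans (to-μ i∈ j∈) (trans (cong (t *_) z) (*-zeroʳ t)))) i′ i′≡
    in x j′ , pair⁺ j j′≡ , trans (x-μ i′ j′) (trans (cong (t *_) eq) (sym (to-μ i∈ j∈)))

-- What is needed of an inflation (X , H) / U: the edges leaving a vertex
-- x ∈ U already exhaust the matchings of the cover, so U is a union of
-- components of H.
record Layer (G : Graph n) (X : Assignment n m) (H : Graph m) (U : Subset m) : Set where
  field
    s         : ℕ
    s≥1       : s ≥ 1
    card      : ∀ {v} → v ∈ V G → ∣ X v ∩ U ∣ ≡ s
    closed    : ∀ {u v x y} → u ∈ V G → v ∈ V G → x ∈ X u → y ∈ X v →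
                x ∈ U → Adjacent H x y → y ∈ U
    neighbour : ∀ {u v x} → Adjacent G u v → x ∈ X u → x ∈ U →
                ∃[ y ] y ∈ X v × Adjacent H x y

inflation⇒layer : {G : Graph n} {X : Assignment n m} {H : Graph m} {U : Subset m} →
  IsCover G X H →
  ∀ {X₀ : Assignment n m₀} {H₀ : Graph m₀} → IsLift G X₀ H₀ →
  ∀ {s} .{{_ : NonZero s}} → IsInflation s G X₀ H₀ (X ↾ U) (H [ U ]) → Layer G X H U
inflation⇒layer {n} {m} {m₀} {G = G} {X} {H} {U} cov {X₀} {H₀} lifting {s} infl = record
  { s         = c * s
  ; s≥1       = *-mono-≤ c≥1 (>-nonZero⁻¹ s)
  ; card      = λ {v} v∈ → trans (∣biunion∣ {S = X₀ v} I.U (I.size ∘ ⊆H₀ v∈)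
                  (λ x∈ y∈ → I.disjoint (⊆H₀ v∈ x∈) (⊆H₀ v∈ y∈)) (I.assignment v∈))
                  (cong (_* s) (card v∈))
  ; closed    = closed
  ; neighbour = neighbour
  }
  where
  module I = IsInflation infl
  open IsLift lifting
  ⊆H₀ : ∀ {v} → v ∈ V G → X₀ v ⊆ V H₀
  ⊆H₀ = cover-⊆ isCover

  record Class (u v : Fin n) (x : Fin m) : Set where
    field
      W     : Subset m
      ∣W∣   : ∣ W ∣ ≡ s
      W⊆    : ∀ {y} → y ∈ W → y ∈ X v × y ∈ U
      q     : ℕ
      sq≡μ  : s * q ≡ μ G u v
      edges : ∀ {y} → y ∈ W → μ H x y ≡ q

  class : ∀ {u v x} → Adjacent G u v → x ∈ X u → x ∈ U → Class u v x
  class {u} {v} {x} adj x∈X x∈U = record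
    { W     = I.U y₀
    ; ∣W∣   = I.size y₀∈
    ; W⊆    = W⊆
    ; q     = μ H₀ x₀ y₀ / s
    ; sq≡μ  = trans (m*[n/m]≡n (I.divides x₀ y₀)) lift≡
    ; edges = λ y∈ → trans (sym ([]-μ H U x∈U (proj₂ (W⊆ y∈))))
        (I.bipartite (⊆H₀ u∈ x₀∈X₀) y₀∈ x₀≢y₀ x∈Ux₀ y∈)
    }
    where
    u∈ = adjacent-∈ˡ G adj
    v∈ = adjacent-∈ʳ G adj
    over = to (I.assignment u∈) (x∈p∩q⁺ (x∈X , x∈U))
    x₀ = proj₁ over
    x₀∈X₀ = proj₁ (proj₂ over)
    x∈Ux₀ = proj₂ (proj₂ over)
    lifted = lift adj x₀∈X₀
    y₀ = proj₁ lifted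
    y₀∈X₀ = proj₁ (proj₂ lifted)
    lift≡ = proj₂ (proj₂ lifted)
    y₀∈ = ⊆H₀ v∈ y₀∈X₀
    x₀≢y₀ : x₀ ≢ y₀
    x₀≢y₀ eq = adj (trans (sym lift≡) (trans (cong (μ H₀ x₀) (sym eq)) (μ-loopless H₀ x₀)))
    W⊆ : ∀ {y} → y ∈ I.U y₀ → y ∈ X v × y ∈ U
    W⊆ y∈ = x∈p∩q⁻ (X v) U (from (I.assignment v∈) (y₀ , y₀∈X₀ , y∈))

  neighbour : ∀ {u v x} → Adjacent G u v → x ∈ X u → x ∈ U → ∃[ y ] y ∈ X v × Adjacent H x y
  neighbour adj x∈X x∈U = y , proj₁ (W⊆ y∈) ,
    λ μ≡0 → adj (trans (sym sq≡μ) (trans (cong (s *_) (trans (sym (edges y∈)) μ≡0)) (*-zeroʳ s)))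
    where
    open Class (class adj x∈X x∈U)
    member : ∃[ y ] (1 when y ∈? W) ≢ 0
    member = sum-≢0 _ λ z → ≢-nonZero⁻¹ s (trans (sym ∣W∣) (trans (∣∣-sum W) z))
    y = proj₁ member
    y∈ : y ∈ W
    y∈ = when-≢0 (y ∈? W) (proj₂ member)

  closed : ∀ {u v x y} → u ∈ V G → v ∈ V G → x ∈ X u → y ∈ X v → x ∈ U → Adjacent H x y → y ∈ U
  closed {u} {v} {x} {w} u∈ v∈ x∈X w∈X x∈U adj with w ∈? U
  ... | yes w∈ = w∈
  ... | no w∉  = contradiction (≤-trans (sum-mono below) (∑-edges≤μ cov u∈ v∈ (adjacent⇒≢ G adjG) x∈X))
                   (<⇒≱ (≤-trans (m<m+n (μ G u v) (n≢0⇒n>0 adj)) (≤-reflexive (sym total))))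
    where
    adjG = cover-adjacent cov u∈ v∈ x∈X w∈X adj
    open Class (class adjG x∈X x∈U)
    h : Fin m → ℕ
    h y = (q when y ∈? W) + (μ H x w when y ≟ w)
    total : sum h ≡ μ G u v + μ H x w
    total = trans (∑-distrib-+ (λ y → q when y ∈? W) (λ y → μ H x w when y ≟ w)) (cong₂ _+_
      (trans (sum-const W q) (trans (cong (_* q) ∣W∣) sq≡μ))
      (trans (sum-single _ w λ y y≢w → when-no (y ≟ w) y≢w) (when-yes (w ≟ w) refl)))
    below : ∀ y → h y ≤ (μ H x y when y ∈? X v)
    below y with y ∈? W | y ≟ w
    ... | yes y∈ | yes refl = contradiction (proj₂ (W⊆ y∈)) w∉
    ... | yes y∈ | no _     = ≤-reflexive (trans (+-identityʳ q)
            (trans (sym (edges y∈)) (sym (when-yes (y ∈? X v) (proj₁ (W⊆ y∈))))))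
    ... | no _   | yes refl = ≤-reflexive (sym (when-yes (y ∈? X v) w∈X))
    ... | no _   | no _     = z≤n

record Harmonic (G : Graph n) (X : Assignment n m) (H : Graph m) (f : Fin m → ℕ) : Set where
  field
    balanced : ∀ {u v x y} → u ∈ V G → v ∈ V G → x ∈ X u → y ∈ X v → Adjacent H x y →
               f x * degree G v ≡ f y * degree G u
    spread   : ∀ {u x} → u ∈ V G → x ∈ X u → f x ≢ 0 →
               ∃[ v ] Adjacent G u v × (∃[ y ] y ∈ X v × Adjacent H x y)

layered⇒harmonic : {G : Graph n} {X : Assignment n m} {H : Graph m} {f : Fin m → ℕ} →
  IsCover G X H →
  ∀ {p} (U : Fin p → Subset m) (c : Fin p → Fin n → ℕ) → (∀ i → Layer G X H (U i)) →
  (∀ {v x} → v ∈ V G → x ∈ X v → ∀ i → x ∈ U i → f x * ∣ X v ∩ U i ∣ ≡ c i v) →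
  (∀ {v x} → v ∈ V G → x ∈ X v → (∀ i → x ∉ U i) → f x ≡ 0) →
  (∀ i {u v} → Adjacent G u v → c i u * degree G v ≡ c i v * degree G u) →
  (∀ i {u} → u ∈ V G → c i u ≢ 0 → ∃ (Adjacent G u)) →
  Harmonic G X H f
layered⇒harmonic {G = G} {X} {H} {f} cov U c layer on off proportional isolated = record
  { balanced = balanced
  ; spread   = spread
  }
  where
  open ≡-Reasoning
  module L i = Layer (layer i)
  value : ∀ {v x} → v ∈ V G → x ∈ X v → ∀ i → x ∈ U i → f x * L.s i ≡ c i v
  value {x = x} v∈ x∈ i x∈U = trans (cong (f x *_) (sym (L.card i v∈))) (on v∈ x∈ i x∈U)
  balanced : ∀ {u v x y} → u ∈ V G → v ∈ V G → x ∈ X u → y ∈ X v → Adjacent H x y →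
             f x * degree G v ≡ f y * degree G u
  balanced {u} {v} {x} {y} u∈ v∈ x∈ y∈ adj with any? (λ i → x ∈? U i)
  ... | no ¬x = trans (cong (_* degree G v) fx≡0) (sym (cong (_* degree G u) fy≡0))
    where
    fx≡0 = off u∈ x∈ λ i x∈U → ¬x (i , x∈U)
    fy≡0 = off v∈ y∈ λ i y∈U →
      ¬x (i , L.closed i v∈ u∈ y∈ x∈ y∈U (adjacent-sym H adj))
  ... | yes (i , x∈U) = *-cancelʳ-≡ _ _ (L.s i) {{>-nonZero (L.s≥1 i)}} (begin
    f x * degree G v * L.s i     ≡⟨ swap (f x) (degree G v) (L.s i) ⟩
    f x * L.s i * degree G v     ≡⟨ cong (_* degree G v) (value u∈ x∈ i x∈U) ⟩
    c i u * degree G v           ≡⟨ proportional i (cover-adjacent cov u∈ v∈ x∈ y∈ adj) ⟩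
    c i v * degree G u           ≡⟨ cong (_* degree G u) (value v∈ y∈ i y∈U) ⟨
    f y * L.s i * degree G u     ≡⟨ swap (f y) (L.s i) (degree G u) ⟩
    f y * degree G u * L.s i     ∎)
    where
    y∈U = L.closed i u∈ v∈ x∈ y∈ x∈U adj
    swap : ∀ a b d → a * b * d ≡ a * d * b
    swap a b d = trans (*-assoc a b d) (trans (cong (a *_) (*-comm b d)) (sym (*-assoc a d b)))
  spread : ∀ {u x} → u ∈ V G → x ∈ X u → f x ≢ 0 →
           ∃[ v ] Adjacent G u v × (∃[ y ] y ∈ X v × Adjacent H x y)
  spread {u} {x} u∈ x∈ fx≢0 with any? (λ i → x ∈? U i)
  ... | no ¬x = contradiction (off u∈ x∈ λ i x∈U → ¬x (i , x∈U)) fx≢0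
  ... | yes (i , x∈U) = let v , adj = isolated i u∈ ciu≢0 in v , adj , L.neighbour i adj x∈ x∈U
    where
    ciu≢0 : c i u ≢ 0
    ciu≢0 ciu≡0 with m*n≡0⇒m≡0∨n≡0 (f x) (trans (value u∈ x∈ i x∈U) ciu≡0)
    ... | inj₁ fx≡0 = fx≢0 fx≡0
    ... | inj₂ s≡0  = contradiction (subst (_≥ 1) s≡0 (L.s≥1 i)) λ ()

gLayer : {G : Graph n} {X : Assignment n m} {H : Graph m} {U : Subset m} →
         IsCover G X H → InflationOf (IsGCover G) G (X ↾ U) (H [ U ]) → Layer G X H U
gLayer cov (_ , _ , _ , gc , _ , s≢0 , infl) = inflation⇒layer cov (gCover⇒lift gc) {{s≢0}} infl

m⇒harmonic : {G : Graph n} {X : Assignment n m} {H : Graph m} {f : Fin m → ℕ} →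
             MConfiguration G X H f → Harmonic G X H f
m⇒harmonic {G = G} mc = layered⇒harmonic (proj₁ uniform) {1} (λ _ → U) (λ _ → degree G)
  (λ _ → gLayer (proj₁ uniform) inflation)
  (λ v∈ x∈ _ → f-inside v∈ x∈)
  (λ v∈ x∈ x∉ → f-outside v∈ x∈ (x∉ zero))
  (λ _ {u} {v} _ → *-comm (degree G u) (degree G v))
  (λ _ {u} _ → sum-≢0 (μ G u))
  where open MConfiguration mc

k⇒harmonic : {G : Graph n} {X : Assignment n m} {H : Graph m} {f : Fin m → ℕ} →
             KConfiguration G X H f → Harmonic G X H f
k⇒harmonic {G = G} kc = layered⇒harmonic (proj₁ uniform) U (λ i _ → t * parts i)
  (gLayer (proj₁ uniform) ∘ inflation) f-inside f-outside
  (λ i adj → cong (t * parts i *_) (sym (regular (adjacent-∈ˡ G adj) (adjacent-∈ʳ G adj))))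
  (λ _ u∈ _ → neighbour u∈)
  where
  open KConfiguration kc
  open _≅_ complete using (surjective) renaming (to to ι)
  open Iso complete
  regular : ∀ {u v} → u ∈ V G → v ∈ V G → degree G u ≡ degree G v
  regular u∈ v∈ with surjective u∈ | surjective v∈
  ... | i , i∈ , refl | j , j∈ , refl =
    trans (≅-degree i∈) (trans (K-degree t k i j) (sym (≅-degree j∈)))
  k≥2 : k ≥ 2
  k≥2 = subst (2 ≤_) parts-sum (s≤s (≤-trans (parts≥1 (fromℕ< p≥1)) (term≤sum parts _)))
  neighbour : ∀ {u} → u ∈ V G → ∃ (Adjacent G u)
  neighbour u∈ with surjective u∈
  ... | i , _ , refl = let j , i≢j = other k≥2 i in
    ι j , ≅-adjacent (·-adjacent (K k) {i} {j} t≥1 (K-adjacent k {i} {j} i≢j))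
    where
    other : ∀ {k} → k ≥ 2 → (i : Fin k) → ∃[ j ] i ≢ j
    other (s≤s (s≤s _)) zero    = suc zero , λ ()
    other (s≤s (s≤s _)) (suc _) = zero , λ ()

module _ {G : Graph n} {t k : ℕ} (t≥1 : t ≥ 1) (cycle : t · C k ≅ G) where
  open _≅_ cycle using (surjective; to-μ) renaming (to to ι)
  open Iso cycle

  cycle-regular : ∀ {u v} → Adjacent G u v → degree G u ≡ degree G v
  cycle-regular adj with surjective (adjacent-∈ˡ G adj) | surjective (adjacent-∈ʳ G adj)
  ... | i , i∈ , refl | j , j∈ , refl = trans (≅-degree i∈) (trans
    (C-degree t k {i} {j} λ z → adj (trans (to-μ i∈ j∈) (trans (cong (t *_) z) (*-zeroʳ t))))
    (sym (≅-degree j∈)))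

  cycle-neighbour : k ≥ 2 → ∀ {u} → u ∈ V G → ∃ (Adjacent G u)
  cycle-neighbour k≥2 u∈ with surjective u∈
  ... | i , _ , refl = let j , adj = successor k≥2 i in
    ι j , ≅-adjacent (·-adjacent (C k) {i} {j} t≥1 adj)
    where
    successor : ∀ {k} → k ≥ 2 → (i : Fin k) → ∃[ j ] Adjacent (C k) i j
    successor (s≤s (s≤s _)) i = next i , λ z → 1+n≢0 (trans (sym (C-next i)) z)

oddC⇒harmonic : {G : Graph n} {X : Assignment n m} {H : Graph m} {f : Fin m → ℕ} →
                OddCConfiguration G X H f → Harmonic G X H f
oddC⇒harmonic {G = G} cc = layered⇒harmonic (proj₁ uniform) U (λ _ _ → t)
  (gLayer (proj₁ uniform) ∘ inflation) f-inside f-outside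
  (λ _ adj → cong (t *_) (sym (cycle-regular t≥1 cycle adj)))
  (λ _ u∈ _ → cycle-neighbour t≥1 cycle (<⇒≤ k≥3) u∈)
  where open OddCConfiguration cc

evenC⇒harmonic : {G : Graph n} {X : Assignment n m} {H : Graph m} {f : Fin m → ℕ} →
                 EvenCConfiguration G X H f → Harmonic G X H f
evenC⇒harmonic {G = G} {X} {H} cc = layered⇒harmonic (proj₁ uniform) {1} (λ _ → U) (λ _ _ → 2 * t)
  (λ _ → layer inflation)
  (λ v∈ x∈ _ → f-inside v∈ x∈)
  (λ v∈ x∈ x∉ → f-outside v∈ x∈ (x∉ zero))
  (λ _ adj → cong (2 * t *_) (sym (cycle-regular t≥1 cycle adj)))
  (λ _ u∈ _ → cycle-neighbour t≥1 cycle k≥2 u∈)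
  where
  open EvenCConfiguration cc
  k≥2 : k ≥ 2
  k≥2 = ≤-trans (s≤s (s≤s z≤n)) k≥4
  layer : InflationOf (IsDoubleCover G t k cycle) G (X ↾ U) (H [ U ]) → Layer G X H U
  layer (_ , _ , _ , dc , _ , s≢0 , infl) =
    inflation⇒layer (proj₁ uniform) (doubleCover⇒lift k≥2 dc) {{s≢0}} infl

BlockConfiguration : (G : Graph n) (X : Assignment n m) (H : Graph m) (f : Fin m → ℕ) → Set
BlockConfiguration G X H f = MConfiguration G X H f ⊎ KConfiguration G X H f ⊎ CConfiguration G X H f

block⇒harmonic : {G : Graph n} {X : Assignment n m} {H : Graph m} {f : Fin m → ℕ} →
                 BlockConfiguration G X H f → Harmonic G X H f
block⇒harmonic (inj₁ mc)               = m⇒harmonic mc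
block⇒harmonic (inj₂ (inj₁ kc))        = k⇒harmonic kc
block⇒harmonic (inj₂ (inj₂ (inj₁ cc))) = oddC⇒harmonic cc
block⇒harmonic (inj₂ (inj₂ (inj₂ cc))) = evenC⇒harmonic cc

block-connectedNonseparable : {G : Graph n} {X : Assignment n m} {H : Graph m} {f : Fin m → ℕ} →
                              BlockConfiguration G X H f → ConnectedNonseparable G
block-connectedNonseparable (inj₁ mc) =
  isBlock⇒connectedNonseparable (MConfiguration.isBlock mc)
block-connectedNonseparable (inj₂ (inj₁ kc)) =
  ≅-connectedNonseparable complete (K-connectedNonseparable t≥1 k≥1)
  where open KConfiguration kc
block-connectedNonseparable (inj₂ (inj₂ (inj₁ cc))) =
  ≅-connectedNonseparable cycle (C-connectedNonseparable t≥1 k≥3)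
  where open OddCConfiguration cc
block-connectedNonseparable (inj₂ (inj₂ (inj₂ cc))) =
  ≅-connectedNonseparable cycle (C-connectedNonseparable t≥1 (<⇒≤ k≥4))
  where open EvenCConfiguration cc

harmonic-agree : {G : Graph n} {X : Assignment n m} {H : Graph m} {f g : Fin m → ℕ} →
  Harmonic G X H f → Harmonic G X H g → ∀ {v x} → v ∈ V G → x ∈ X v → f x ≢ 0 →
  (∀ {u y} → u ∈ V G → u ≢ v → y ∈ X u → f y ≡ g y) → f x ≡ g x
harmonic-agree {G = G} hf hg {v} v∈ x∈ fx≢0 agree with Harmonic.spread hf v∈ x∈ fx≢0
... | u , adj , y , y∈ , adjH = *-cancelʳ-≡ _ _ (degree G u)
    {{≢-nonZero (degree≢0 G (adjacent-sym G adj))}}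
    (trans (Harmonic.balanced hf v∈ u∈ x∈ y∈ adjH) (trans
      (cong (_* degree G v) (agree u∈ (adjacent⇒≢ G adj ∘ sym) y∈))
      (sym (Harmonic.balanced hg v∈ u∈ x∈ y∈ adjH))))
    where u∈ = adjacent-∈ʳ G adj

harmonic-unique : {G : Graph n} {X : Assignment n m} {H : Graph m} {f g : Fin m → ℕ} →
  Harmonic G X H f → Harmonic G X H g → ∀ w →
  (∀ {v x} → v ∈ V G → v ≢ w → x ∈ X v → f x ≡ g x) →
  ∀ {v x} → v ∈ V G → x ∈ X v → f x ≡ g x
harmonic-unique {G = G} {X} {H} {f} {g} hf hg w agree {v} {x} v∈ x∈ with v ≟ w
... | no v≢w = agree v∈ v≢w x∈
... | yes refl with f x ≟ℕ 0 | g x ≟ℕ 0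
...   | yes fx≡0 | yes gx≡0 = trans fx≡0 (sym gx≡0)
...   | no fx≢0  | _        = harmonic-agree hf hg v∈ x∈ fx≢0 agree
...   | yes _    | no gx≢0  = sym (harmonic-agree hg hf v∈ x∈ gx≢0 λ u∈ u≢v y∈ → sym (agree u∈ u≢v y∈))

-- Transport of configurations along isomorphisms

module _ {S : Graph l} {G : Graph n} (c : S ≅ G) (default : Fin l) where
  open _≅_ c renaming (to to ι)

  private
    preimage? : ∀ v → Dec (∃[ i ] i ∈ V S × ι i ≡ v)
    preimage? v = any? λ i → i ∈? V S ×-dec ι i ≟ v
    back : Fin n → Fin l
    back v with preimage? v
    ... | yes (i , _) = i
    ... | no _        = default
    back-∈ : ∀ {v} → v ∈ V G → back v ∈ V S × ι (back v) ≡ v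
    back-∈ {v} v∈ with preimage? v
    ... | yes (i , p) = p
    ... | no ¬p       = contradiction (surjective v∈) ¬p

  ≅-sym : G ≅ S
  ≅-sym = record
    { to         = back
    ; to-∈       = λ v∈ → proj₁ (back-∈ v∈)
    ; injective  = λ u∈ v∈ eq →
        trans (sym (proj₂ (back-∈ u∈))) (trans (cong ι eq) (proj₂ (back-∈ v∈)))
    ; surjective = λ {i} i∈ → ι i , to-∈ i∈ ,
        let b∈ , eq = back-∈ (to-∈ i∈) in injective b∈ i∈ eq
    ; to-μ       = λ u∈ v∈ → let u′∈ , u≡ = back-∈ u∈ ; v′∈ , v≡ = back-∈ v∈ in
        trans (sym (to-μ u′∈ v′∈)) (cong₂ (μ G) u≡ v≡)
    }

  to-≅-sym : ∀ {v} → v ∈ V G → ι (_≅_.to ≅-sym v) ≡ v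
  to-≅-sym v∈ = proj₂ (back-∈ v∈)

  ≅-sym-to : ∀ {i} → i ∈ V S → _≅_.to ≅-sym (ι i) ≡ i
  ≅-sym-to i∈ = let b∈ , eq = back-∈ (to-∈ i∈) in injective b∈ i∈ eq

module Pullback {G : Graph n} {G₁ : Graph n₁} (d : G ≅ G₁) where
  open _≅_ d renaming (to to ȷ)

  pull-cover : {X₀ : Assignment n₁ m₀} {H₀ : Graph m₀} → IsCover G₁ X₀ H₀ → IsCover G (X₀ ∘ ȷ) H₀
  pull-cover {H₀ = H₀} cov = record
    { disjoint    = λ u∈ v∈ u≢v → C₀.disjoint (to-∈ u∈) (to-∈ v∈) (u≢v ∘ injective u∈ v∈)
    ; union       = mk⇔ over λ (v , v∈ , x∈) → from C₀.union (ȷ v , to-∈ v∈ , x∈)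
    ; independent = C₀.independent ∘ to-∈
    ; matchings   = λ u∈ v∈ u≢v → subst (UnionOfMatchings H₀ _ _) (to-μ u∈ v∈)
        (C₀.matchings (to-∈ u∈) (to-∈ v∈) (u≢v ∘ injective u∈ v∈))
    }
    where
    module C₀ = IsCover cov
    over : ∀ {x} → x ∈ V H₀ → ∃[ v ] v ∈ V G × x ∈ _
    over x∈ with to C₀.union x∈
    ... | a , a∈ , x∈X with surjective a∈
    ...   | v , v∈ , refl = v , v∈ , x∈X

  pull-gCover : {X₀ : Assignment n₁ m₀} {H₀ : Graph m₀} → IsGCover G₁ X₀ H₀ → IsGCover G (X₀ ∘ ȷ) H₀
  pull-gCover gc = record
    { isCover   = pull-cover isCover
    ; x         = x ∘ ȷ
    ; singleton = singleton ∘ to-∈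
    ; x-μ       = λ u∈ v∈ u≢v → trans (x-μ (to-∈ u∈) (to-∈ v∈) (u≢v ∘ injective u∈ v∈)) (to-μ u∈ v∈)
    }
    where open IsGCover gc

  pull-doubleCover : ∀ {t k} {c : t · C k ≅ G} {c₁ : t · C k ≅ G₁} →
    (∀ i → ȷ (_≅_.to c i) ≡ _≅_.to c₁ i) →
    {X₀ : Assignment n₁ m₀} {H₀ : Graph m₀} →
    IsDoubleCover G₁ t k c₁ X₀ H₀ → IsDoubleCover G t k c (X₀ ∘ ȷ) H₀
  pull-doubleCover same {X₀} dc = record
    { isCover   = pull-cover isCover
    ; x         = x
    ; injective = IsDoubleCover.injective dc
    ; pair      = λ i → trans (cong X₀ (same i)) (pair i)
    ; x-μ       = x-μ
    }
    where open IsDoubleCover dc hiding (injective)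

record CoverIso (G₁ : Graph n₁) (X₁ : Assignment n₁ m₁) (H₁ : Graph m₁)
                (G : Graph n) (X : Assignment n m) (H : Graph m) : Set where
  field
    graph : G₁ ≅ G
    cover : H₁ ≅ H
  open _≅_ graph public renaming
    (to to ι; to-∈ to ι-∈; injective to ι-injective; surjective to ι-surjective; to-μ to ι-μ)
  open _≅_ cover public renaming
    (to to κ; to-∈ to κ-∈; injective to κ-injective; surjective to κ-surjective; to-μ to κ-μ)
  field
    X₁-⊆  : ∀ {a} → a ∈ V G₁ → X₁ a ⊆ V H₁
    X-ι   : ∀ {a} → a ∈ V G₁ → ∀ {z} → z ∈ X (ι a) ⇔ (∃[ x ] x ∈ X₁ a × κ x ≡ z)

module _ {G₁ : Graph n₁} {X₁ : Assignment n₁ m₁} {H₁ : Graph m₁}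
         {G : Graph n} {X : Assignment n m} {H : Graph m}
         (iso : CoverIso G₁ X₁ H₁ G X H) where
  open CoverIso iso

  ∈-image-κ : ∀ {U} → U ⊆ V H₁ → ∀ {x} → x ∈ V H₁ → κ x ∈ image κ U → x ∈ U
  ∈-image-κ {U} U⊆ x∈ κx∈ with to (∈image κ U) κx∈
  ... | y , y∈ , eq = subst (_∈ U) (κ-injective (U⊆ y∈) x∈ eq) y∈

  image-κ-⊆ : ∀ {U} → U ⊆ V H₁ → image κ U ⊆ V H
  image-κ-⊆ {U} U⊆ z∈ with to (∈image κ U) z∈
  ... | x , x∈ , refl = κ-∈ (U⊆ x∈)

  image-κ-disjoint : ∀ {U W} → U ⊆ V H₁ → W ⊆ V H₁ → Empty (U ∩ W) → Empty (image κ U ∩ image κ W)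
  image-κ-disjoint {U} {W} U⊆ W⊆ disj (z , z∈) with x∈p∩q⁻ (image κ U) (image κ W) z∈
  ... | z∈U , z∈W with to (∈image κ U) z∈U
  ...   | x , x∈ , refl = disj (x , x∈p∩q⁺ (x∈ , ∈-image-κ W⊆ (U⊆ x∈) z∈W))

  restrictIso : ∀ {U} → U ⊆ V H₁ →
                CoverIso G₁ (X₁ ↾ U) (H₁ [ U ]) G (X ↾ image κ U) (H [ image κ U ])
  restrictIso {U} U⊆ = record
    { graph = graph
    ; cover = Iso.≅-restrict cover U (image κ U) λ x∈ →
        mk⇔ (λ x∈U → from (∈image κ U) (_ , x∈U , refl)) (∈-image-κ U⊆ x∈)
    ; X₁-⊆  = λ {a} a∈ x∈ → let x∈X , x∈U = x∈p∩q⁻ (X₁ a) U x∈ in x∈p∩q⁺ (X₁-⊆ a∈ x∈X , x∈U)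
    ; X-ι   = λ a∈ → mk⇔ (fwd a∈) (bwd a∈)
    }
    where
    fwd : ∀ {a} → a ∈ V G₁ → ∀ {z} → z ∈ X (ι a) ∩ image κ U → ∃[ x ] x ∈ X₁ a ∩ U × κ x ≡ z
    fwd {a} a∈ z∈ with x∈p∩q⁻ (X (ι a)) (image κ U) z∈
    ... | z∈X , z∈U with to (X-ι a∈) z∈X
    ...   | x , x∈ , refl = x , x∈p∩q⁺ (x∈ , ∈-image-κ U⊆ (X₁-⊆ a∈ x∈) z∈U) , refl
    bwd : ∀ {a} → a ∈ V G₁ → ∀ {z} → (∃[ x ] x ∈ X₁ a ∩ U × κ x ≡ z) → z ∈ X (ι a) ∩ image κ U
    bwd {a} a∈ (x , x∈ , refl) with x∈p∩q⁻ (X₁ a) U x∈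
    ... | x∈X , x∈U = x∈p∩q⁺ (from (X-ι a∈) (x , x∈X , refl) , from (∈image κ U) (x , x∈U , refl))

  ∣X-ι∣ : ∀ {a} → a ∈ V G₁ → ∣ X (ι a) ∣ ≡ ∣ X₁ a ∣
  ∣X-ι∣ a∈ = ∣image∣ κ (λ x∈ y∈ → κ-injective (X₁-⊆ a∈ x∈) (X₁-⊆ a∈ y∈)) (X-ι a∈)

  isInflation⁺ : (d : G ≅ G₁) → (∀ {v} → v ∈ V G → ι (_≅_.to d v) ≡ v) →
    ∀ {s} .{{_ : NonZero s}} {X₀ : Assignment n₁ m₀} {H₀ : Graph m₀} →
    IsInflation s G₁ X₀ H₀ X₁ H₁ → IsInflation s G (X₀ ∘ _≅_.to d) H₀ X H
  isInflation⁺ d ι-ȷ {X₀ = X₀} {H₀} infl = record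
    { divides     = I.divides
    ; U           = image κ ∘ I.U
    ; size        = λ {x} x∈ → trans (∣image∣ κ (λ y∈ z∈ → κ-injective (U⊆ x∈ y∈) (U⊆ x∈ z∈))
                      (∈image κ (I.U x))) (I.size x∈)
    ; disjoint    = λ x∈ y∈ x≢y → image-κ-disjoint (U⊆ x∈) (U⊆ y∈) (I.disjoint x∈ y∈ x≢y)
    ; vertices    = mk⇔ vertices⁻ vertices⁺
    ; assignment  = λ v∈ → mk⇔ (assignment⁻ v∈) (assignment⁺ v∈)
    ; independent = independent
    ; bipartite   = bipartite
    }
    where
    module I = IsInflation infl
    open _≅_ d using () renaming (to to ȷ; to-∈ to ȷ-∈)
    U⊆ : ∀ {x} → x ∈ V H₀ → I.U x ⊆ V H₁
    U⊆ x∈ y∈ = from I.vertices (_ , x∈ , y∈)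
    vertices⁻ : ∀ {z} → z ∈ V H → ∃[ x ] x ∈ V H₀ × z ∈ image κ (I.U x)
    vertices⁻ z∈ with κ-surjective z∈
    ... | y , y∈ , refl with to I.vertices y∈
    ...   | x , x∈ , y∈U = x , x∈ , from (∈image κ (I.U x)) (y , y∈U , refl)
    vertices⁺ : ∀ {z} → (∃[ x ] x ∈ V H₀ × z ∈ image κ (I.U x)) → z ∈ V H
    vertices⁺ (x , x∈ , z∈) = image-κ-⊆ (U⊆ x∈) z∈
    assignment⁻ : ∀ {v} → v ∈ V G → ∀ {z} → z ∈ X v → ∃[ x ] x ∈ X₀ (ȷ v) × z ∈ image κ (I.U x)
    assignment⁻ {v} v∈ {z} z∈ with to (X-ι (ȷ-∈ v∈)) (subst (λ w → z ∈ X w) (sym (ι-ȷ v∈)) z∈)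
    ... | y , y∈ , refl with to (I.assignment (ȷ-∈ v∈)) y∈
    ...   | x , x∈ , y∈U = x , x∈ , from (∈image κ (I.U x)) (y , y∈U , refl)
    assignment⁺ : ∀ {v} → v ∈ V G → ∀ {z} → (∃[ x ] x ∈ X₀ (ȷ v) × z ∈ image κ (I.U x)) → z ∈ X v
    assignment⁺ v∈ (x , x∈ , z∈) with to (∈image κ (I.U x)) z∈
    ... | y , y∈ , refl = subst (λ w → κ y ∈ X w) (ι-ȷ v∈)
            (from (X-ι (ȷ-∈ v∈)) (y , from (I.assignment (ȷ-∈ v∈)) (x , x∈ , y∈) , refl))
    independent : ∀ {x} → x ∈ V H₀ → ∀ {z w} → z ∈ image κ (I.U x) → w ∈ image κ (I.U x) → μ H z w ≡ 0
    independent {x} x∈ z∈ w∈ with to (∈image κ (I.U x)) z∈ | to (∈image κ (I.U x)) w∈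
    ... | a , a∈ , refl | b , b∈ , refl = trans (κ-μ (U⊆ x∈ a∈) (U⊆ x∈ b∈)) (I.independent x∈ a∈ b∈)
    bipartite : ∀ {x y} → x ∈ V H₀ → y ∈ V H₀ → x ≢ y →
                ∀ {z w} → z ∈ image κ (I.U x) → w ∈ image κ (I.U y) → μ H z w ≡ μ H₀ x y / _
    bipartite {x} {y} x∈ y∈ x≢y z∈ w∈ with to (∈image κ (I.U x)) z∈ | to (∈image κ (I.U y)) w∈
    ... | a , a∈ , refl | b , b∈ , refl =
      trans (κ-μ (U⊆ x∈ a∈) (U⊆ y∈ b∈)) (I.bipartite x∈ y∈ x≢y a∈ b∈)

module Transport {G₁ : Graph n₁} {X₁ : Assignment n₁ m₁} {H₁ : Graph m₁} {f₁ : Fin m₁ → ℕ}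
                 {G : Graph n} {X : Assignment n m} {H : Graph m} {f : Fin m → ℕ}
                 (iso : CoverIso G₁ X₁ H₁ G X H) (uniform : Uniform G X H)
                 (f-κ : ∀ {a x} → a ∈ V G₁ → x ∈ X₁ a → f (CoverIso.κ iso x) ≡ f₁ x) where
  open CoverIso iso

  inflationOf⁺ : (P₁ : ∀ {m₀} → Assignment n₁ m₀ → Graph m₀ → Set)
    (P : ∀ {m₀} → Assignment n m₀ → Graph m₀ → Set) (a₀ : Fin n₁) →
    (∀ {m₀} {X₀ : Assignment n₁ m₀} {H₀ : Graph m₀} →
       P₁ X₀ H₀ → P (X₀ ∘ _≅_.to (≅-sym graph a₀)) H₀) →
    ∀ {U} → U ⊆ V H₁ →
    InflationOf P₁ G₁ (X₁ ↾ U) (H₁ [ U ]) → InflationOf P G (X ↾ image κ U) (H [ image κ U ])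
  inflationOf⁺ P₁ P a₀ pull U⊆ (m₀ , X₀ , H₀ , p , s , s≢0 , infl) =
    m₀ , _ , H₀ , pull p , s , s≢0 ,
    isInflation⁺ (restrictIso iso U⊆) (≅-sym graph a₀) (to-≅-sym graph a₀) {{s≢0}} infl

  gInflation⁺ : Fin n₁ → ∀ {U} → U ⊆ V H₁ →
    InflationOf (IsGCover G₁) G₁ (X₁ ↾ U) (H₁ [ U ]) →
    InflationOf (IsGCover G) G (X ↾ image κ U) (H [ image κ U ])
  gInflation⁺ a₀ = inflationOf⁺ (IsGCover G₁) (IsGCover G) a₀ (Pullback.pull-gCover (≅-sym graph a₀))

  f-inside⁺ : ∀ {U} → U ⊆ V H₁ → (c : Fin n₁ → ℕ) (d : Fin n → ℕ) →
    (∀ {a} → a ∈ V G₁ → c a ≡ d (ι a)) →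
    (∀ {a x} → a ∈ V G₁ → x ∈ X₁ a → x ∈ U → f₁ x * ∣ X₁ a ∩ U ∣ ≡ c a) →
    ∀ {v z} → v ∈ V G → z ∈ X v → z ∈ image κ U → f z * ∣ X v ∩ image κ U ∣ ≡ d v
  f-inside⁺ U⊆ c d c≡d on v∈ z∈ z∈U with ι-surjective v∈
  ... | a , a∈ , refl with to (X-ι a∈) z∈
  ...   | x , x∈ , refl = trans (cong₂ _*_ (f-κ a∈ x∈) (∣X-ι∣ (restrictIso iso U⊆) a∈))
            (trans (on a∈ x∈ (∈-image-κ iso U⊆ (X₁-⊆ a∈ x∈) z∈U)) (c≡d a∈))

  f-outside⁺ : ∀ {p} (U : Fin p → Subset m₁) →
    (∀ {a x} → a ∈ V G₁ → x ∈ X₁ a → (∀ i → x ∉ U i) → f₁ x ≡ 0) →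
    ∀ {v z} → v ∈ V G → z ∈ X v → (∀ i → z ∉ image κ (U i)) → f z ≡ 0
  f-outside⁺ U off v∈ z∈ z∉ with ι-surjective v∈
  ... | a , a∈ , refl with to (X-ι a∈) z∈
  ...   | x , x∈ , refl = trans (f-κ a∈ x∈)
            (off a∈ x∈ λ i x∈U → z∉ i (from (∈image κ (U i)) (x , x∈U , refl)))

  m⁺ : MConfiguration G₁ X₁ H₁ f₁ → MConfiguration G X H f
  m⁺ mc = record
    { uniform   = uniform
    ; isBlock   = connectedNonseparable⇒isBlock
        (≅-connectedNonseparable graph (isBlock⇒connectedNonseparable M.isBlock))
    ; U         = image κ M.U
    ; U⊆H       = image-κ-⊆ iso M.U⊆H
    ; inflation = gInflation⁺ (proj₁ (proj₁ (proj₁ (isBlock⇒connectedNonseparable M.isBlock))))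
                    M.U⊆H M.inflation
    ; f-inside  = f-inside⁺ M.U⊆H (degree G₁) (degree G) (λ a∈ → sym (Iso.≅-degree graph a∈)) M.f-inside
    ; f-outside = λ v∈ z∈ z∉ → f-outside⁺ {1} (λ _ → M.U)
                    (λ a∈ x∈ x∉ → M.f-outside a∈ x∈ (x∉ zero)) v∈ z∈ (λ _ → z∉)
    }
    where module M = MConfiguration mc

  k⁺ : KConfiguration G₁ X₁ H₁ f₁ → KConfiguration G X H f
  k⁺ kc = record
    { uniform   = uniform
    ; t         = K₁.t
    ; k         = K₁.k
    ; t≥1       = K₁.t≥1
    ; k≥1       = K₁.k≥1
    ; complete  = ≅-trans K₁.complete graph
    ; p         = K₁.p
    ; p≥1       = K₁.p≥1
    ; parts     = K₁.parts
    ; parts≥1   = K₁.parts≥1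
    ; parts-sum = K₁.parts-sum
    ; U         = image κ ∘ K₁.U
    ; U⊆H       = λ i → image-κ-⊆ iso (K₁.U⊆H i)
    ; disjoint  = λ {i} {j} i≢j → image-κ-disjoint iso (K₁.U⊆H i) (K₁.U⊆H j) (K₁.disjoint i≢j)
    ; inflation = λ i → gInflation⁺ (_≅_.to K₁.complete (fromℕ< K₁.k≥1)) (K₁.U⊆H i) (K₁.inflation i)
    ; f-inside  = λ v∈ z∈ i → f-inside⁺ (K₁.U⊆H i) _ _ (λ _ → refl)
                    (λ a∈ x∈ → K₁.f-inside a∈ x∈ i) v∈ z∈
    ; f-outside = f-outside⁺ K₁.U K₁.f-outside
    }
    where module K₁ = KConfiguration kc

  oddC⁺ : OddCConfiguration G₁ X₁ H₁ f₁ → OddCConfiguration G X H f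
  oddC⁺ cc = record
    { uniform   = uniform
    ; t         = C₁.t
    ; k         = C₁.k
    ; t≥1       = C₁.t≥1
    ; k≥3       = C₁.k≥3
    ; odd       = C₁.odd
    ; cycle     = ≅-trans C₁.cycle graph
    ; U         = image κ ∘ C₁.U
    ; U⊆H       = λ i → image-κ-⊆ iso (C₁.U⊆H i)
    ; disjoint  = λ {i} {j} i≢j → image-κ-disjoint iso (C₁.U⊆H i) (C₁.U⊆H j) (C₁.disjoint i≢j)
    ; inflation = λ i → gInflation⁺ (_≅_.to C₁.cycle (fromℕ< (≤-trans (s≤s z≤n) C₁.k≥3)))
                    (C₁.U⊆H i) (C₁.inflation i)
    ; f-inside  = λ v∈ z∈ i → f-inside⁺ (C₁.U⊆H i) _ _ (λ _ → refl)
                    (λ a∈ x∈ → C₁.f-inside a∈ x∈ i) v∈ z∈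
    ; f-outside = f-outside⁺ C₁.U C₁.f-outside
    }
    where module C₁ = OddCConfiguration cc

  evenC⁺ : EvenCConfiguration G₁ X₁ H₁ f₁ → EvenCConfiguration G X H f
  evenC⁺ cc = record
    { uniform   = uniform
    ; t         = C₁.t
    ; k         = C₁.k
    ; t≥1       = C₁.t≥1
    ; k≥4       = C₁.k≥4
    ; even      = C₁.even
    ; cycle     = ≅-trans C₁.cycle graph
    ; U         = image κ C₁.U
    ; U⊆H       = image-κ-⊆ iso C₁.U⊆H
    ; inflation = inflationOf⁺ _ _ a₀ (Pullback.pull-doubleCover (≅-sym graph a₀)
                    λ i → ≅-sym-to graph a₀ (_≅_.to-∈ C₁.cycle (cycle-∈ C₁.k i))) C₁.U⊆H C₁.inflation
    ; f-inside  = f-inside⁺ C₁.U⊆H (λ _ → 2 * C₁.t) _ (λ _ → refl) C₁.f-inside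
    ; f-outside = λ v∈ z∈ z∉ → f-outside⁺ {1} (λ _ → C₁.U)
                    (λ a∈ x∈ x∉ → C₁.f-outside a∈ x∈ (x∉ zero)) v∈ z∈ (λ _ → z∉)
    }
    where
    module C₁ = EvenCConfiguration cc
    a₀ = _≅_.to C₁.cycle (fromℕ< (≤-trans (s≤s z≤n) C₁.k≥4))
    cycle-∈ : ∀ k (i : Fin k) → i ∈ V (C k)
    cycle-∈ (suc k) i = ∈⊤

  block⁺ : BlockConfiguration G₁ X₁ H₁ f₁ → BlockConfiguration G X H f
  block⁺ (inj₁ mc)               = inj₁ (m⁺ mc)
  block⁺ (inj₂ (inj₁ kc))        = inj₂ (inj₁ (k⁺ kc))
  block⁺ (inj₂ (inj₂ (inj₁ cc))) = inj₂ (inj₂ (inj₁ (oddC⁺ cc)))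
  block⁺ (inj₂ (inj₂ (inj₂ cc))) = inj₂ (inj₂ (inj₂ (evenC⁺ cc)))

-- Trees of blocks

∈⋃⇔ : (L : List (Subset n)) {z : Fin n} → z ∈ ⋃ L ⇔ (∃[ S ] S ∈ˡ L × z ∈ S)
∈⋃⇔ L = mk⇔ (fwd L) (bwd L)
  where
  fwd : ∀ L {z} → z ∈ ⋃ L → ∃[ S ] S ∈ˡ L × z ∈ S
  fwd []      z∈ = contradiction z∈ ∉⊥
  fwd (S ∷ L) z∈ with x∈p∪q⁻ S (⋃ L) z∈
  ... | inj₁ z∈S = S , here refl , z∈S
  ... | inj₂ z∈L = let T , T∈ , z∈T = fwd L z∈L in T , there T∈ , z∈T
  bwd : ∀ L {z} → (∃[ S ] S ∈ˡ L × z ∈ S) → z ∈ ⋃ L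
  bwd (S ∷ L) (_ , here refl , z∈) = x∈p∪q⁺ (inj₁ z∈)
  bwd (S ∷ L) (T , there T∈ , z∈)  = x∈p∪q⁺ {p = S} (inj₂ (bwd L (T , T∈ , z∈)))

fibres : Graph n → Assignment n m → Subset m
fibres {n} B X = ⋃ (List.map X (filter (_∈? V B) (allFin n)))

∈-fibres : (B : Graph n) (X : Assignment n m) {z : Fin m} →
           z ∈ fibres B X ⇔ (∃[ v ] v ∈ V B × z ∈ X v)
∈-fibres {n} B X = mk⇔ fwd bwd
  where
  fwd : ∀ {z} → z ∈ fibres B X → ∃[ v ] v ∈ V B × z ∈ X v
  fwd z∈ with to (∈⋃⇔ (List.map X (filter (_∈? V B) (allFin n)))) z∈
  ... | S , S∈ , z∈S with ∈-map⁻ X S∈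
  ...   | v , v∈ , refl = v , proj₂ (∈-filter⁻ (_∈? V B) {xs = allFin n} v∈) , z∈S
  bwd : ∀ {z} → (∃[ v ] v ∈ V B × z ∈ X v) → z ∈ fibres B X
  bwd (v , v∈ , z∈) = from (∈⋃⇔ (List.map X (filter (_∈? V B) (allFin n))))
    (X v , ∈-map⁺ X (∈-filter⁺ (_∈? V B) (∈-allFin v) v∈) , z∈)

unionOfMatchings-[] : {H : Graph m} {P Q : Subset m} {k : ℕ} (W : Subset m) →
  UnionOfMatchings H P Q k → UnionOfMatchings (H [ W ]) P Q k
unionOfMatchings-[] {m} {H} {P} {Q} {k} W (E , matching , covering) =
  (λ i x y → restrict (b x y) (E i x y)) ,
  (λ i → record
    { uniqueʳ = λ {x} {y} {y′} x∈ y∈ y′∈ {e} {e′} e∈ e′∈ → rʳ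
        (IsMatching.uniqueʳ (matching i) x∈ y∈ y′∈ (restrict⁻ (b x y) e∈) (restrict⁻ (b x y′) e′∈))
    ; uniqueˡ = λ {x} {x′} {y} x∈ x′∈ y∈ {e} {e′} e∈ e′∈ → rˡ
        (IsMatching.uniqueˡ (matching i) x∈ x′∈ y∈ (restrict⁻ (b x y) e∈) (restrict⁻ (b x′ y) e′∈))
    }) ,
  λ {x} {y} x∈ y∈ e → let i , e∈ = covering x∈ y∈ (widen (b x y) e) in i , restrict⁺ (b x y) e e∈
  where
  b : Fin m → Fin m → Bool
  b x y = does (x ∈? W) ∧ does (y ∈? W)
  widen : ∀ b {j} → Fin (if b then j else 0) → Fin j
  widen true e = e
  widen-injective : ∀ b {j} {e e′ : Fin (if b then j else 0)} → widen b e ≡ widen b e′ → e ≡ e′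
  widen-injective true eq = eq
  restrict : ∀ b {j} → Subset j → Subset (if b then j else 0)
  restrict true  S = S
  restrict false S = []
  restrict⁺ : ∀ b {j} {S : Subset j} (e : Fin (if b then j else 0)) → widen b e ∈ S → e ∈ restrict b S
  restrict⁺ true e e∈ = e∈
  restrict⁻ : ∀ b {j} {S : Subset j} {e : Fin (if b then j else 0)} → e ∈ restrict b S → widen b e ∈ S
  restrict⁻ true e∈ = e∈
  rʳ : ∀ {x y y′ e e′} →
       _≡_ {A = Σ[ z ∈ Fin m ] Fin (μ H x z)} (y , widen (b x y) e) (y′ , widen (b x y′) e′) →
       _≡_ {A = Σ[ z ∈ Fin m ] Fin (μ (H [ W ]) x z)} (y , e) (y′ , e′)
  rʳ {x} {y} eq with ,-injectiveˡ eq
  ... | refl = cong (y ,_) (widen-injective (b x y) (,-injectiveʳ eq))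
  rˡ : ∀ {x x′ y e e′} →
       _≡_ {A = Σ[ z ∈ Fin m ] Fin (μ H z y)} (x , widen (b x y) e) (x′ , widen (b x′ y) e′) →
       _≡_ {A = Σ[ z ∈ Fin m ] Fin (μ (H [ W ]) z y)} (x , e) (x′ , e′)
  rˡ {x} {_} {y} eq with ,-injectiveˡ eq
  ... | refl = cong (x ,_) (widen-injective (b x y) (,-injectiveʳ eq))

module Decomposition (G : Graph n) (X : Assignment n m) (H : Graph m) where

  infix 8 _ᴴ

  _ᴴ : Subset n → Graph m
  S ᴴ = coverOver (G [ S ]) X H

  Large : Subset n → Set
  Large S = ∃[ a ] ∃[ b ] a ∈ S × b ∈ S × a ≢ b

  record Glued (S₁ S₂ S : Subset n) (f₁ f₂ f : Fin m → ℕ) : Set where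
    field
      v*      : Fin n
      v*∈₁    : v* ∈ S₁
      v*∈₂    : v* ∈ S₂
      other₁  : ∃[ a ] a ∈ S₁ × a ≢ v*
      other₂  : ∃[ b ] b ∈ S₂ × b ≢ v*
      common : ∀ {v} → v ∈ S₁ → v ∈ S₂ → v ≡ v*
      across  : ∀ {a b} → a ∈ S₁ → a ∉ S₂ → b ∈ S₂ → b ∉ S₁ → μ G a b ≡ 0
      union   : ∀ {v} → v ∈ S ⇔ (v ∈ S₁ ⊎ v ∈ S₂)
      f-left  : ∀ {v z} → v ∈ S₁ → v ≢ v* → z ∈ X v → f z ≡ f₁ z
      f-right : ∀ {v z} → v ∈ S₂ → v ≢ v* → z ∈ X v → f z ≡ f₂ z
      f-both  : ∀ {z} → z ∈ X v* → f z ≡ f₁ z + f₂ z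

    ⊆₁ : S₁ ⊆ S
    ⊆₁ v∈ = from union (inj₁ v∈)
    ⊆₂ : S₂ ⊆ S
    ⊆₂ v∈ = from union (inj₂ v∈)
    large₁ : Large S₁
    large₁ = let a , a∈ , a≢ = other₁ in a , v* , a∈ , v*∈₁ , a≢
    large₂ : Large S₂
    large₂ = let b , b∈ , b≢ = other₂ in b , v* , b∈ , v*∈₂ , b≢

  -- All pieces of nested merges are kept as vertex sets S of the final G, so
  -- relabelling is needed for the configurations at the leaves only.
  data BlockTree : Subset n → (Fin m → ℕ) → Set where
    leaf : ∀ {S f} → S ⊆ V G → BlockConfiguration (G [ S ]) X (S ᴴ) f → BlockTree S f
    node : ∀ {S₁ S₂ S f₁ f₂ f} → Glued S₁ S₂ S f₁ f₂ f →
           BlockTree S₁ f₁ → BlockTree S₂ f₂ → BlockTree S f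

  leaves : ∀ {S f} → BlockTree S f → List (Subset n)
  leaves (leaf {S} _ _)  = S ∷ []
  leaves (node _ T₁ T₂) = leaves T₁ ++ leaves T₂

  tree-⊆ : ∀ {S f} → BlockTree S f → S ⊆ V G
  tree-⊆ (leaf S⊆ _)    = S⊆
  tree-⊆ (node g T₁ T₂) v∈ with to (Glued.union g) v∈
  ... | inj₁ v∈₁ = tree-⊆ T₁ v∈₁
  ... | inj₂ v∈₂ = tree-⊆ T₂ v∈₂

  leaf-⊆ : ∀ {S f} (T : BlockTree S f) {B} → B ∈ˡ leaves T → B ⊆ S
  leaf-⊆ (leaf _ _)     (here refl) v∈ = v∈
  leaf-⊆ (node g T₁ T₂) B∈ v∈ with ∈-++⁻ (leaves T₁) B∈
  ... | inj₁ B∈₁ = Glued.⊆₁ g (leaf-⊆ T₁ B∈₁ v∈)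
  ... | inj₂ B∈₂ = Glued.⊆₂ g (leaf-⊆ T₂ B∈₂ v∈)

  leaf-large : ∀ {S f} (T : BlockTree S f) → Large S → ∀ {B} → B ∈ˡ leaves T → Large B
  leaf-large (leaf _ _)     large (here refl) = large
  leaf-large (node g T₁ T₂) _     B∈ with ∈-++⁻ (leaves T₁) B∈
  ... | inj₁ B∈₁ = leaf-large T₁ (Glued.large₁ g) B∈₁
  ... | inj₂ B∈₂ = leaf-large T₂ (Glued.large₂ g) B∈₂

  module _ {S₁ S₂ S f₁ f₂ f} (g : Glued S₁ S₂ S f₁ f₂ f) where
    open Glued g

    not-in-both : ∀ {B} → Large B → B ⊆ S₁ → ¬ B ⊆ S₂
    not-in-both (a , b , a∈ , b∈ , a≢b) ⊆S₁ ⊆S₂ =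
      a≢b (trans (common (⊆S₁ a∈) (⊆S₂ a∈)) (sym (common (⊆S₁ b∈) (⊆S₂ b∈))))

    one-sided : ∀ {B} → B ⊆ V G → B ⊆ S → ConnectedNonseparable (G [ B ]) → B ⊆ S₁ ⊎ B ⊆ S₂
    one-sided {B} B⊆G B⊆S ((_ , conn) , nonsep)
      with any? (λ a → a ∈? B ×-dec ¬? (a ∈? S₂)) | any? (λ b → b ∈? B ×-dec ¬? (b ∈? S₁))
    ... | no ¬a | _     = inj₂ λ {v} v∈ → decidable-stable (v ∈? S₂) λ v∉ → ¬a (v , v∈ , v∉)
    ... | yes _ | no ¬b = inj₁ λ {v} v∈ → decidable-stable (v ∈? S₁) λ v∉ → ¬b (v , v∈ , v∉)
    ... | yes (a , a∈B , a∉₂) | yes (b , b∈B , b∉₁) = contradiction separated separated⇒⊥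
      where
      step : ∀ {c d} → c ∉ S₂ → Adjacent (G [ B ]) c d → d ≢ v* → d ∉ S₂
      step {c} {d} c∉₂ adj d≢ d∈₂ with []-μ≢0 G B adj
      ... | c∈B , d∈B , adjG with to union (B⊆S c∈B) | d ∈? S₁
      ...   | inj₂ c∈₂ | _        = c∉₂ c∈₂
      ...   | inj₁ _   | yes d∈₁  = d≢ (common d∈₁ d∈₂)
      ...   | inj₁ c∈₁ | no d∉₁   = adjG (across c∈₁ c∉₂ d∈₂ d∉₁)
      b∈₂ : b ∈ S₂
      b∈₂ = [ (λ b∈₁ → contradiction b∈₁ b∉₁) , id ]′ (to union (B⊆S b∈B))
      in-B : ∀ {v} → v ∈ B → v ∈ V (G [ B ])
      in-B v∈ = x∈p∩q⁺ (B⊆G v∈ , v∈)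
      separated : ¬ Joined ((G [ B ]) ⊖ v*) a b
      separated j = star-invariant (_∉ S₂) (λ {c} {d} c∉₂ adj →
          let _ , _ , adjB = []-μ≢0 (G [ B ]) (∁ ⁅ v* ⁆) adj in
          step c∉₂ adjB (proj₂ (∈-⊖⁻ (G [ B ]) (adjacent-∈ʳ ((G [ B ]) ⊖ v*) {c} {d} adj)))) j a∉₂ b∈₂
      separated⇒⊥ : ¬ ¬ Joined ((G [ B ]) ⊖ v*) a b
      separated⇒⊥ ¬j with v* ∈? B
      ... | yes v*∈B = nonsep (v* , in-B v*∈B , a , b ,
              ∈-⊖ (G [ B ]) (in-B a∈B) (λ { refl → a∉₂ v*∈₂ }) ,
              ∈-⊖ (G [ B ]) (in-B b∈B) (λ { refl → b∉₁ v*∈₁ }) , ¬j)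
      ... | no v*∉B  = star-invariant (_∉ S₂) (λ {c} {d} c∉₂ adj →
              step c∉₂ adj λ { refl → v*∉B (proj₁ (proj₂ ([]-μ≢0 G B adj))) })
              (conn a b (in-B a∈B) (in-B b∈B)) a∉₂ b∈₂

  MaximalIn : Subset n → Subset n → Set
  MaximalIn S B = B ⊆ S × ConnectedNonseparable (G [ B ]) ×
    (∀ C → C ⊆ S → ConnectedNonseparable (G [ C ]) → B ⊆ C → C ⊆ B)

  leaf-maximal : ∀ {S f} (T : BlockTree S f) {B} → B ∈ˡ leaves T → MaximalIn S B
  leaf-maximal (leaf _ conf)  (here refl) = id , block-connectedNonseparable conf , λ _ C⊆ _ _ → C⊆
  leaf-maximal (node g T₁ T₂) {B} B∈ with ∈-++⁻ (leaves T₁) B∈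
  ... | inj₁ B∈₁ = Glued.⊆₁ g ∘ B⊆ , cn , max′
    where
    maximal = leaf-maximal T₁ B∈₁
    B⊆ = proj₁ maximal
    cn = proj₁ (proj₂ maximal)
    max′ : ∀ C → C ⊆ _ → ConnectedNonseparable (G [ C ]) → B ⊆ C → C ⊆ B
    max′ C C⊆ cnC B⊆C with one-sided g (tree-⊆ (node g T₁ T₂) ∘ C⊆) C⊆ cnC
    ... | inj₁ C⊆₁ = proj₂ (proj₂ maximal) C C⊆₁ cnC B⊆C
    ... | inj₂ C⊆₂ = contradiction (λ {v} v∈ → C⊆₂ (B⊆C v∈))
                       (not-in-both g (leaf-large T₁ (Glued.large₁ g) B∈₁) B⊆)
  ... | inj₂ B∈₂ = Glued.⊆₂ g ∘ B⊆ , cn , max′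
    where
    maximal = leaf-maximal T₂ B∈₂
    B⊆ = proj₁ maximal
    cn = proj₁ (proj₂ maximal)
    max′ : ∀ C → C ⊆ _ → ConnectedNonseparable (G [ C ]) → B ⊆ C → C ⊆ B
    max′ C C⊆ cnC B⊆C with one-sided g (tree-⊆ (node g T₁ T₂) ∘ C⊆) C⊆ cnC
    ... | inj₂ C⊆₂ = proj₂ (proj₂ maximal) C C⊆₂ cnC B⊆C
    ... | inj₁ C⊆₁ = contradiction (λ {v} → B⊆ {v})
                       (not-in-both g (leaf-large T₂ (Glued.large₂ g) B∈₂) (C⊆₁ ∘ B⊆C))

  maximal-leaf : ∀ {S f} (T : BlockTree S f) {B} → MaximalIn S B → B ∈ˡ leaves T
  maximal-leaf (leaf _ conf) (B⊆ , _ , max) =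
    here (⊆-antisym B⊆ (max _ id (block-connectedNonseparable conf) B⊆))
  maximal-leaf (node g T₁ T₂) (B⊆ , cn , max) with one-sided g (tree-⊆ (node g T₁ T₂) ∘ B⊆) B⊆ cn
  ... | inj₁ B⊆₁ = ∈-++⁺ˡ (maximal-leaf T₁ (B⊆₁ , cn , λ C C⊆ → max C (Glued.⊆₁ g ∘ C⊆)))
  ... | inj₂ B⊆₂ = ∈-++⁺ʳ (leaves T₁) (maximal-leaf T₂ (B⊆₂ , cn , λ C C⊆ → max C (Glued.⊆₂ g ∘ C⊆)))

  leaves-unique : ∀ {S f} (T : BlockTree S f) → Unique (leaves T)
  leaves-unique (leaf _ _)     = All.[] AllPairs.∷ AllPairs.[]
  leaves-unique (node g T₁ T₂) = Unique.++⁺ (leaves-unique T₁) (leaves-unique T₂)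
    λ (B∈₁ , B∈₂) → not-in-both g (leaf-large T₁ (Glued.large₁ g) B∈₁) (leaf-⊆ T₁ B∈₁) (leaf-⊆ T₂ B∈₂)

  Family : Set
  Family = Subset n → Fin m → ℕ

  total : Family → Fin n → Fin m → List (Subset n) → ℕ
  total F v x L = sumᴸ (List.map (λ B → F B x when v ∈? V (G [ B ])) L)

  total-++ : ∀ F v x L M → total F v x (L ++ M) ≡ total F v x L + total F v x M
  total-++ F v x L M = trans (cong sumᴸ (map-++ _ L M)) (sum-++ (List.map _ L) (List.map _ M))

  total-cong : ∀ F F′ {v x} L → (∀ {B} → B ∈ˡ L → v ∈ B → F B x ≡ F′ B x) → total F v x L ≡ total F′ v x L
  total-cong F F′ []      eq = refl
  total-cong F F′ {v} (B ∷ L) eq = cong₂ _+_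
    (when-cong (v ∈? V (G [ B ])) (v ∈? V (G [ B ])) id id (eq (here refl) ∘ p∩q⊆q (V G) B))
    (total-cong F F′ L (eq ∘ there))

  total-zero : ∀ F {v x} L → (∀ {B} → B ∈ˡ L → v ∉ B) → total F v x L ≡ 0
  total-zero F []      v∉ = refl
  total-zero F {v} (B ∷ L) v∉ = cong₂ _+_
    (when-no (v ∈? V (G [ B ])) (v∉ (here refl) ∘ p∩q⊆q (V G) B)) (total-zero F L (v∉ ∘ there))

  module _ {S₁ S₂ S f₁ f₂ f} (g : Glued S₁ S₂ S f₁ f₂ f) (T₁ : BlockTree S₁ f₁) (T₂ : BlockTree S₂ f₂)
           (F : Family) (v : Fin n) (x : Fin m) where
    open Glued g

    total-left : v ∈ S₁ → v ≢ v* → total F v x (leaves T₁ ++ leaves T₂) ≡ total F v x (leaves T₁)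
    total-left v∈ v≢ = trans (total-++ F v x (leaves T₁) (leaves T₂)) (trans
      (cong (total F v x (leaves T₁) +_)
        (total-zero F {v} (leaves T₂) λ B∈ v∈B → v≢ (common v∈ (leaf-⊆ T₂ B∈ v∈B))))
      (+-identityʳ _))

    total-right : v ∈ S₂ → v ≢ v* → total F v x (leaves T₁ ++ leaves T₂) ≡ total F v x (leaves T₂)
    total-right v∈ v≢ = trans (total-++ F v x (leaves T₁) (leaves T₂))
      (cong (_+ total F v x (leaves T₂))
        (total-zero F {v} (leaves T₁) λ B∈ v∈B → v≢ (common (leaf-⊆ T₁ B∈ v∈B) v∈)))

  tree-exists : ∀ {S f} (T : BlockTree S f) → Σ[ F ∈ Family ]
    (∀ {B} → B ∈ˡ leaves T → BlockConfiguration (G [ B ]) X (B ᴴ) (F B)) ×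
    (∀ {v x} → v ∈ S → x ∈ X v → f x ≡ total F v x (leaves T))
  tree-exists (leaf {S} {f} S⊆ conf) = (λ _ → f) , (λ { (here refl) → conf }) ,
    λ {v} {x} v∈ x∈ → sym (trans (+-identityʳ _) (when-yes (v ∈? V (G [ S ])) (x∈p∩q⁺ (S⊆ v∈ , v∈))))
  tree-exists (node {S₁} {S₂} {S} {f₁} {f₂} {f} g T₁ T₂) with tree-exists T₁ | tree-exists T₂
  ... | F₁ , confs₁ , sums₁ | F₂ , confs₂ , sums₂ = F , confs , sums
    where
    open Glued g
    F : Family
    F B = if does (B ⊆? S₁) then F₁ B else F₂ B
    F-left : ∀ {B} → B ∈ˡ leaves T₁ → F B ≡ F₁ B
    F-left {B} B∈ = cong (if_then F₁ B else F₂ B) (dec-true (B ⊆? S₁) (leaf-⊆ T₁ B∈))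
    F-right : ∀ {B} → B ∈ˡ leaves T₂ → F B ≡ F₂ B
    F-right {B} B∈ = cong (if_then F₁ B else F₂ B) (dec-false (B ⊆? S₁)
      λ B⊆₁ → not-in-both g (leaf-large T₂ large₂ B∈) B⊆₁ (leaf-⊆ T₂ B∈))
    confs : ∀ {B} → B ∈ˡ leaves T₁ ++ leaves T₂ → BlockConfiguration (G [ B ]) X (B ᴴ) (F B)
    confs {B} B∈ with ∈-++⁻ (leaves T₁) B∈
    ... | inj₁ B∈₁ = subst (BlockConfiguration (G [ B ]) X (B ᴴ)) (sym (F-left B∈₁)) (confs₁ B∈₁)
    ... | inj₂ B∈₂ = subst (BlockConfiguration (G [ B ]) X (B ᴴ)) (sym (F-right B∈₂)) (confs₂ B∈₂)
    total₁ : ∀ {v x} → total F v x (leaves T₁) ≡ total F₁ v x (leaves T₁)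
    total₁ {v} {x} = total-cong F F₁ {v} (leaves T₁) λ B∈ _ → cong (λ h → h x) (F-left B∈)
    total₂ : ∀ {v x} → total F v x (leaves T₂) ≡ total F₂ v x (leaves T₂)
    total₂ {v} {x} = total-cong F F₂ {v} (leaves T₂) λ B∈ _ → cong (λ h → h x) (F-right B∈)
    sums : ∀ {v x} → v ∈ S → x ∈ X v → f x ≡ total F v x (leaves T₁ ++ leaves T₂)
    sums {v} {x} v∈ x∈ with v ≟ v* | to union v∈
    ... | yes refl | _        = trans (f-both x∈) (sym (trans (total-++ F v x (leaves T₁) (leaves T₂))
            (cong₂ _+_ (trans (total₁ {v} {x}) (sym (sums₁ v*∈₁ x∈)))
              (trans (total₂ {v} {x}) (sym (sums₂ v*∈₂ x∈))))))
    ... | no v≢    | inj₁ v∈₁ = trans (f-left v∈₁ v≢ x∈) (trans (sums₁ v∈₁ x∈)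
            (sym (trans (total-left g T₁ T₂ F v x v∈₁ v≢) (total₁ {v} {x}))))
    ... | no v≢    | inj₂ v∈₂ = trans (f-right v∈₂ v≢ x∈) (trans (sums₂ v∈₂ x∈)
            (sym (trans (total-right g T₁ T₂ F v x v∈₂ v≢) (total₂ {v} {x}))))

  module _ (F F′ : Family) where

    Agree : List (Subset n) → Set
    Agree L = ∀ {B} → B ∈ˡ L → ∀ {v x} → v ∈ B → x ∈ X v → F B x ≡ F′ B x

    HarmonicOn : List (Subset n) → Set
    HarmonicOn L = ∀ {B} → B ∈ˡ L → Harmonic (G [ B ]) X (B ᴴ) (F B) × Harmonic (G [ B ]) X (B ᴴ) (F′ B)

    -- The induction needs totals that agree only off one fibre: at a node,
    -- the side not containing w is determined first, off the fibre of v*.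
    tree-unique : ∀ {S f} (T : BlockTree S f) → HarmonicOn (leaves T) → ∀ w →
      (∀ {v x} → v ∈ S → v ≢ w → x ∈ X v → total F v x (leaves T) ≡ total F′ v x (leaves T)) →
      Agree (leaves T)
    tree-unique (leaf {S} S⊆ _) harmonic w same (here refl) v∈ x∈ =
      harmonic-unique (proj₁ (harmonic (here refl))) (proj₂ (harmonic (here refl))) w
        (λ {v} {x} v∈ v≢ x∈ → let v∈S = p∩q⊆q (V G) S v∈ in trans (sym (single F v∈ x))
          (trans (same v∈S v≢ x∈) (single F′ v∈ x)))
        (x∈p∩q⁺ (S⊆ v∈ , v∈)) x∈
      where
      single : ∀ F {v} → v ∈ V (G [ S ]) → ∀ x → total F v x (S ∷ []) ≡ F S x
      single F {v} v∈ x = trans (+-identityʳ _) (when-yes (v ∈? V (G [ S ])) v∈)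
    tree-unique (node {S₁} {S₂} g T₁ T₂) harmonic w same {B} B∈ with w ∈? S₁ | ∈-++⁻ (leaves T₁) B∈
    ... | yes w∈₁ | B∈⊎ = [ agree₁ , agree₂ ]′ B∈⊎
      where
      open Glued g
      agree₂ : Agree (leaves T₂)
      agree₂ = tree-unique T₂ (harmonic ∘ ∈-++⁺ʳ (leaves T₁)) v* λ {v} {x} v∈ v≢ x∈ →
        trans (sym (total-right g T₁ T₂ F v x v∈ v≢))
          (trans (same (⊆₂ v∈) (λ { refl → v≢ (common w∈₁ v∈) }) x∈) (total-right g T₁ T₂ F′ v x v∈ v≢))
      agree₁ : Agree (leaves T₁)
      agree₁ = tree-unique T₁ (harmonic ∘ ∈-++⁺ˡ) w λ {v} {x} v∈ v≢ x∈ →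
        +-cancelʳ-≡ (total F v x (leaves T₂)) _ _
          (trans (sym (total-++ F v x (leaves T₁) (leaves T₂))) (trans (same (⊆₁ v∈) v≢ x∈)
            (trans (total-++ F′ v x (leaves T₁) (leaves T₂)) (cong (total F′ v x (leaves T₁) +_)
              (sym (total-cong F F′ {v} (leaves T₂) λ B∈ v∈B → agree₂ B∈ v∈B x∈))))))
    ... | no w∉₁ | B∈⊎ = [ agree₁ , agree₂ ]′ B∈⊎
      where
      open Glued g
      agree₁ : Agree (leaves T₁)
      agree₁ = tree-unique T₁ (harmonic ∘ ∈-++⁺ˡ) v* λ {v} {x} v∈ v≢ x∈ →
        trans (sym (total-left g T₁ T₂ F v x v∈ v≢))
          (trans (same (⊆₁ v∈) (λ { refl → w∉₁ v∈ }) x∈) (total-left g T₁ T₂ F′ v x v∈ v≢))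
      agree₂ : Agree (leaves T₂)
      agree₂ = tree-unique T₂ (harmonic ∘ ∈-++⁺ʳ (leaves T₁)) w λ {v} {x} v∈ v≢ x∈ →
        +-cancelˡ-≡ (total F v x (leaves T₁)) _ _
          (trans (sym (total-++ F v x (leaves T₁) (leaves T₂))) (trans (same (⊆₂ v∈) v≢ x∈)
            (trans (total-++ F′ v x (leaves T₁) (leaves T₂)) (cong (_+ total F′ v x (leaves T₂))
              (sym (total-cong F F′ {v} (leaves T₁) λ B∈ v∈B → agree₁ B∈ v∈B x∈))))))

  tree-trivial : ∀ {S f} → BlockTree S f → ∀ {v} → (∀ {a} → a ∈ S → a ≡ v) →
                 v ∈ S → ∀ {x} → x ∈ X v → f x ≡ 0
  tree-trivial (leaf {S} {f} S⊆ conf) {v} trivial v∈ {x} x∈ = decidable-stable (f x ≟ℕ 0) λ fx≢0 →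
    let u , adj , _ = Harmonic.spread (block⇒harmonic conf) (x∈p∩q⁺ (S⊆ v∈ , v∈)) x∈ fx≢0 in
    adjacent⇒≢ (G [ S ]) adj (sym (trivial (proj₁ (proj₂ ([]-μ≢0 G S adj)))))
  tree-trivial (node g _ _) trivial v∈ x∈ with Glued.other₁ g
  ... | a , a∈ , a≢ = contradiction
    (trans (trivial (Glued.⊆₁ g a∈)) (sym (trivial (Glued.⊆₁ g (Glued.v*∈₁ g))))) a≢

-- From constructible configurations to trees of blocks

constructible⇒uniform : {G : Graph n} {X : Assignment n m} {H : Graph m} {f : Fin m → ℕ} →
                        Constructible G X H f → Uniform G X H
constructible⇒uniform (mConf mc)           = MConfiguration.uniform mc
constructible⇒uniform (kConf kc)           = KConfiguration.uniform kc
constructible⇒uniform (cConf (inj₁ cc))    = OddCConfiguration.uniform cc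
constructible⇒uniform (cConf (inj₂ cc))    = EvenCConfiguration.uniform cc
constructible⇒uniform (merge uniform _ _ _) = uniform

uniform-restrict : {G : Graph n} {X : Assignment n m} {H : Graph m} → Uniform G X H →
                   ∀ S → Uniform (G [ S ]) X (coverOver (G [ S ]) X H)
uniform-restrict {G = G} {X} {H} (cov , r , r≥1 , size) S = restricted , r , r≥1 , λ v∈ → size (⊆G v∈)
  where
  module C₀ = IsCover cov
  W = fibres (G [ S ]) X
  ⊆G : V (G [ S ]) ⊆ V G
  ⊆G = p∩q⊆p (V G) S
  ⊆S : V (G [ S ]) ⊆ S
  ⊆S = p∩q⊆q (V G) S
  restricted : IsCover (G [ S ]) X (coverOver (G [ S ]) X H)
  restricted = record
    { disjoint    = λ u∈ v∈ → C₀.disjoint (⊆G u∈) (⊆G v∈)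
    ; union       = mk⇔ (to (∈-fibres (G [ S ]) X) ∘ p∩q⊆q (V H) W)
        λ (v , v∈ , x∈) → x∈p∩q⁺
          (from C₀.union (v , ⊆G v∈ , x∈) , from (∈-fibres (G [ S ]) X) (v , v∈ , x∈))
    ; independent = λ {v} v∈ x∈ y∈ → trans
        ([]-μ H W (from (∈-fibres (G [ S ]) X) (v , v∈ , x∈)) (from (∈-fibres (G [ S ]) X) (v , v∈ , y∈)))
        (C₀.independent (⊆G v∈) x∈ y∈)
    ; matchings   = λ {u} {v} u∈ v∈ u≢v →
        subst (UnionOfMatchings (H [ W ]) (X u) (X v)) (sym ([]-μ G S (⊆S u∈) (⊆S v∈)))
          (unionOfMatchings-[] W (C₀.matchings (⊆G u∈) (⊆G v∈) u≢v))
    }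

record Embedding (A : Graph n₁) (B : Graph n₂) : Set where
  field
    ι           : Fin n₁ → Fin n₂
    ι-∈         : ∀ {i} → i ∈ V A → ι i ∈ V B
    ι-injective : ∀ {i j} → i ∈ V A → j ∈ V A → ι i ≡ ι j → i ≡ j
    ι-μ         : ∀ {i j} → i ∈ V A → j ∈ V A → μ B (ι i) (ι j) ≡ μ A i j

open Embedding

embedding-id : {A : Graph n₁} → Embedding A A
embedding-id = record { ι = id ; ι-∈ = id ; ι-injective = λ _ _ → id ; ι-μ = λ _ _ → refl }

embedding-∘ : {A : Graph n₁} {B : Graph n₂} {D : Graph n₃} →
              Embedding B D → Embedding A B → Embedding A D
embedding-∘ d c = record
  { ι           = ι d ∘ ι c
  ; ι-∈         = ι-∈ d ∘ ι-∈ c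
  ; ι-injective = λ i∈ j∈ → ι-injective c i∈ j∈ ∘ ι-injective d (ι-∈ c i∈) (ι-∈ c j∈)
  ; ι-μ         = λ i∈ j∈ → trans (ι-μ d (ι-∈ c i∈) (ι-∈ c j∈)) (ι-μ c i∈ j∈)
  }

record CoverEmbedding (G₁ : Graph n₁) (X₁ : Assignment n₁ m₁) (H₁ : Graph m₁)
                      (G : Graph n) (X : Assignment n m) (H : Graph m) : Set where
  field
    graph : Embedding G₁ G
    cover : Embedding H₁ H
    X-ι   : ∀ {a} → a ∈ V G₁ → ∀ {z} → z ∈ X (ι graph a) ⇔ (∃[ x ] x ∈ X₁ a × ι cover x ≡ z)

coverEmbedding-∘ :
  {G₁ : Graph n₁} {X₁ : Assignment n₁ m₁} {H₁ : Graph m₁}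
  {G₂ : Graph n₂} {X₂ : Assignment n₂ m₂} {H₂ : Graph m₂}
  {G : Graph n} {X : Assignment n m} {H : Graph m} →
  CoverEmbedding G₂ X₂ H₂ G X H → CoverEmbedding G₁ X₁ H₁ G₂ X₂ H₂ → CoverEmbedding G₁ X₁ H₁ G X H
coverEmbedding-∘ d c = record
  { graph = embedding-∘ D₀.graph C₀.graph
  ; cover = embedding-∘ D₀.cover C₀.cover
  ; X-ι   = λ a∈ → mk⇔
      (λ z∈ → let y , y∈ , eq = to (D₀.X-ι (ι-∈ C₀.graph a∈)) z∈ ; x , x∈ , eq′ = to (C₀.X-ι a∈) y∈ in
        x , x∈ , trans (cong (ι D₀.cover) eq′) eq)
      (λ (x , x∈ , eq) → from (D₀.X-ι (ι-∈ C₀.graph a∈))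
        (ι C₀.cover x , from (C₀.X-ι a∈) (x , x∈ , refl) , eq))
  }
  where
  module C₀ = CoverEmbedding c
  module D₀ = CoverEmbedding d

module _ {A : Graph n₁} {B : Graph n₂} {_~_ : Fin n₁ → Fin n₂ → Set} {D : Graph n}
         (identification : Identification A B _~_ D) where
  open Identification identification renaming (ι₁ to i₁; ι₂ to i₂)

  embedding₁ : Embedding A D
  embedding₁ = record { ι = i₁ ; ι-∈ = ι₁-∈ ; ι-injective = ι₁-inj ; ι-μ = μ₁ }

  embedding₂ : Embedding B D
  embedding₂ = record { ι = i₂ ; ι-∈ = ι₂-∈ ; ι-injective = ι₂-inj ; ι-μ = μ₂ }

push : Graph m₁ → (Fin m₁ → Fin m) → (Fin m₁ → ℕ) → Fin m → ℕ
push H₁ κ f z with any? (λ x → x ∈? V H₁ ×-dec κ x ≟ z)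
... | yes (x , _) = f x
... | no _        = 0

push-ι : {H₁ : Graph m₁} {H : Graph m} (e : Embedding H₁ H) (f : Fin m₁ → ℕ) →
         ∀ {x} → x ∈ V H₁ → push H₁ (ι e) f (ι e x) ≡ f x
push-ι {H₁ = H₁} e f {x} x∈ with any? (λ y → y ∈? V H₁ ×-dec ι e y ≟ ι e x)
... | yes (y , y∈ , eq) = cong f (ι-injective e y∈ x∈ eq)
... | no ¬y             = contradiction (x , x∈ , refl) ¬y

module Build {G : Graph n} {X : Assignment n m} {H : Graph m} (uniform : Uniform G X H) where
  open Decomposition G X H

  Spans : {G₁ : Graph n₁} → Embedding G₁ G → Subset n → Set
  Spans {G₁ = G₁} e S = ∀ {v} → v ∈ S ⇔ (∃[ a ] a ∈ V G₁ × ι e a ≡ v)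

  module _ {G₁ : Graph n₁} {X₁ : Assignment n₁ m₁} {H₁ : Graph m₁} {f₁ : Fin m₁ → ℕ}
           {S : Subset n} {f : Fin m → ℕ}
           (uniform₁ : Uniform G₁ X₁ H₁)
           (e : CoverEmbedding G₁ X₁ H₁ G X H)
           (spans : Spans (CoverEmbedding.graph e) S)
           (f-κ : ∀ {a x} → a ∈ V G₁ → x ∈ X₁ a → f (ι (CoverEmbedding.cover e) x) ≡ f₁ x) where
    open CoverEmbedding e
    private
      S⊆G : S ⊆ V G
      S⊆G v∈ with to spans v∈
      ... | a , a∈ , refl = ι-∈ graph a∈
      in-S : ∀ {a} → a ∈ V G₁ → ι graph a ∈ S
      in-S a∈ = from spans (_ , a∈ , refl)
      W = fibres (G [ S ]) X
      κ-∈W : ∀ {x} → x ∈ V H₁ → ι cover x ∈ W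
      κ-∈W {x} x∈ = let a , a∈ , x∈X = to (IsCover.union (proj₁ uniform₁)) x∈ in
        from (∈-fibres (G [ S ]) X)
          (ι graph a , x∈p∩q⁺ (ι-∈ graph a∈ , in-S a∈) , from (X-ι a∈) (x , x∈X , refl))

      iso : CoverIso G₁ X₁ H₁ (G [ S ]) X (S ᴴ)
      iso = record
        { graph = record
          { to         = ι graph
          ; to-∈       = λ a∈ → x∈p∩q⁺ (ι-∈ graph a∈ , in-S a∈)
          ; injective  = ι-injective graph
          ; surjective = λ v∈ → to spans (p∩q⊆q (V G) S v∈)
          ; to-μ       = λ a∈ b∈ → trans ([]-μ G S (in-S a∈) (in-S b∈)) (ι-μ graph a∈ b∈)
          }
        ; cover = record
          { to         = ι cover
          ; to-∈       = λ x∈ → x∈p∩q⁺ (ι-∈ cover x∈ , κ-∈W x∈)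
          ; injective  = ι-injective cover
          ; surjective = surjective
          ; to-μ       = λ x∈ y∈ → trans ([]-μ H W (κ-∈W x∈) (κ-∈W y∈)) (ι-μ cover x∈ y∈)
          }
        ; X₁-⊆  = cover-⊆ (proj₁ uniform₁)
        ; X-ι   = X-ι
        }
        where
        surjective : ∀ {z} → z ∈ V (S ᴴ) → ∃[ x ] x ∈ V H₁ × ι cover x ≡ z
        surjective z∈ with to (∈-fibres (G [ S ]) X) (p∩q⊆q (V H) W z∈)
        ... | v , v∈ , z∈X with to spans (p∩q⊆q (V G) S v∈)
        ...   | a , a∈ , refl with to (X-ι a∈) z∈X
        ...     | x , x∈ , eq = x , cover-⊆ (proj₁ uniform₁) a∈ x∈ , eq

    embedded-leaf : BlockConfiguration G₁ X₁ H₁ f₁ → BlockTree S f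
    embedded-leaf conf = leaf S⊆G
      (Transport.block⁺ iso (uniform-restrict uniform S) f-κ conf)

  module Merge
    {G₁ : Graph n₁} {X₁ : Assignment n₁ m₁} {H₁ : Graph m₁} {f₁ : Fin m₁ → ℕ}
    {G₂ : Graph n₂} {X₂ : Assignment n₂ m₂} {H₂ : Graph m₂} {f₂ : Fin m₂ → ℕ}
    {G₃ : Graph n₃} {X₃ : Assignment n₃ m₃} {H₃ : Graph m₃} {f₃ : Fin m₃ → ℕ}
    (uniform₁ : Uniform G₁ X₁ H₁) (uniform₂ : Uniform G₂ X₂ H₂)
    (isMerge : IsMerge G₁ X₁ H₁ f₁ G₂ X₂ H₂ f₂ G₃ X₃ H₃ f₃)
    (e : CoverEmbedding G₃ X₃ H₃ G X H) (S : Subset n) (f : Fin m → ℕ)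
    (spans : Spans (CoverEmbedding.graph e) S)
    (f-κ : ∀ {a x} → a ∈ V G₃ → x ∈ X₃ a → f (ι (CoverEmbedding.cover e) x) ≡ f₃ x) where
    open IsMerge isMerge
    private
      module I = Identification graph
      module J = Identification cover
      module E = CoverEmbedding e

    e₁ : CoverEmbedding G₁ X₁ H₁ G X H
    e₁ = coverEmbedding-∘ e (record { graph = embedding₁ graph ; cover = embedding₁ cover ; X-ι = X-left })
    e₂ : CoverEmbedding G₂ X₂ H₂ G X H
    e₂ = coverEmbedding-∘ e (record { graph = embedding₂ graph ; cover = embedding₂ cover ; X-ι = X-right })

    private
      module E₁ = CoverEmbedding e₁
      module E₂ = CoverEmbedding e₂

    S₁ S₂ : Subset n
    S₁ = image (ι E₁.graph) (V G₁)
    S₂ = image (ι E₂.graph) (V G₂)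

    spans₁ : Spans E₁.graph S₁
    spans₁ = ∈image (ι E₁.graph) (V G₁)
    spans₂ : Spans E₂.graph S₂
    spans₂ = ∈image (ι E₂.graph) (V G₂)

    f₁⁺ f₂⁺ : Fin m → ℕ
    f₁⁺ = push H₁ (ι E₁.cover) f₁
    f₂⁺ = push H₂ (ι E₂.cover) f₂

    f₁⁺-κ : ∀ {a x} → a ∈ V G₁ → x ∈ X₁ a → f₁⁺ (ι E₁.cover x) ≡ f₁ x
    f₁⁺-κ a∈ x∈ = push-ι E₁.cover f₁ (cover-⊆ (proj₁ uniform₁) a∈ x∈)
    f₂⁺-κ : ∀ {b y} → b ∈ V G₂ → y ∈ X₂ b → f₂⁺ (ι E₂.cover y) ≡ f₂ y
    f₂⁺-κ b∈ y∈ = push-ι E₂.cover f₂ (cover-⊆ (proj₁ uniform₂) b∈ y∈)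

    v* : Fin n
    v* = ι E₁.graph v₁

    v*≡ : v* ≡ ι E₂.graph v₂
    v*≡ = cong (ι E.graph) (from (I.identified v₁∈ v₂∈) (refl , refl))

    v*∈₁ : v* ∈ S₁
    v*∈₁ = from spans₁ (v₁ , v₁∈ , refl)
    v*∈₂ : v* ∈ S₂
    v*∈₂ = from spans₂ (v₂ , v₂∈ , sym v*≡)

    union : ∀ {v} → v ∈ S ⇔ (v ∈ S₁ ⊎ v ∈ S₂)
    union = mk⇔ split join′
      where
      split : ∀ {v} → v ∈ S → v ∈ S₁ ⊎ v ∈ S₂
      split v∈ with to spans v∈
      ... | c , c∈ , refl with I.onto c∈
      ...   | inj₁ (a , a∈ , refl) = inj₁ (from spans₁ (a , a∈ , refl))
      ...   | inj₂ (b , b∈ , refl) = inj₂ (from spans₂ (b , b∈ , refl))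
      join′ : ∀ {v} → v ∈ S₁ ⊎ v ∈ S₂ → v ∈ S
      join′ (inj₁ v∈) = let a , a∈ , eq = to spans₁ v∈ in from spans (ι₁ a , I.ι₁-∈ a∈ , eq)
      join′ (inj₂ v∈) = let b , b∈ , eq = to spans₂ v∈ in from spans (ι₂ b , I.ι₂-∈ b∈ , eq)

    common : ∀ {v} → v ∈ S₁ → v ∈ S₂ → v ≡ v*
    common v∈₁ v∈₂ with to spans₁ v∈₁ | to spans₂ v∈₂
    ... | a , a∈ , refl | b , b∈ , eq =
      cong (ι E₁.graph) (proj₁ (to (I.identified a∈ b∈)
        (ι-injective E.graph (I.ι₁-∈ a∈) (I.ι₂-∈ b∈) (sym eq))))

    across : ∀ {a b} → a ∈ S₁ → a ∉ S₂ → b ∈ S₂ → b ∉ S₁ → μ G a b ≡ 0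
    across a∈₁ a∉₂ b∈₂ b∉₁ with to spans₁ a∈₁ | to spans₂ b∈₂
    ... | a , a∈ , refl | b , b∈ , refl = trans (ι-μ E.graph (I.ι₁-∈ a∈) (I.ι₂-∈ b∈))
      (I.μ-across a∈ b∈ (λ { _ (refl , _) → a∉₂ v*∈₂ })
        (λ { _ (_ , refl) → b∉₁ (subst (_∈ S₁) v*≡ v*∈₁) }))

    f-κ₁ : ∀ {a x} → a ∈ V G₁ → a ≢ v₁ → x ∈ X₁ a → f (ι E₁.cover x) ≡ f₁ x
    f-κ₁ a∈ a≢ x∈ = trans (f-κ (I.ι₁-∈ a∈) (from (X-left a∈) (_ , x∈ , refl)))
      (f-left (cover-⊆ (proj₁ uniform₁) a∈ x∈) λ x∈v₁ → a≢ (cover-fibre (proj₁ uniform₁) a∈ v₁∈ x∈ x∈v₁))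

    f-κ₂ : ∀ {b y} → b ∈ V G₂ → b ≢ v₂ → y ∈ X₂ b → f (ι E₂.cover y) ≡ f₂ y
    f-κ₂ b∈ b≢ y∈ = trans (f-κ (I.ι₂-∈ b∈) (from (X-right b∈) (_ , y∈ , refl)))
      (f-right (cover-⊆ (proj₁ uniform₂) b∈ y∈) λ y∈v₂ → b≢ (cover-fibre (proj₁ uniform₂) b∈ v₂∈ y∈ y∈v₂))

    κ-π : ∀ {x} → x ∈ X₁ v₁ → ι E₁.cover x ≡ ι E₂.cover (π x)
    κ-π x∈ = cong (ι E.cover) (from (J.identified (cover-⊆ (proj₁ uniform₁) v₁∈ x∈)
      (cover-⊆ (proj₁ uniform₂) v₂∈ (π-∈ x∈))) (x∈ , refl))

    f-κ* : ∀ {x} → x ∈ X₁ v₁ → f (ι E₁.cover x) ≡ f₁ x + f₂ (π x)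
    f-κ* x∈ = trans (f-κ (I.ι₁-∈ v₁∈) (from (X-left v₁∈) (_ , x∈ , refl))) (f-merged x∈)

    glued : (∃[ a ] a ∈ S₁ × a ≢ v*) → (∃[ b ] b ∈ S₂ × b ≢ v*) → Glued S₁ S₂ S f₁⁺ f₂⁺ f
    glued other₁ other₂ = record
      { v*      = v*
      ; v*∈₁    = v*∈₁
      ; v*∈₂    = v*∈₂
      ; other₁  = other₁
      ; other₂  = other₂
      ; common  = common
      ; across  = across
      ; union   = union
      ; f-left  = f-left⁺
      ; f-right = f-right⁺
      ; f-both  = f-both
      }
      where
      f-left⁺ : ∀ {v z} → v ∈ S₁ → v ≢ v* → z ∈ X v → f z ≡ f₁⁺ z
      f-left⁺ v∈ v≢ z∈ with to spans₁ v∈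
      ... | a , a∈ , refl with to (E₁.X-ι a∈) z∈
      ...   | x , x∈ , refl = trans (f-κ₁ a∈ (λ { refl → v≢ refl }) x∈) (sym (f₁⁺-κ a∈ x∈))
      f-right⁺ : ∀ {v z} → v ∈ S₂ → v ≢ v* → z ∈ X v → f z ≡ f₂⁺ z
      f-right⁺ v∈ v≢ z∈ with to spans₂ v∈
      ... | b , b∈ , refl with to (E₂.X-ι b∈) z∈
      ...   | y , y∈ , refl = trans (f-κ₂ b∈ (λ { refl → v≢ (sym v*≡) }) y∈) (sym (f₂⁺-κ b∈ y∈))
      f-both : ∀ {z} → z ∈ X v* → f z ≡ f₁⁺ z + f₂⁺ z
      f-both z∈ with to (E₁.X-ι v₁∈) z∈
      ... | x , x∈ , refl = trans (f-κ* x∈) (sym (cong₂ _+_ (f₁⁺-κ v₁∈ x∈)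
              (trans (cong f₂⁺ (κ-π x∈)) (f₂⁺-κ v₂∈ (π-∈ x∈)))))

    f-drop₁ : BlockTree S₁ f₁⁺ → ¬ (∃[ a ] a ∈ S₁ × a ≢ v*) →
              ∀ {b y} → b ∈ V G₂ → y ∈ X₂ b → f (ι E₂.cover y) ≡ f₂ y
    f-drop₁ T₁ trivial {b} b∈ y∈ with b ≟ v₂
    ... | no b≢    = f-κ₂ b∈ b≢ y∈
    ... | yes refl with π-sur y∈
    ...   | x , x∈ , refl = trans (cong f (sym (κ-π x∈))) (trans (f-κ* x∈) (cong (_+ f₂ (π x)) (trans
            (sym (f₁⁺-κ v₁∈ x∈))
            (tree-trivial T₁ (λ {a} a∈ → decidable-stable (a ≟ v*) λ a≢ → trivial (a , a∈ , a≢)) v*∈₁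
              (from (E₁.X-ι v₁∈) (x , x∈ , refl))))))

    f-drop₂ : BlockTree S₂ f₂⁺ → ¬ (∃[ b ] b ∈ S₂ × b ≢ v*) →
              ∀ {a x} → a ∈ V G₁ → x ∈ X₁ a → f (ι E₁.cover x) ≡ f₁ x
    f-drop₂ T₂ trivial {a} {x} a∈ x∈ with a ≟ v₁
    ... | no a≢    = f-κ₁ a∈ a≢ x∈
    ... | yes refl = trans (f-κ* x∈) (trans (cong (f₁ _ +_) (trans
            (sym (f₂⁺-κ v₂∈ (π-∈ x∈)))
            (tree-trivial T₂ (λ {b} b∈ → decidable-stable (b ≟ v*) λ b≢ → trivial (b , b∈ , b≢)) v*∈₂
              (subst (_∈ X v*) (κ-π x∈) (from (E₁.X-ι v₁∈) (_ , x∈ , refl)))))) (+-identityʳ _))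

    spans-drop₁ : ¬ (∃[ a ] a ∈ S₁ × a ≢ v*) → Spans E₂.graph S
    spans-drop₁ trivial = mk⇔ (to spans₂ ∘ [ in-S₂ , id ]′ ∘ to union) (from union ∘ inj₂ ∘ from spans₂)
      where
      in-S₂ : ∀ {v} → v ∈ S₁ → v ∈ S₂
      in-S₂ {v} v∈ = subst (_∈ S₂) (sym (decidable-stable (v ≟ v*) λ v≢ → trivial (v , v∈ , v≢))) v*∈₂

    spans-drop₂ : ¬ (∃[ b ] b ∈ S₂ × b ≢ v*) → Spans E₁.graph S
    spans-drop₂ trivial = mk⇔ (to spans₁ ∘ [ id , in-S₁ ]′ ∘ to union) (from union ∘ inj₁ ∘ from spans₁)
      where
      in-S₁ : ∀ {v} → v ∈ S₂ → v ∈ S₁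
      in-S₁ {v} v∈ = subst (_∈ S₁) (sym (decidable-stable (v ≟ v*) λ v≢ → trivial (v , v∈ , v≢))) v*∈₁

  -- A piece consisting of v* alone is no block of a larger graph; it is
  -- dropped, which is harmless as its function vanishes.
  build : {G₁ : Graph n₁} {X₁ : Assignment n₁ m₁} {H₁ : Graph m₁} {f₁ : Fin m₁ → ℕ} →
          Constructible G₁ X₁ H₁ f₁ → (e : CoverEmbedding G₁ X₁ H₁ G X H) →
          ∀ {S f} → Spans (CoverEmbedding.graph e) S →
          (∀ {a x} → a ∈ V G₁ → x ∈ X₁ a → f (ι (CoverEmbedding.cover e) x) ≡ f₁ x) → BlockTree S f
  build (mConf mc) e spans f-κ = embedded-leaf (MConfiguration.uniform mc) e spans f-κ (inj₁ mc)
  build (kConf kc) e spans f-κ = embedded-leaf (KConfiguration.uniform kc) e spans f-κ (inj₂ (inj₁ kc))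
  build c@(cConf cc) e spans f-κ =
    embedded-leaf (constructible⇒uniform c) e spans f-κ (inj₂ (inj₂ cc))
  build (merge _ c₁ c₂ isMerge) e {S} {f} spans f-κ =
    choose (any? λ a → a ∈? S₁ ×-dec ¬? (a ≟ v*)) (any? λ b → b ∈? S₂ ×-dec ¬? (b ≟ v*))
    where
    open Merge (constructible⇒uniform c₁) (constructible⇒uniform c₂) isMerge e S f spans f-κ
    T₁ : BlockTree S₁ f₁⁺
    T₁ = build c₁ e₁ spans₁ f₁⁺-κ
    T₂ : BlockTree S₂ f₂⁺
    T₂ = build c₂ e₂ spans₂ f₂⁺-κ
    choose : Dec (∃[ a ] a ∈ S₁ × a ≢ v*) → Dec (∃[ b ] b ∈ S₂ × b ≢ v*) → BlockTree S f
    choose (no trivial) _            = build c₂ e₂ (spans-drop₁ trivial) (f-drop₁ T₁ trivial)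
    choose (yes _)      (no trivial) = build c₁ e₁ (spans-drop₂ trivial) (f-drop₂ T₂ trivial)
    choose (yes other₁) (yes other₂) = node (glued other₁ other₂) T₁ T₂

module _ {A B : Set} (g : A → B) where

  preimageAt : (L : List A) → Fin (length (List.map g L)) → A
  preimageAt (a ∷ L) zero    = a
  preimageAt (a ∷ L) (suc i) = preimageAt L i

  lookup-map : ∀ L i → List.lookup (List.map g L) i ≡ g (preimageAt L i)
  lookup-map (a ∷ L) zero    = refl
  lookup-map (a ∷ L) (suc i) = lookup-map L i

  preimageAt-∈ : ∀ L i → preimageAt L i ∈ˡ L
  preimageAt-∈ (a ∷ L) zero    = here refl
  preimageAt-∈ (a ∷ L) (suc i) = there (preimageAt-∈ L i)

  preimageAt-surjective : ∀ {L a} → a ∈ˡ L → ∃[ i ] preimageAt L i ≡ a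
  preimageAt-surjective (here refl) = zero , refl
  preimageAt-surjective (there a∈)  = let i , eq = preimageAt-surjective a∈ in suc i , eq

  preimageAt-injective : ∀ {L} → Unique L → ∀ {i j} → preimageAt L i ≡ preimageAt L j → i ≡ j
  preimageAt-injective {_ ∷ _} _ {zero} {zero} _ = refl
  preimageAt-injective {_ ∷ L} (a∉ AllPairs.∷ _) {zero} {suc j} eq =
    contradiction eq (All.lookup a∉ (preimageAt-∈ L j))
  preimageAt-injective {_ ∷ L} (a∉ AllPairs.∷ _) {suc i} {zero} eq =
    contradiction (sym eq) (All.lookup a∉ (preimageAt-∈ L i))
  preimageAt-injective {_ ∷ _} (_ AllPairs.∷ unique) {suc i} {suc j} eq =
    cong suc (preimageAt-injective unique eq)

  sum-preimageAt : (ψ : A → ℕ) → ∀ L → sum (ψ ∘ preimageAt L) ≡ sumᴸ (List.map ψ L)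
  sum-preimageAt ψ []      = refl
  sum-preimageAt ψ (a ∷ L) = cong (ψ a +_) (sum-preimageAt ψ L)

module OverTree (G : Graph n) (X : Assignment n m) (H : Graph m) (f : Fin m → ℕ)
                (tree : Decomposition.BlockTree G X H (V G) f) where
  open Decomposition G X H

  maximal⇒inducedBlock : ∀ {B} → MaximalIn (V G) B → InducedBlock G B
  maximal⇒inducedBlock {B} (B⊆ , cn , max) = B⊆ , []-⊑ G B , cn , max′
    where
    max′ : ∀ B′ → B′ ⊑ G → ConnectedNonseparable B′ → G [ B ] ⊑ B′ → B′ ⊑ G [ B ]
    max′ B′ B′⊑G cn′ B⊑B′ = ⊑-trans (⊑-induced B′⊑G) ([]-mono ⊑-refl
      (max (V B′) (V-⊆ B′⊑G) (connectedNonseparable-mono (⊑-induced B′⊑G) (p∩q⊆q (V G) (V B′)) cn′)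
        (λ v∈ → V-⊆ B⊑B′ (x∈p∩q⁺ (B⊆ v∈ , v∈)))))

  inducedBlock⇒maximal : ∀ {B} → InducedBlock G B → MaximalIn (V G) B
  inducedBlock⇒maximal {B} (B⊆ , _ , cn , max) = B⊆ , cn , λ C C⊆ cnC B⊆C v∈ →
    p∩q⊆q (V G) B (V-⊆ (max (G [ C ]) ([]-⊑ G C) cnC ([]-mono ⊑-refl B⊆C)) (x∈p∩q⁺ (C⊆ v∈ , v∈)))

  leaf⇔blockSet : ∀ {B} → B ∈ˡ leaves tree ⇔ B ∈ˡ blockSets G
  leaf⇔blockSet = mk⇔
    (λ B∈ → ∈-filter⁺ (inducedBlock? G) (∈-subsets _) (maximal⇒inducedBlock (leaf-maximal tree B∈)))
    (λ B∈ → maximal-leaf tree (inducedBlock⇒maximal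
      (proj₂ (∈-filter⁻ (inducedBlock? G) {xs = subsets n} B∈))))

  module _ {L : List (Subset n)} (L-unique : Unique L)
           (leaf⇔ : ∀ {B} → B ∈ˡ leaves tree ⇔ B ∈ˡ L) where

    Index : Set
    Index = Fin (length (List.map (G [_]) L))

    blockAt : Index → Graph n
    blockAt = List.lookup (List.map (G [_]) L)

    at : Index → Subset n
    at = preimageAt (G [_]) L

    blockAt≡ : ∀ i → blockAt i ≡ G [ at i ]
    blockAt≡ = lookup-map (G [_]) L

    Configurations : (Index → Fin m → ℕ) → Set
    Configurations F = ∀ i → BlockConfiguration (blockAt i) X (coverOver (blockAt i) X H) (F i)

    Sums : (Index → Fin m → ℕ) → Set
    Sums F = ∀ {v x} → v ∈ V G → x ∈ X v →
      f x ≡ ∑[ i < length (List.map (G [_]) L) ] (F i x when v ∈? V (blockAt i))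

    total-at : ∀ F {v x} → total F v x (leaves tree) ≡
      ∑[ i < length (List.map (G [_]) L) ] (F (at i) x when v ∈? V (blockAt i))
    total-at F {v} {x} = trans
      (sum-↭ (↭-map⁺ _ (∼bag⇒↭ (unique∧set⇒bag (leaves-unique tree) L-unique leaf⇔)))) (trans
      (sym (sum-preimageAt (G [_]) (λ B → F B x when v ∈? V (G [ B ])) L))
      (sum-cong-≗ λ i → cong (λ B → F (at i) x when v ∈? V B) (sym (blockAt≡ i))))

    exists : ∃[ F ] Configurations F × Sums F
    exists with tree-exists tree
    ... | F , confs , sums = F ∘ at ,
      (λ i → subst (λ B → BlockConfiguration B X (coverOver B X H) (F (at i)))
        (sym (blockAt≡ i)) (confs (from leaf⇔ (preimageAt-∈ (G [_]) L i)))) ,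
      λ {v} {x} v∈ x∈ → trans (sums v∈ x∈) (total-at F {v} {x})

    extend : (Index → Fin m → ℕ) → Family
    extend F B with any? (λ i → ≡-dec _≟ᵇ_ (at i) B)
    ... | yes (i , _) = F i
    ... | no _        = λ _ → 0

    extend-at : ∀ F i → extend F (at i) ≡ F i
    extend-at F i with any? (λ j → ≡-dec _≟ᵇ_ (at j) (at i))
    ... | yes (j , eq) = cong F (preimageAt-injective (G [_]) L-unique eq)
    ... | no ¬j        = contradiction (i , refl) ¬j

    extend-total : ∀ {F} → Sums F → ∀ {v x} → v ∈ V G → x ∈ X v →
                   f x ≡ total (extend F) v x (leaves tree)
    extend-total {F} sums {v} {x} v∈ x∈ = trans (sums v∈ x∈) (sym (trans (total-at (extend F) {v} {x})
      (sum-cong-≗ λ i → cong (λ h → h x when v ∈? V (blockAt i)) (extend-at F i))))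

    extend-harmonic : ∀ {F} → Configurations F →
                      ∀ {B} → B ∈ˡ leaves tree → Harmonic (G [ B ]) X (B ᴴ) (extend F B)
    extend-harmonic {F} configurations B∈ with preimageAt-surjective (G [_]) (to leaf⇔ B∈)
    ... | i , refl = block⇒harmonic (subst (BlockConfiguration (G [ at i ]) X (at i ᴴ))
      (sym (extend-at F i)) (subst (λ B → BlockConfiguration B X (coverOver B X H) (F i))
        (blockAt≡ i) (configurations i)))

    agree : ∀ {F F′} → Configurations F → Sums F → Configurations F′ → Sums F′ →
            ∀ i {x} → x ∈ V (coverOver (blockAt i) X H) → F i x ≡ F′ i x
    agree {F} {F′} confs sums confs′ sums′ i {x} x∈
      with to (∈-fibres (blockAt i) X) (p∩q⊆q (V H) (fibres (blockAt i) X) x∈)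
    ... | v , v∈ , x∈X = subst₂ (λ h h′ → h x ≡ h′ x) (extend-at F i) (extend-at F′ i)
      (tree-unique (extend F) (extend F′) tree
        (λ B∈ → extend-harmonic confs B∈ , extend-harmonic confs′ B∈) v
        (λ v∈ _ x∈ → trans (sym (extend-total sums v∈ x∈)) (extend-total sums′ v∈ x∈))
        (from leaf⇔ (preimageAt-∈ (G [_]) L i))
        (p∩q⊆q (V G) (at i) (subst (λ B → v ∈ V B) (blockAt≡ i) v∈)) x∈X)

constructible⇒blockTree : {G : Graph n} {X : Assignment n m} {H : Graph m} {f : Fin m → ℕ} →
  Constructible G X H f → Decomposition.BlockTree G X H (V G) f
constructible⇒blockTree constructible = Build.build (constructible⇒uniform constructible) constructible
  (record { graph = embedding-id ; cover = embedding-id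
          ; X-ι = λ _ → mk⇔ (λ z∈ → _ , z∈ , refl) λ { (_ , x∈ , refl) → x∈ } })
  (mk⇔ (λ v∈ → _ , v∈ , refl) λ { (_ , a∈ , refl) → a∈ }) (λ _ _ → refl)

proposition9 : {n m : ℕ} (G : Graph n) (X : Assignment n m) (H : Graph m) (f : Fin m → ℕ) →
    Constructible G X H f →
    ∃! (SameBlockFunctions G X H) (IsBlockDecomposition G X H f)
proposition9 {n} G X H f constructible =
  let F , confs , sums = exists blockSets-unique leaf⇔blockSet in
  F , record { configurations = confs ; sums = sums } ,
  λ d → let module D = IsBlockDecomposition d in
    agree blockSets-unique leaf⇔blockSet confs sums D.configurations D.sums
  where
  open OverTree G X H f (constructible⇒blockTree constructible)
  blockSets-unique : Unique (blockSets G)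
  blockSets-unique = Unique.filter⁺ (inducedBlock? G) (subsets-unique n)
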